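{- Let $E/\mathbb{Q}$ be an elliptic curve with conductor $N_E$ and let $K = \mathbb{Q}(\sqrt{d})$, with $d$ a square-free integer, be a quadratic number field with $E_\mathrm{tors}(\mathbb{Q}) \neq E_\mathrm{tors}(K)$. If $p$ is a prime with $p \mid d$, then either $p \mid N_E$ or $p = 3$.
   Context: $E_\mathrm{tors}(F)$ denotes the torsion subgroup of $E(F)$. -}

module Defs where

open import Data.Nat as ℕ using (ℕ; zero; suc)
open import Data.Nat.Primality using (Prime)
open import Data.Nat.Divisibility as ℕD using ()
open import Data.Integer as ℤ using (ℤ; +_)
open import Data.Integer.Divisibility as ℤD using ()
open import Data.Rational as ℚ using (ℚ; 0ℚ; 1ℚ; _+_; _*_; _-_; -_; 1/_; ↥_; ↧ₙ_)
open import Data.Rational.Properties using () renaming (_≟_ to _≟ℚ_)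
open import Data.Product using (Σ; _×_; _,_; ∃)
open import Relation.Nullary using (¬_; yes; no; Dec)
open import Relation.Binary.PropositionalEquality using (_≡_; _≢_; refl; cong₂)
open import Data.Bool using (Bool; true; false; if_then_else_)

nat : ℕ → ℚ
nat n = + n ℚ./ 1

invℚ : ℚ → ℚ
invℚ q with q ≟ℚ 0ℚ
... | yes _ = 0ℚ
... | no q≢0 = 1/_ q {{ℚ.≢-nonZero q≢0}}

SquareFree : ℤ → Set
SquareFree d = ∀ p → Prime p → ¬ (p ℕ.* p ℕD.∣ ℤ.∣ d ∣)

-- The quadratic field K = ℚ(√d): an element a + b√d is the pair (a , b).
-- (For d square-free and d ≠ 1 this is a field of degree 2 over ℚ.)

Kd : Set
Kd = ℚ × ℚ

module QuadField (d : ℤ) where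
  dQ : ℚ
  dQ = d ℚ./ 1

  ι : ℚ → Kd
  ι q = (q , 0ℚ)

  _⊕_ : Kd → Kd → Kd
  (a , b) ⊕ (c , e) = (a + c , b + e)

  _⊖_ : Kd → Kd → Kd
  (a , b) ⊖ (c , e) = (a - c , b - e)

  _⊗_ : Kd → Kd → Kd
  (a , b) ⊗ (c , e) = (a * c + dQ * (b * e) , a * e + b * c)

  neg : Kd → Kd
  neg (a , b) = (- a , - b)

  -- inverse of a + b√d is (a - b√d)/(a² - d b²); junk value 0 at 0
  inv : Kd → Kd
  inv (a , b) = let n = invℚ (a * a - dQ * (b * b)) in (a * n , - (b * n))

  _⊘_ : Kd → Kd → Kd
  x ⊘ y = x ⊗ inv y

  _≟K_ : (x y : Kd) → Dec (x ≡ y)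
  (a , b) ≟K (c , e) with a ≟ℚ c | b ≟ℚ e
  ... | yes refl | yes refl = yes refl
  ... | no ne | _ = no λ { refl → ne refl }
  ... | yes _ | no ne = no λ { refl → ne refl }

  infixl 6 _⊕_ _⊖_
  infixl 7 _⊗_ _⊘_

-- Weierstrass equations over ℚ
-- y² + a₁xy + a₃y = x³ + a₂x² + a₄x + a₆

record Weierstrass : Set where
  constructor weier
  field
    a₁ a₂ a₃ a₄ a₆ : ℚ

module Invariants (W : Weierstrass) where
  open Weierstrass W
  b₂ b₄ b₆ b₈ Δ : ℚ
  b₂ = a₁ * a₁ + nat 4 * a₂
  b₄ = nat 2 * a₄ + a₁ * a₃
  b₆ = a₃ * a₃ + nat 4 * a₆
  b₈ = a₁ * a₁ * a₆ + nat 4 * a₂ * a₆ - a₁ * a₃ * a₄ + a₂ * a₃ * a₃ - a₄ * a₄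
  Δ = - (b₂ * b₂ * b₈) - nat 8 * (b₄ * b₄ * b₄) - nat 27 * (b₆ * b₆) + nat 9 * b₂ * b₄ * b₆

disc : Weierstrass → ℚ
disc W = Invariants.Δ W

record EllipticCurve : Set where
  constructor ell
  field
    eqn  : Weierstrass
    Δ≢0 : disc eqn ≢ 0ℚ

-- Points of E over K = ℚ(√d) and the group law (Silverman, III.2.3)

data Point : Set where
  O   : Point
  aff : Kd → Kd → Point

module GroupLaw (d : ℤ) (W : Weierstrass) where
  open QuadField d
  open Weierstrass W

  c : ℕ → Kd
  c n = ι (nat n)

  A₁ A₂ A₃ A₄ A₆ : Kd
  A₁ = ι a₁
  A₂ = ι a₂
  A₃ = ι a₃
  A₄ = ι a₄
  A₆ = ι a₆

  OnCurve : Point → Set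
  OnCurve O = Data.Unit.⊤
    where import Data.Unit
  OnCurve (aff x y) =
    y ⊗ y ⊕ A₁ ⊗ x ⊗ y ⊕ A₃ ⊗ y ≡ x ⊗ x ⊗ x ⊕ A₂ ⊗ x ⊗ x ⊕ A₄ ⊗ x ⊕ A₆

  private
    finish : Kd → Kd → Kd → Kd → Point
    finish x₁ x₂ λ' ν =
      let x₃ = λ' ⊗ λ' ⊕ A₁ ⊗ λ' ⊖ A₂ ⊖ x₁ ⊖ x₂
      in aff x₃ (neg ((λ' ⊕ A₁) ⊗ x₃) ⊖ ν ⊖ A₃)

  _⊞_ : Point → Point → Point
  O ⊞ Q = Q
  aff x₁ y₁ ⊞ O = aff x₁ y₁
  aff x₁ y₁ ⊞ aff x₂ y₂ with x₁ ≟K x₂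
  ... | no _ =
        finish x₁ x₂ ((y₂ ⊖ y₁) ⊘ (x₂ ⊖ x₁)) ((y₁ ⊗ x₂ ⊖ y₂ ⊗ x₁) ⊘ (x₂ ⊖ x₁))
  ... | yes _ with (y₁ ⊕ y₂ ⊕ A₁ ⊗ x₂ ⊕ A₃) ≟K ι 0ℚ
  ...   | yes _ = O
  ...   | no _ =
        let den = c 2 ⊗ y₁ ⊕ A₁ ⊗ x₁ ⊕ A₃ in
        finish x₁ x₂
          ((c 3 ⊗ x₁ ⊗ x₁ ⊕ c 2 ⊗ A₂ ⊗ x₁ ⊕ A₄ ⊖ A₁ ⊗ y₁) ⊘ den)
          ((neg (x₁ ⊗ x₁ ⊗ x₁) ⊕ A₄ ⊗ x₁ ⊕ c 2 ⊗ A₆ ⊖ A₃ ⊗ y₁) ⊘ den)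

  mul : ℕ → Point → Point
  mul zero    P = O
  mul (suc n) P = P ⊞ mul n P

  IsTorsion : Point → Set
  IsTorsion P = Σ ℕ λ n → (n ℕ.≥ 1) × (mul n P ≡ O)

  IsRational : Point → Set
  IsRational O = Data.Unit.⊤
    where import Data.Unit
  IsRational (aff (x , x') (y , y')) = (x' ≡ 0ℚ) × (y' ≡ 0ℚ)

-- E_tors(ℚ) ≠ E_tors(K).  Since E_tors(ℚ) ⊆ E_tors(K), this says there is a
-- torsion point of E(K) that is not in E(ℚ).
TorsionGrows : EllipticCurve → ℤ → Set
TorsionGrows E d =
  Σ Point λ P → OnCurve P × IsTorsion P × ¬ IsRational P
  where open GroupLaw d (EllipticCurve.eqn E)

PIntegral : ℕ → ℚ → Set
PIntegral p q = ¬ (p ℕD.∣ ↧ₙ q)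

-- W' is obtained from W by the change of variables
--   x = u²x' + r,  y = u³y' + u²s x' + t  (u ≠ 0)   (Silverman, Table III.3.1)
IsoVia : Weierstrass → Weierstrass → ℚ → ℚ → ℚ → ℚ → Set
IsoVia (weier a₁ a₂ a₃ a₄ a₆) (weier a₁' a₂' a₃' a₄' a₆') u r s t =
  (u ≢ 0ℚ) ×
  (u * a₁' ≡ a₁ + nat 2 * s) ×
  (u * u * a₂' ≡ a₂ - s * a₁ + nat 3 * r - s * s) ×
  (u * u * u * a₃' ≡ a₃ + r * a₁ + nat 2 * t) ×
  (u * u * u * u * a₄' ≡ a₄ - s * a₃ + nat 2 * r * a₂ - (t + r * s) * a₁ + nat 3 * r * r - nat 2 * s * t) ×
  (u * u * u * u * u * u * a₆' ≡ a₆ + r * a₄ + r * r * a₂ + r * r * r - t * a₃ - t * t - r * t * a₁)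

-- E has bad reduction at p: every Weierstrass model of E that is integral at p
-- (in particular a minimal one) has p ∣ Δ, i.e. v_p(Δ_min) > 0.
-- The primes dividing the conductor N_E are exactly the primes of bad reduction.
DividesConductor : ℕ → EllipticCurve → Set
DividesConductor p E =
  ∀ (W' : Weierstrass) (u r s t : ℚ) →
  IsoVia (EllipticCurve.eqn E) W' u r s t →
  PIntegral p (Weierstrass.a₁ W') → PIntegral p (Weierstrass.a₂ W') →
  PIntegral p (Weierstrass.a₃ W') → PIntegral p (Weierstrass.a₄ W') →
  PIntegral p (Weierstrass.a₆ W') →
  p ℕD.∣ ℤ.∣ ↥ disc W' ∣

{-# OPTIONS --safe #-}
module Submission where

-- Suppose p ≠ 3 and E has an equation integral at p whose discriminant is prime to p; let P be a
-- torsion point over K = ℚ(√d) that is not rational.  Since p ramifies in K, the point P and its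
-- conjugate P̄ have the same reduction, so Q = P - P̄ ≠ O reduces to the origin, and x(Q) is
-- rational because Q̄ = -Q.  Near the origin the reciprocal of x grows p-adically smaller under
-- multiplication by p, which is read off the x-coordinates alone: for p ≥ 5 from the recurrence
-- relating x((m + 1)Q), x((m - 1)Q) and x(mQ), for p = 2 from the duplication formula.  As Q is
-- torsion, some p-power multiple of Q must therefore vanish.  For p ≥ 5 that never happens.  For
-- p = 2 a multiple R of P has R - R̄ = T of order 2 near the origin; the line through R and T
-- expresses x(R) by norm and trace equations that have no solution modulo 8, because d is twice a
-- 2-adic unit.

open import Defs hiding (O; aff; disc)
open import Algebra.Bundles using (CommutativeRing)
import Algebra.Solver.Ring as RingSolver
import Algebra.Solver.Ring.AlmostCommutativeRing as ACR
open import Algebra.Structures using (IsCommutativeRing)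
open import Data.Empty using (⊥; ⊥-elim)
open import Data.Fin using (toℕ)
import Data.Fin.Properties as FinP
open import Data.Integer as ℤ using (ℤ; +_)
open import Data.Integer.Divisibility using (_∣_)
import Data.Integer.Divisibility.Signed as ℤS
import Data.Integer.DivMod as ℤDM
import Data.Integer.Properties as ℤP
import Data.Integer.Solver
import Data.Maybe as Maybe
open import Data.Nat as ℕ using (ℕ; zero; suc; z≤n; s≤s)
open import Data.Nat.Coprimality as Coprimality using (Coprime)
import Data.Nat.Divisibility as ℕD
import Data.Nat.DivMod as DivMod
open import Data.Nat.Primality as Primality using (Prime; euclidsLemma)
import Data.Nat.Properties as ℕP
open import Data.Product using (∃; _×_; _,_; proj₁; proj₂)
open import Data.Rational as ℚ using (ℚ; mkℚ; 0ℚ; ↥_; ↧_)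
import Data.Rational.Properties as ℚP
open import Data.Rational.Unnormalised as ℚᵘ using (mkℚᵘ; *≡*)
import Data.Rational.Unnormalised.Properties as ℚᵘP
open import Data.Sum using (_⊎_; inj₁; inj₂)
open import Data.Unit using (⊤; tt)
open import Level using (0ℓ)
open import Relation.Binary.PropositionalEquality
  using (_≡_; _≢_; refl; sym; trans; cong; cong₂; subst; subst₂; isEquivalence; module ≡-Reasoning)
open import Relation.Nullary using (¬_; Dec; yes; no)
open import Relation.Nullary.Decidable using (dec⇒maybe; from-no)

-- Why 3 is exceptional: p has ramification index 2 in K, and by the theory of formal groups a
-- nonzero point reducing to the origin can be killed by p only if p - 1 ≤ 2. For p ≥ 5 the argument
-- therefore ends near the origin; for p = 2 points of order 2 survive there and a congruence has to
-- exclude them; for p = 3 points of order 3 may survive.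
--
-- Rationality of x(Q) matters because an element of ℚ in the maximal ideal of K is divisible by p
-- and not merely by √d. Without this gain the recurrence for p ≥ 5 would be too imprecise.
--
-- At p = 2 completing the square destroys integrality: α, β, γ acquire denominators. Hence
-- integrality is always expressed through b₂ = 4α, b₄ = 2β, b₆ = 4γ and b₈ = 4αγ - β², and integral
-- ordinates are recovered from the Weierstrass equation.
--
-- Formal groups are replaced by explicit identities for x-coordinates. They presuppose that the
-- chord and tangent law is a group law, which is proved over an arbitrary field and then used over
-- K.

record Field : Set₁ where
  infixl 6 _+_
  infixl 7 _*_
  infix 8 -_
  infix 4 _≟_
  field
    Carrier : Set
    _+_ _*_ : Carrier → Carrier → Carrier
    -_ : Carrier → Carrier
    -- The image of ℤ is part of the structure so that the ring solver can compute with integers.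
    # : ℤ → Carrier
    isCommutativeRing : IsCommutativeRing _≡_ _+_ _*_ -_ (# (+ 0)) (# (+ 1))
    _≟_ : (x y : Carrier) → Dec (x ≡ y)
    inverse : ∀ x → x ≢ # (+ 0) → ∃ λ y → x * y ≡ # (+ 1)
    #-+ : ∀ i j → # (i ℤ.+ j) ≡ # i + # j
    #-* : ∀ i j → # (i ℤ.* j) ≡ # i * # j
    #-neg : ∀ i → # (ℤ.- i) ≡ - # i

-- Polynomial identities over a field

module FieldTheory (F : Field) where
  open Field F public
  0# 1# : Carrier
  0# = # (+ 0)
  1# = # (+ 1)

  infixl 6 _-_
  _-_ : Carrier → Carrier → Carrier
  x - y = x + - y

  commutativeRing : CommutativeRing 0ℓ 0ℓ
  commutativeRing = record { isCommutativeRing = isCommutativeRing }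

  almostCommutativeRing : ACR.AlmostCommutativeRing 0ℓ 0ℓ
  almostCommutativeRing = ACR.fromCommutativeRing commutativeRing

  fromℤ-morphism : CommutativeRing.rawRing ℤP.+-*-commutativeRing
                   ACR.-Raw-AlmostCommutative⟶ almostCommutativeRing
  fromℤ-morphism = record
    { ⟦_⟧ = # ; +-homo = #-+ ; *-homo = #-* ; -‿homo = #-neg ; 0-homo = refl ; 1-homo = refl }

  open RingSolver (CommutativeRing.rawRing ℤP.+-*-commutativeRing) almostCommutativeRing fromℤ-morphism
    (λ i j → Maybe.map (cong #) (dec⇒maybe (i ℤ.≟ j))) public
    using (Polynomial; solve; _:=_; _:+_; _:*_; :-_; _:-_)
    renaming (con to constant)

  con : ∀ {n} → ℕ → Polynomial n
  con m = constant (+ m)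

  private
    lin : ∀ {l r s t} → l + t ≡ r + s → s ≡ t → l ≡ r
    lin {l} {r} {s} e refl = begin
      l           ≡⟨ solve 2 (λ l s → l := l :+ s :- s) refl l s ⟩
      l + s - s   ≡⟨ cong (_- s) e ⟩
      r + s - s   ≡⟨ solve 2 (λ r s → r :+ s :- s := r) refl r s ⟩
      r           ∎
      where open ≡-Reasoning

  -- l - r = Σ cᵢ (xᵢ - yᵢ), with both sides moved so that the premise is a polynomial identity.
  combine₁ : ∀ {l r x₁ y₁} c₁ → x₁ ≡ y₁ → l + c₁ * y₁ ≡ r + c₁ * x₁ → l ≡ r
  combine₁ c₁ refl e = lin e refl

  combine₂ : ∀ {l r x₁ y₁ x₂ y₂} c₁ → x₁ ≡ y₁ → ∀ c₂ → x₂ ≡ y₂ →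
    l + (c₁ * y₁ + c₂ * y₂) ≡ r + (c₁ * x₁ + c₂ * x₂) → l ≡ r
  combine₂ c₁ refl c₂ refl e = lin e refl

  combine₃ : ∀ {l r x₁ y₁ x₂ y₂ x₃ y₃} c₁ → x₁ ≡ y₁ → ∀ c₂ → x₂ ≡ y₂ → ∀ c₃ → x₃ ≡ y₃ →
    l + (c₁ * y₁ + c₂ * y₂ + c₃ * y₃) ≡ r + (c₁ * x₁ + c₂ * x₂ + c₃ * x₃) → l ≡ r
  combine₃ c₁ refl c₂ refl c₃ refl e = lin e refl

  *-cancelˡ : ∀ {x y z} → x ≢ 0# → x * y ≡ x * z → y ≡ z
  *-cancelˡ {x} {y} {z} x≢0 e with i , xi≡1 ← inverse x x≢0 =
    combine₂ i e (z - y) xi≡1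
      (solve 4 (λ x y z i → y :+ (i :* (x :* z) :+ (z :- y) :* con 1) :=
          z :+ (i :* (x :* y) :+ (z :- y) :* (x :* i))) refl x y z i)

  -≡0⇒≡ : ∀ {x y} → x - y ≡ 0# → x ≡ y
  -≡0⇒≡ {x} {y} e = combine₁ 1# e
    (solve 2 (λ x y → x :+ con 1 :* con 0 := y :+ con 1 :* (x :- y)) refl x y)

  ≡⇒-≡0 : ∀ {x y} → x ≡ y → x - y ≡ 0#
  ≡⇒-≡0 {x} refl = solve 1 (λ x → x :- x := con 0) refl x

  *≡0⇒ : ∀ {x y} → x ≢ 0# → x * y ≡ 0# → y ≡ 0#
  *≡0⇒ {x} x≢0 e = *-cancelˡ x≢0 (trans e (solve 1 (λ x → con 0 := x :* con 0) refl x))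

-- The group law on Y² = X³ + αX² + βX + γ

module _ (F : Field) where
  open FieldTheory F

  module CubicCurve (α β γ : Carrier) where

    data Pt : Set where
      O : Pt
      aff : (x y : Carrier) → Pt

    _≟Pt_ : (P Q : Pt) → Dec (P ≡ Q)
    O ≟Pt O = yes refl
    O ≟Pt aff _ _ = no λ ()
    aff _ _ ≟Pt O = no λ ()
    aff x y ≟Pt aff x' y' with x ≟ x' | y ≟ y'
    ... | yes refl | yes refl = yes refl
    ... | no ne | _ = no λ { refl → ne refl }
    ... | yes _ | no ne = no λ { refl → ne refl }

    f : Carrier → Carrier
    f x = x * x * x + α * x * x + β * x + γ

    -- The divided difference (f x - f y) / (x - y) written as a polynomial; `D x x` is the
    -- derivative of `f`.
    D : Carrier → Carrier → Carrier
    D x y = x * x + x * y + y * y + α * (x + y) + β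

    On : Pt → Set
    On O = ⊤
    On (aff x y) = y * y ≡ f x

    neg : Pt → Pt
    neg O = O
    neg (aff x y) = aff x (- y)

    chord : Carrier → Carrier → Carrier → Carrier → Pt
    chord λ' x₁ y₁ x₂ = let x₃ = λ' * λ' - α - x₁ - x₂ in aff x₃ (λ' * (x₁ - x₃) - y₁)

    infixl 6 _⊕_
    _⊕_ : Pt → Pt → Pt
    O ⊕ Q = Q
    aff x₁ y₁ ⊕ O = aff x₁ y₁
    aff x₁ y₁ ⊕ aff x₂ y₂ with x₁ - x₂ ≟ 0#
    ... | no x≢ = chord ((y₁ - y₂) * proj₁ (inverse (x₁ - x₂) x≢)) x₁ y₁ x₂
    ... | yes _ with y₁ + y₂ ≟ 0#
    ...   | yes _ = O
    ...   | no y≢ = chord (D x₁ x₂ * proj₁ (inverse (y₁ + y₂) y≢)) x₁ y₁ x₂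

    infixr 7 _·_
    _·_ : ℕ → Pt → Pt
    zero · P = O
    suc n · P = P ⊕ n · P

    Opposite : Carrier → Carrier → Carrier → Carrier → Set
    Opposite x₁ y₁ x₂ y₂ = x₁ - x₂ ≡ 0# × y₁ + y₂ ≡ 0#

    -- Both equations for the slope, cleared of denominators. For two points on the curve that are
    -- not opposite, one of the coefficients x₁ - x₂ and y₁ + y₂ is nonzero and determines the
    -- slope, so that chords and tangents need no separate treatment.
    record Slope (λ' x₁ y₁ x₂ y₂ : Carrier) : Set where
      constructor slope
      field
        secant  : (x₁ - x₂) * λ' ≡ y₁ - y₂
        tangent : (y₁ + y₂) * λ' ≡ D x₁ x₂
    open Slope

    private
      fP DP : ∀ {n} (α β γ x : Polynomial n) → Polynomial n
      fP α β γ x = x :* x :* x :+ α :* x :* x :+ β :* x :+ γ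
      DP α β x y = x :* x :+ x :* y :+ y :* y :+ α :* (x :+ y) :+ β

    ⊕-slope : ∀ {x₁ y₁ x₂ y₂ λ'} → ¬ Opposite x₁ y₁ x₂ y₂ → Slope λ' x₁ y₁ x₂ y₂ →
      aff x₁ y₁ ⊕ aff x₂ y₂ ≡ chord λ' x₁ y₁ x₂
    ⊕-slope {x₁} {y₁} {x₂} {y₂} {λ'} ¬opp (slope e₁ e₂) with x₁ - x₂ ≟ 0#
    ... | no x≢ with i , xi ← inverse (x₁ - x₂) x≢ = cong (λ l → chord l x₁ y₁ x₂) (sym
      (combine₂ i e₁ (- λ') xi (solve 4 (λ l x y i → l :+ (i :* y :+ :- l :* con 1) :=
        y :* i :+ (i :* (x :* l) :+ :- l :* (x :* i))) refl λ' (x₁ - x₂) (y₁ - y₂) i)))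
    ... | yes x= with y₁ + y₂ ≟ 0#
    ...   | yes y= = ⊥-elim (¬opp (x= , y=))
    ...   | no y≢ with i , yi ← inverse (y₁ + y₂) y≢ = cong (λ l → chord l x₁ y₁ x₂) (sym
      (combine₂ i e₂ (- λ') yi (solve 4 (λ l x y i → l :+ (i :* y :+ :- l :* con 1) :=
        y :* i :+ (i :* (x :* l) :+ :- l :* (x :* i))) refl λ' (y₁ + y₂) (D x₁ x₂) i)))

    ⊕-opposite : ∀ {x₁ y₁ x₂ y₂} → Opposite x₁ y₁ x₂ y₂ → aff x₁ y₁ ⊕ aff x₂ y₂ ≡ O
    ⊕-opposite {x₁} {y₁} {x₂} {y₂} (x= , y=) with x₁ - x₂ ≟ 0#
    ... | no x≢ = ⊥-elim (x≢ x=)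
    ... | yes _ with y₁ + y₂ ≟ 0#
    ...   | yes _ = refl
    ...   | no y≢ = ⊥-elim (y≢ y=)

    On-difference : ∀ {x₁ y₁ x₂ y₂} → On (aff x₁ y₁) → On (aff x₂ y₂) →
      (y₁ + y₂) * (y₁ - y₂) ≡ (x₁ - x₂) * D x₁ x₂
    On-difference {x₁} {y₁} {x₂} {y₂} on₁ on₂ = combine₂ 1# on₁ (- 1#) on₂
      (solve 7 (λ α β γ x₁ y₁ x₂ y₂ → (y₁ :+ y₂) :* (y₁ :- y₂) :+
          (con 1 :* fP α β γ x₁ :+ :- con 1 :* fP α β γ x₂) :=
        (x₁ :- x₂) :* DP α β x₁ x₂ :+ (con 1 :* (y₁ :* y₁) :+ :- con 1 :* (y₂ :* y₂)))
        refl α β γ x₁ y₁ x₂ y₂)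

    secant⇒slope : ∀ {x₁ y₁ x₂ y₂ λ'} → On (aff x₁ y₁) → On (aff x₂ y₂) → x₁ - x₂ ≢ 0# →
      (x₁ - x₂) * λ' ≡ y₁ - y₂ → Slope λ' x₁ y₁ x₂ y₂
    secant⇒slope {x₁} {y₁} {x₂} {y₂} {λ'} on₁ on₂ x≢ e = slope e (*-cancelˡ x≢
      (combine₂ (y₁ + y₂) e 1# (On-difference on₁ on₂)
        (solve 5 (λ l x s m d → x :* (s :* l) :+ (s :* m :+ con 1 :* (x :* d)) :=
            x :* d :+ (s :* (x :* l) :+ con 1 :* (s :* m)))
          refl λ' (x₁ - x₂) (y₁ + y₂) (y₁ - y₂) (D x₁ x₂))))

    tangent⇒slope : ∀ {x₁ y₁ x₂ y₂ λ'} → On (aff x₁ y₁) → On (aff x₂ y₂) → y₁ + y₂ ≢ 0# →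
      (y₁ + y₂) * λ' ≡ D x₁ x₂ → Slope λ' x₁ y₁ x₂ y₂
    tangent⇒slope {x₁} {y₁} {x₂} {y₂} {λ'} on₁ on₂ y≢ e = slope (*-cancelˡ y≢
      (combine₂ (x₁ - x₂) e (- 1#) (On-difference on₁ on₂)
        (solve 5 (λ l x s m d → s :* (x :* l) :+ (x :* d :+ :- con 1 :* (x :* d)) :=
            s :* m :+ (x :* (s :* l) :+ :- con 1 :* (s :* m)))
          refl λ' (x₁ - x₂) (y₁ + y₂) (y₁ - y₂) (D x₁ x₂)))) e

    SumView : (x₁ y₁ x₂ y₂ : Carrier) → Set
    SumView x₁ y₁ x₂ y₂ = Opposite x₁ y₁ x₂ y₂ ⊎
      (¬ Opposite x₁ y₁ x₂ y₂ × ∃ λ λ' → Slope λ' x₁ y₁ x₂ y₂)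

    sumView : ∀ {x₁ y₁ x₂ y₂} → On (aff x₁ y₁) → On (aff x₂ y₂) → SumView x₁ y₁ x₂ y₂
    sumView {x₁} {y₁} {x₂} {y₂} on₁ on₂ with x₁ - x₂ ≟ 0#
    ... | no x≢ with i , xi ← inverse (x₁ - x₂) x≢ = inj₂ ((λ opp → x≢ (proj₁ opp)) ,
      i * (y₁ - y₂) , secant⇒slope on₁ on₂ x≢ (combine₁ (y₁ - y₂) xi
        (solve 3 (λ x m i → x :* (i :* m) :+ m :* con 1 := m :+ m :* (x :* i))
          refl (x₁ - x₂) (y₁ - y₂) i)))
    ... | yes x= with y₁ + y₂ ≟ 0#
    ...   | yes y= = inj₁ (x= , y=)
    ...   | no y≢ with i , yi ← inverse (y₁ + y₂) y≢ = inj₂ ((λ opp → y≢ (proj₂ opp)) ,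
      i * D x₁ x₂ , tangent⇒slope on₁ on₂ y≢ (combine₁ (D x₁ x₂) yi
        (solve 3 (λ x m i → x :* (i :* m) :+ m :* con 1 := m :+ m :* (x :* i))
          refl (y₁ + y₂) (D x₁ x₂) i)))

    opposite-sym : ∀ {x₁ y₁ x₂ y₂} → Opposite x₁ y₁ x₂ y₂ → Opposite x₂ y₂ x₁ y₁
    opposite-sym {x₁} {y₁} {x₂} {y₂} (x= , y=) =
        combine₁ (- 1#) x= (solve 2 (λ x y → y :- x :+ :- con 1 :* con 0 :=
          con 0 :+ :- con 1 :* (x :- y)) refl x₁ x₂)
      , trans (solve 2 (λ x y → x :+ y := y :+ x) refl y₂ y₁) y=

    slope-sym : ∀ {x₁ y₁ x₂ y₂ λ'} → Slope λ' x₁ y₁ x₂ y₂ → Slope λ' x₂ y₂ x₁ y₁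
    slope-sym {x₁} {y₁} {x₂} {y₂} {λ'} (slope e₁ e₂) = slope
      (combine₁ (- 1#) e₁ (solve 5 (λ l x y u v → (y :- x) :* l :+ :- con 1 :* (u :- v) :=
          v :- u :+ :- con 1 :* ((x :- y) :* l)) refl λ' x₁ x₂ y₁ y₂))
      (combine₁ 1# e₂ (solve 7 (λ α β l x y u v → (v :+ u) :* l :+ con 1 :* DP α β x y :=
          DP α β y x :+ con 1 :* ((u :+ v) :* l)) refl α β λ' x₁ x₂ y₁ y₂))

    aff-cong : ∀ {x₁ y₁ x₂ y₂} → x₁ ≡ x₂ → y₁ ≡ y₂ → aff x₁ y₁ ≡ aff x₂ y₂
    aff-cong = cong₂ aff

    chord-sym : ∀ {x₁ y₁ x₂ y₂ λ'} → (x₁ - x₂) * λ' ≡ y₁ - y₂ →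
      chord λ' x₁ y₁ x₂ ≡ chord λ' x₂ y₂ x₁
    chord-sym {x₁} {y₁} {x₂} {y₂} {λ'} e = aff-cong
      (solve 4 (λ α l x y → l :* l :- α :- x :- y := l :* l :- α :- y :- x) refl α λ' x₁ x₂)
      (combine₁ 1# e (solve 6 (λ α l x y u v →
        l :* (x :- (l :* l :- α :- x :- y)) :- u :+ con 1 :* (u :- v) :=
        l :* (y :- (l :* l :- α :- y :- x)) :- v :+ con 1 :* ((x :- y) :* l))
        refl α λ' x₁ x₂ y₁ y₂))

    ⊕-comm : ∀ P Q → On P → On Q → P ⊕ Q ≡ Q ⊕ P
    ⊕-comm O O _ _ = refl
    ⊕-comm O (aff _ _) _ _ = refl
    ⊕-comm (aff _ _) O _ _ = refl
    ⊕-comm (aff x₁ y₁) (aff x₂ y₂) on₁ on₂ with sumView on₁ on₂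
    ... | inj₁ opp = trans (⊕-opposite opp) (sym (⊕-opposite (opposite-sym opp)))
    ... | inj₂ (¬opp , λ' , sl) = trans (⊕-slope ¬opp sl) (trans (chord-sym (secant sl))
      (sym (⊕-slope (λ opp → ¬opp (opposite-sym opp)) (slope-sym sl))))

    -- On the line through the two points the cubic minus the square of the line has the three
    -- roots x₁, x₂ and x₃; dividing by X - x₁ keeps this meaningful when roots coincide.
    line-roots : ∀ {x₁ y₁ x₂ y₂ λ'} → Slope λ' x₁ y₁ x₂ y₂ → ∀ X →
      let x₃ = λ' * λ' - α - x₁ - x₂ in
      D X x₁ - (y₁ + y₁) * λ' - λ' * λ' * (X - x₁) ≡ (X - x₂) * (X - x₃)
    line-roots {x₁} {y₁} {x₂} {y₂} {λ'} (slope e₁ e₂) X = combine₂ λ' e₁ (- 1#) e₂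
      (solve 8 (λ α β l x₁ y₁ x₂ y₂ X →
        DP α β X x₁ :- (y₁ :+ y₁) :* l :- l :* l :* (X :- x₁) :+
          (l :* (y₁ :- y₂) :+ :- con 1 :* DP α β x₁ x₂) :=
        (X :- x₂) :* (X :- (l :* l :- α :- x₁ :- x₂)) :+
          (l :* ((x₁ :- x₂)   :* l) :+ :- con 1 :* ((y₁ :+ y₂) :* l)))
        refl α β λ' x₁ y₁ x₂ y₂ X)

    -- Before reflection the sum lies on the line through the two points, so the slope to it from
    -- the first point is unchanged. The tangent equation is `line-roots` evaluated at the root x₃.
    chord-slope : ∀ {x₁ y₁ x₂ y₂ λ'} → Slope λ' x₁ y₁ x₂ y₂ →
      let x₃ = λ' * λ' - α - x₁ - x₂ in Slope λ' x₁ y₁ x₃ (- (λ' * (x₁ - x₃) - y₁))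
    chord-slope {x₁} {y₁} {x₂} {y₂} {λ'} sl = slope
      (solve 3 (λ l x y → x :* l := y :- :- (l :* x :- y)) refl λ' (x₁ - x₃) y₁)
      (combine₁ (- 1#) (line-roots sl x₃) (solve 7 (λ α β l x₁ y₁ x₂ x₃ →
        (y₁ :+ :- (l :* (x₁ :- x₃) :- y₁)) :* l :+ :- con 1 :* ((x₃ :- x₂) :* (x₃ :- x₃)) :=
        DP α β x₁ x₃ :+ :- con 1 :* (DP α β x₃ x₁ :- (y₁ :+ y₁) :* l :- l :* l :* (x₃ :- x₁)))
        refl α β λ' x₁ y₁ x₂ x₃))
      where x₃ = λ' * λ' - α - x₁ - x₂

    On-chord : ∀ {x₁ y₁ x₂ y₂ λ'} → On (aff x₁ y₁) → Slope λ' x₁ y₁ x₂ y₂ → On (chord λ' x₁ y₁ x₂)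
    On-chord {x₁} {y₁} {x₂} {y₂} {λ'} on₁ sl = combine₂ 1# on₁ (x₃ - x₁) (tangent (chord-slope sl))
      (solve 7 (λ α β γ l x₁ y₁ x₃ → let y₃ = l :* (x₁ :- x₃) :- y₁ in
        y₃ :* y₃ :+ (con 1 :* fP α β γ x₁ :+ (x₃ :- x₁) :* DP α β x₁ x₃) :=
        fP α β γ x₃ :+ (con 1 :* (y₁ :* y₁) :+ (x₃ :- x₁) :* ((y₁ :+ :- y₃) :* l)))
        refl α β γ λ' x₁ y₁ x₃)
      where x₃ = λ' * λ' - α - x₁ - x₂

    On-⊕ : ∀ P Q → On P → On Q → On (P ⊕ Q)
    On-⊕ O Q _ on = on
    On-⊕ (aff _ _) O on _ = on
    On-⊕ (aff _ _) (aff _ _) on₁ on₂ with sumView on₁ on₂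
    ... | inj₁ opp = subst On (sym (⊕-opposite opp)) tt
    ... | inj₂ (¬opp , λ' , sl) = subst On (sym (⊕-slope ¬opp sl)) (On-chord on₁ sl)

    On-neg : ∀ P → On P → On (neg P)
    On-neg O _ = tt
    On-neg (aff x y) on = trans (solve 1 (λ y → :- y :* :- y := y :* y) refl y) on

    neg-neg : ∀ P → neg (neg P) ≡ P
    neg-neg O = refl
    neg-neg (aff x y) = cong (aff x) (solve 1 (λ y → :- (:- y) := y) refl y)

    neg-opposite : ∀ x y → Opposite x y x (- y)
    neg-opposite x y = solve 1 (λ x → x :- x := con 0) refl x , solve 1 (λ x → x :- x := con 0) refl y

    ⊕-inverseʳ : ∀ P → P ⊕ neg P ≡ O
    ⊕-inverseʳ O = refl
    ⊕-inverseʳ (aff x y) = ⊕-opposite (neg-opposite x y)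

    ⊕-identityʳ : ∀ P → P ⊕ O ≡ P
    ⊕-identityʳ O = refl
    ⊕-identityʳ (aff _ _) = refl

    opposite⇒neg : ∀ {x₁ y₁ x₂ y₂} → Opposite x₁ y₁ x₂ y₂ → aff x₂ y₂ ≡ neg (aff x₁ y₁)
    opposite⇒neg {x₁} {y₁} {x₂} {y₂} (x= , y=) = aff-cong (sym (-≡0⇒≡ x=))
      (combine₁ 1# y= (solve 2 (λ y₁ y₂ → y₂ :+ con 1 :* con 0 := :- y₁ :+ con 1 :* (y₁ :+ y₂)) refl y₁ y₂))

    opposite-neg : ∀ {x₁ y₁ x₂ y₂} → Opposite x₁ y₁ x₂ y₂ → Opposite x₁ (- y₁) x₂ (- y₂)
    opposite-neg {x₁} {y₁} {x₂} {y₂} (x= , y=) = x= ,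
      combine₁ (- 1#) y= (solve 2 (λ u v → :- u :+ :- v :+ :- con 1 :* con 0 :=
        con 0 :+ :- con 1 :* (u :+ v)) refl y₁ y₂)

    slope-neg : ∀ {x₁ y₁ x₂ y₂ λ'} → Slope λ' x₁ y₁ x₂ y₂ → Slope (- λ') x₁ (- y₁) x₂ (- y₂)
    slope-neg {x₁} {y₁} {x₂} {y₂} {λ'} (slope e₁ e₂) = slope
      (combine₁ (- 1#) e₁ (solve 4 (λ l x u v → x :* :- l :+ :- con 1 :* (u :- v) :=
        :- u :- :- v :+ :- con 1 :* (x :* l)) refl λ' (x₁ - x₂) y₁ y₂))
      (trans (solve 3 (λ l u v → (:- u :+ :- v) :* :- l := (u :+ v) :* l) refl λ' y₁ y₂) e₂)

    -‿involutive : ∀ x → - - x ≡ x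
    -‿involutive = solve 1 (λ x → :- (:- x) := x) refl

    neg-⊕ : ∀ P Q → On P → On Q → neg (P ⊕ Q) ≡ neg P ⊕ neg Q
    neg-⊕ O Q _ _ = refl
    neg-⊕ (aff _ _) O _ _ = refl
    neg-⊕ (aff x₁ y₁) (aff x₂ y₂) on₁ on₂ with sumView on₁ on₂
    ... | inj₁ opp = trans (cong neg (⊕-opposite opp)) (sym (⊕-opposite (opposite-neg opp)))
    ... | inj₂ (¬opp , λ' , sl) = trans (cong neg (⊕-slope ¬opp sl))
      (trans (aff-cong (solve 4 (λ α l x y → l :* l :- α :- x :- y := :- l :* :- l :- α :- x :- y) refl α λ' x₁ x₂)
         (solve 5 (λ α l x y u → :- (l :* (x :- (l :* l :- α :- x :- y)) :- u) :=
           :- l :* (x :- (:- l :* :- l :- α :- x :- y)) :- :- u) refl α λ' x₁ x₂ y₁))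
       (sym (⊕-slope (λ opp → ¬opp (subst₂ (λ u v → Opposite x₁ u x₂ v) (-‿involutive y₁) (-‿involutive y₂)
         (opposite-neg opp))) (slope-neg sl))))

    module Associativity
      (nonsingular : ∀ {x y} → On (aff x y) → y + y ≡ 0# → D x x ≡ 0# → ⊥) where

      -- P, Q and the reflected sum are collinear. Adding -P to the sum runs along the mirror image
      -- of that line, of slope -λ, and returns to Q.
      ⊕-cancel : ∀ P Q → On P → On Q → (P ⊕ Q) ⊕ neg P ≡ Q
      ⊕-cancel O Q _ _ = ⊕-identityʳ Q
      ⊕-cancel (aff x y) O _ _ = ⊕-inverseʳ (aff x y)
      ⊕-cancel (aff x₁ y₁) (aff x₂ y₂) on₁ on₂ with sumView on₁ on₂
      ... | inj₁ opp = trans (cong (_⊕ aff x₁ (- y₁)) (⊕-opposite opp)) (sym (opposite⇒neg opp))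
      ... | inj₂ (¬opp , λ' , sl) = trans (cong (_⊕ aff x₁ (- y₁)) (⊕-slope ¬opp sl)) (trans (⊕-slope ¬opp' sl')
        (aff-cong (solve 4 (λ α l x y → let z = l :* l :- α :- x :- y in :- l :* :- l :- α :- z :- x := y)
                     refl α λ' x₁ x₂)
          (combine₁ (- 1#) (secant sl) (solve 6 (λ α l x y u v → let z = l :* l :- α :- x :- y in
              :- l :* (z :- (:- l :* :- l :- α :- z :- x)) :- (l :* (x :- z) :- u) :+
                :- con 1 :* (u :- v) :=
              v :+ :- con 1 :* ((x :- y) :* l)) refl α λ' x₁ x₂ y₁ y₂))))
        where
        x₃ = λ' * λ' - α - x₁ - x₂
        y₃ = λ' * (x₁ - x₃) - y₁
        sl' : Slope (- λ') x₃ y₃ x₁ (- y₁)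
        sl' = slope-sym (subst (Slope (- λ') x₁ (- y₁) x₃) (-‿involutive y₃) (slope-neg (chord-slope sl)))
        -- If P ⊕ Q were P, a line of finite slope would contain both P and -P, forcing 2y₁ = 0, and
        -- `line-roots` at x₁ would make the derivative vanish: P would be singular.
        ¬opp' : ¬ Opposite x₃ y₃ x₁ (- y₁)
        ¬opp' (x= , y=) = nonsingular on₁ 2y≡0 (combine₃ 1# (line-roots sl x₁) (x₂ - x₁) x= λ' 2y≡0
          (solve 7 (λ α β l x₁ x₂ x₃ y →
            DP α β x₁ x₁ :+ (con 1 :* ((x₁ :- x₂) :* (x₁ :- x₃)) :+ (x₂ :- x₁) :* con 0 :+ l :* con 0) :=
            con 0 :+ (con 1 :* (DP α β x₁ x₁ :- (y :+ y) :* l :- l :* l :* (x₁ :- x₁)) :+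
              (x₂ :- x₁) :* (x₃ :- x₁) :+ l :* (y :+ y))) refl α β λ' x₁ x₂ x₃ y₁))
          where
          2y≡0 : y₁ + y₁ ≡ 0#
          2y≡0 = combine₂ (- λ') x= (- 1#) y= (solve 4 (λ l x z y →
            y :+ y :+ (:- l :* con 0 :+ :- con 1 :* con 0) :=
            con 0 :+ (:- l :* (z :- x) :+ :- con 1 :* (l :* (x :- z) :- y :+ :- y))) refl λ' x₁ x₃ y₁)

      rotate : ∀ P Q R → On P → On Q → On R → P ⊕ Q ≡ neg R → R ⊕ P ≡ neg Q
      rotate P Q R onP onQ onR e = begin
        R ⊕ P                 ≡⟨ neg-neg (R ⊕ P) ⟨
        neg (neg (R ⊕ P))     ≡⟨ cong neg (neg-⊕ R P onR onP) ⟩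
        neg (neg R ⊕ neg P)   ≡⟨ cong (λ S → neg (S ⊕ neg P)) e ⟨
        neg (P ⊕ Q ⊕ neg P)   ≡⟨ cong neg (⊕-cancel P Q onP onQ) ⟩
        neg Q                 ∎
        where open ≡-Reasoning

      -- The parabola through three points P, Q, R has leading coefficient a, a second divided
      -- difference; the function (line QR)(line P,Q+R)/(vertical at Q+R) is a multiple of it.
      module _ {xP yP xQ yQ xR xT yT λ₁ λ₂ μ a}
        (onP : On (aff xP yP)) (onQ : On (aff xQ yQ))
        (slPQ : Slope λ₁ xP yP xQ yQ) (slPT : Slope μ xP yP xT yT)
        (line : - yT ≡ yQ + λ₂ * (xT - xQ)) (ha : a * (xP - xR) ≡ λ₁ - λ₂) where
        private
          minus : (xP - xQ) * (a * (xP - xR)) ≡ yP - (yQ + λ₂ * (xP - xQ))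
          minus = combine₂ (xP - xQ) ha 1# (secant slPQ) (solve 6 (λ d ar yP yQ l k →
            d :* ar :+ (d :* (k :- l) :+ con 1 :* (yP :- yQ)) :=
            yP :- (yQ :+ l :* d) :+ (d :* ar :+ con 1 :* (d :* k)))
            refl (xP - xQ) (a * (xP - xR)) yP yQ λ₂ λ₁)

          plus : (xP - xT) * (μ + λ₂) ≡ yP + (yQ + λ₂ * (xP - xQ))
          plus = combine₂ 1# (secant slPT) 1# line (solve 8 (λ p yP q yQ t yT l m →
            (p :- t) :* (m :+ l) :+ (con 1 :* (yP :- yT) :+ con 1 :* (yQ :+ l :* (t :- q))) :=
            yP :+ (yQ :+ l :* (p :- q)) :+ (con 1 :* ((p :- t) :* m) :+ con 1 :* :- yT))
            refl xP yP xQ yQ xT yT λ₂ μ)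

        -- Let L be the value at xP of the line through Q and R. Then `minus` and `plus` factor yP -
        -- L and yP + L, while `line-roots` shows yP² - L² to be the product of the three
        -- differences of abscissae.
        slope-sum-generic : xP - xQ ≢ 0# → xP - xR ≢ 0# → xP - xT ≢ 0# →
          D xP xQ - (yQ + yQ) * λ₂ - λ₂ * λ₂ * (xP - xQ) ≡ (xP - xR) * (xP - xT) → (μ + λ₂) * a ≡ 1#
        slope-sum-generic xP≢xQ xP≢xR xP≢xT roots = *-cancelˡ xP≢xQ (*-cancelˡ xP≢xR (*-cancelˡ xP≢xT (begin
          (xP - xT) * ((xP - xR) * ((xP - xQ) * ((μ + λ₂) * a)))
            ≡⟨ solve 5 (λ t r q m a → t :* (r :* (q :* (m :* a))) := t :* m :* (q :* (a :* r)))
                 refl (xP - xT) (xP - xR) (xP - xQ) (μ + λ₂) a ⟩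
          (xP - xT) * (μ + λ₂) * ((xP - xQ) * (a * (xP - xR)))
            ≡⟨ cong₂ _*_ plus minus ⟩
          (yP + (yQ + λ₂ * (xP - xQ))) * (yP - (yQ + λ₂ * (xP - xQ)))
            ≡⟨ combine₂ 1# (On-difference onP onQ) (xP - xQ) roots
                 (solve 7 (λ d e yP yQ l r t →
                   (yP :+ (yQ :+ l :* d)) :* (yP :- (yQ :+ l :* d)) :+
                     (con 1 :* (d :* e) :+ d :* (r :* t)) :=
                   t :* (r :* (d :* con 1)) :+
                     (con 1 :* ((yP :+ yQ) :* (yP :- yQ)) :+
                      d :* (e :- (yQ :+ yQ) :* l :- l :* l :* d)))
                 refl (xP - xQ) (D xP xQ) yP yQ λ₂ (xP - xR) (xP - xT)) ⟩
          (xP - xT) * ((xP - xR) * ((xP - xQ) * 1#)) ∎)))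
          where open ≡-Reasoning

        -- For P = T the factor yP + L vanishes together with xP - xT, so the tangent equation at T
        -- takes the place of `plus`.
        slope-sum-tangent : yP + yT ≢ 0# → xP ≡ xT → yP ≡ yT →
          D xP xT - (- yT + - yT) * λ₂ - λ₂ * λ₂ * (xP - xT) ≡ (xP - xQ) * (xP - xR) → (μ + λ₂) * a ≡ 1#
        slope-sum-tangent y≢ refl refl roots = *-cancelˡ y≢
          (combine₃ 1# minus' a (tangent slPT) a roots
            (solve 8 (λ y d r e m l a t → (y :+ y) :* ((m :+ l) :* a) :+
                (con 1 :* (y :+ y) :+ a :* e :+ a :* (d :* r)) :=
              (y :+ y) :* con 1 :+ (con 1 :* (d :* (a :* r)) :+ a :* ((y :+ y) :* m) :+
                a :* (e :- (:- y :+ :- y) :* l :- l :* l :* (t :- t))))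
              refl yT (xT - xQ) (xT - xR) (D xT xT) μ λ₂ a xT))
          where
          minus' : (xP - xQ) * (a * (xP - xR)) ≡ yP + yP
          minus' = combine₂ 1# minus 1# line (solve 4 (λ z y l q →
              z :+ (con 1 :* (y :- (q :+ l)) :+ con 1 :* (q :+ l)) :=
              y :+ y :+ (con 1 :* z :+ con 1 :* :- y))
            refl ((xP - xQ) * (a * (xP - xR))) yP (λ₂ * (xT - xQ)) yQ)

        -- For P = Q it is yP - L that vanishes, and the tangent equation for `λ₁` takes the place
        -- of `minus`.
        slope-sum-double : xP ≡ xQ → yP ≡ yQ → xP - xR ≢ 0# → xP - xT ≢ 0# →
          D xP xQ - (yQ + yQ) * λ₂ - λ₂ * λ₂ * (xP - xQ) ≡ (xP - xR) * (xP - xT) → (μ + λ₂) * a ≡ 1#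
        slope-sum-double refl refl xP≢xR xP≢xT roots = *-cancelˡ xP≢xT (trans
          (combine₁ a plus (solve 6 (λ t m a y l p →
              t :* (m :* a) :+ a :* (y :+ (y :+ l :* (p :- p))) := (y :+ y) :* a :+ a :* (t :* m))
            refl (xP - xT) (μ + λ₂) a yP λ₂ xP))
          (*-cancelˡ xP≢xR (combine₃ (yP + yP) ha 1# (tangent slPQ) 1# roots
            (solve 8 (λ y a r t e l k p → r :* ((y :+ y) :* a) :+
                ((y :+ y) :* (k :- l) :+ con 1 :* e :+ con 1 :* (r :* t)) :=
              r :* (t :* con 1) :+ ((y :+ y) :* (a :* r) :+ con 1 :* ((y :+ y) :* k) :+
                con 1 :* (e :- (y :+ y) :* l :- l :* l :* (p :- p))))
              refl yP a (xP - xR) (xP - xT) (D xP xP) λ₂ λ₁ xP))))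

      -- The point of this relation is its symmetry: `a` is unchanged when P and R are exchanged, so
      -- the slopes μ of P ⊕ (Q ⊕ R) and μ' of R ⊕ (P ⊕ Q) satisfy μ + λ₂ = μ' + λ₁.
      slope-sum : ∀ {xP yP xQ yQ xR yR λ₁ λ₂ μ a} →
        On (aff xP yP) → On (aff xQ yQ) → On (aff xR yR) → xP - xR ≢ 0# →
        ¬ Opposite xP yP xQ yQ → Slope λ₁ xP yP xQ yQ →
        ¬ Opposite xQ yQ xR yR → Slope λ₂ xQ yQ xR yR →
        let xT = λ₂ * λ₂ - α - xQ - xR
            yT = λ₂ * (xQ - xT) - yQ in
        ¬ Opposite xP yP xT yT → Slope μ xP yP xT yT →
        a * (xP - xR) ≡ λ₁ - λ₂ → (μ + λ₂) * a ≡ 1#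
      slope-sum {xP} {yP} {xQ} {yQ} {xR} {yR} {λ₁} {λ₂} {μ} {a}
        onP onQ onR xP≢xR ¬oppPQ slPQ ¬oppQR slQR ¬oppPT slPT ha = by-cases (xP - xQ ≟ 0#) (xP - xT ≟ 0#)
        where
        xT = λ₂ * λ₂ - α - xQ - xR
        yT = λ₂ * (xQ - xT) - yQ
        onT : On (aff xT yT)
        onT = On-chord onQ slQR
        line : - yT ≡ yQ + λ₂ * (xT - xQ)
        line = solve 4 (λ l q t y → :- (l :* (q :- t) :- y) := y :+ l :* (t :- q)) refl λ₂ xQ xT yQ

        same : ∀ {x y x' y'} → On (aff x y) → On (aff x' y') → ¬ Opposite x y x' y' → x - x' ≡ 0# → y ≡ y'
        same {x} {y} {x'} {y'} on on' ¬opp x= = -≡0⇒≡ (*≡0⇒ (λ y= → ¬opp (x= , y=))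
          (combine₂ 1# (On-difference on on') (D x x') x= (solve 3 (λ u d e →
            u :+ (con 1 :* (d :* e) :+ e :* con 0) := con 0 :+ (con 1 :* u :+ e :* d))
            refl ((y + y') * (y - y')) (x - x') (D x x'))))

        rootsT : D xP xT - (- yT + - yT) * λ₂ - λ₂ * λ₂ * (xP - xT) ≡ (xP - xQ) * (xP - xR)
        rootsT = trans (line-roots (slope-sym (chord-slope slQR)) xP)
          (cong (λ z → (xP - xQ) * (xP - z)) (solve 4 (λ α l q r →
            l :* l :- α :- (l :* l :- α :- q :- r) :- q := r) refl α λ₂ xQ xR))

        by-cases : Dec (xP - xQ ≡ 0#) → Dec (xP - xT ≡ 0#) → (μ + λ₂) * a ≡ 1#
        by-cases (no xP≢xQ) (no xP≢xT) =
          slope-sum-generic onP onQ slPQ slPT line ha xP≢xQ xP≢xR xP≢xT (line-roots slQR xP)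
        by-cases (no _) (yes x=) = slope-sum-tangent onP onQ slPQ slPT line ha
          (λ y= → ¬oppPT (x= , y=)) (-≡0⇒≡ x=) (same onP onT ¬oppPT x=) rootsT
        by-cases (yes x=) (no xP≢xT) = slope-sum-double onP onQ slPQ slPT line ha
          (-≡0⇒≡ x=) (same onP onQ ¬oppPQ x=) xP≢xR xP≢xT (line-roots slQR xP)
        -- P = Q together with P = Q ⊕ R would force R to be the origin.
        by-cases (yes x=) (yes x=') = ⊥-elim (O≢aff (begin
          O                                                ≡⟨ ⊕-inverseʳ (aff xQ yQ) ⟨
          aff xQ yQ ⊕ neg (aff xQ yQ)                      ≡⟨ cong (_⊕ neg (aff xQ yQ)) T≡Q ⟨
          aff xT yT ⊕ neg (aff xQ yQ)                      ≡⟨ cong (_⊕ neg (aff xQ yQ)) (⊕-slope ¬oppQR slQR) ⟨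
          aff xQ yQ ⊕ aff xR yR ⊕ neg (aff xQ yQ)          ≡⟨ ⊕-cancel (aff xQ yQ) (aff xR yR) onQ onR ⟩
          aff xR yR                                        ∎))
          where
          open ≡-Reasoning
          O≢aff : ∀ {x y} → O ≢ aff x y
          O≢aff ()
          T≡Q : aff xT yT ≡ aff xQ yQ
          T≡Q = aff-cong (trans (sym (-≡0⇒≡ x=')) (-≡0⇒≡ x=))
            (trans (sym (same onP onT ¬oppPT x=')) (same onP onQ ¬oppPQ x=))

      ⊕-assoc-generic : ∀ {xP yP xQ yQ xR yR λ₁ λ₂} →
        On (aff xP yP) → On (aff xQ yQ) → On (aff xR yR) → xP - xR ≢ 0# →
        ¬ Opposite xP yP xQ yQ → Slope λ₁ xP yP xQ yQ →
        ¬ Opposite xQ yQ xR yR → Slope λ₂ xQ yQ xR yR →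
        aff xP yP ⊕ aff xQ yQ ≢ neg (aff xR yR) → aff xQ yQ ⊕ aff xR yR ≢ neg (aff xP yP) →
        aff xP yP ⊕ aff xQ yQ ⊕ aff xR yR ≡ aff xP yP ⊕ (aff xQ yQ ⊕ aff xR yR)
      ⊕-assoc-generic {xP} {yP} {xQ} {yQ} {xR} {yR} {λ₁} {λ₂}
        onP onQ onR xP≢xR ¬oppPQ slPQ ¬oppQR slQR PQ≢-R QR≢-P = begin
          P ⊕ Q ⊕ R                        ≡⟨ cong (_⊕ R) PQ≡U ⟩
          aff xU yU ⊕ R                    ≡⟨ ⊕-comm (aff xU yU) R onU onR ⟩
          R ⊕ aff xU yU                    ≡⟨ sums (sumView onP onT) (sumView onR onU) ⟩
          P ⊕ aff xT yT                    ≡⟨ cong (P ⊕_) QR≡T ⟨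
          P ⊕ (Q ⊕ R)                      ∎
        where
        open ≡-Reasoning
        P = aff xP yP
        Q = aff xQ yQ
        R = aff xR yR
        xT = λ₂ * λ₂ - α - xQ - xR
        yT = λ₂ * (xQ - xT) - yQ
        xU = λ₁ * λ₁ - α - xQ - xP
        yU = λ₁ * (xQ - xU) - yQ
        slQP = slope-sym slPQ
        onT : On (aff xT yT)
        onT = On-chord onQ slQR
        onU : On (aff xU yU)
        onU = On-chord onQ slQP
        ¬oppQP : ¬ Opposite xQ yQ xP yP
        ¬oppQP opp = ¬oppPQ (opposite-sym opp)
        QR≡T : Q ⊕ R ≡ aff xT yT
        QR≡T = ⊕-slope ¬oppQR slQR
        PQ≡U : P ⊕ Q ≡ aff xU yU
        PQ≡U = trans (⊕-comm P Q onP onQ) (⊕-slope ¬oppQP slQP)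
        i : Carrier
        i = proj₁ (inverse (xP - xR) xP≢xR)
        a : Carrier
        a = i * (λ₁ - λ₂)
        ha : a * (xP - xR) ≡ λ₁ - λ₂
        ha = combine₁ (λ₁ - λ₂) (proj₂ (inverse (xP - xR) xP≢xR)) (solve 3 (λ d i l →
          i :* l :* d :+ l :* con 1 := l :+ l :* (d :* i)) refl (xP - xR) i (λ₁ - λ₂))
        ha' : a * (xR - xP) ≡ λ₂ - λ₁
        ha' = combine₁ (- 1#) ha (solve 5 (λ a p r l m → a :* (r :- p) :+ :- con 1 :* (l :- m) :=
          m :- l :+ :- con 1 :* (a :* (p :- r))) refl a xP xR λ₁ λ₂)
        xR≢xP : xR - xP ≢ 0#
        xR≢xP e = xP≢xR (combine₁ (- 1#) e (solve 2 (λ p r → p :- r :+ :- con 1 :* con 0 :=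
          con 0 :+ :- con 1 :* (r :- p)) refl xP xR))

        chords : ∀ {μ μ'} → (μ + λ₂) * a ≡ 1# → (μ' + λ₁) * a ≡ 1# → chord μ' xR yR xU ≡ chord μ xP yP xT
        chords {μ} {μ'} e e' with -- both sums of slopes are inverse to a
          combine₂ {l = μ'} {r = μ + λ₂ - λ₁} (μ + λ₂) e' (- (μ' + λ₁)) e
            (solve 5 (λ m n k l a → n :+ ((m :+ l) :* con 1 :+ :- (n :+ k) :* con 1) :=
              m :+ l :- k :+ ((m :+ l) :* ((n :+ k) :* a) :+ :- (n :+ k) :* ((m :+ l) :* a)))
              refl μ μ' λ₁ λ₂ a)
        ... | refl = aff-cong x-eq (trans (cong (λ X → μ' * (xR - X) - yR) x-eq)
            (combine₃ (- 1#) (secant slPQ) (- 1#) (secant slQR) (μ - λ₂) h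
              (solve 10 (λ α p yP q yQ r yR k l m →
                let n = m :+ l :- k
                    X = m :* m :- α :- p :- (l :* l :- α :- q :- r) in
                n :* (r :- X) :- yR :+ (:- con 1 :* (yP :- yQ) :+ :- con 1 :* (yQ :- yR) :+ (m :- l) :* (p :- r)) :=
                m :* (p :- X) :- yP :+ (:- con 1 :* ((p :- q) :* k) :+ :- con 1 :* ((q :- r) :* l) :+
                  (m :- l) :* ((m :+ l) :* (k :- l))))
                refl α xP yP xQ yQ xR yR λ₁ λ₂ μ)))
          where
          h : (μ + λ₂) * (λ₁ - λ₂) ≡ xP - xR
          h = combine₂ (- (μ + λ₂)) ha (xP - xR) e (solve 4 (λ c a d k →
            c :* k :+ (:- c :* k :+ d :* con 1) := d :+ (:- c :* (a :* d) :+ d :* (c :* a)))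
            refl (μ + λ₂) a (xP - xR) (λ₁ - λ₂))
          x-eq : μ' * μ' - α - xR - xU ≡ μ * μ - α - xP - xT
          x-eq = combine₁ (- # (+ 2)) h (solve 7 (λ α p q r k l m → let n = m :+ l :- k in
              n :* n :- α :- r :- (k :* k :- α :- q :- p) :+ :- con 2 :* (p :- r) :=
              m :* m :- α :- p :- (l :* l :- α :- q :- r) :+ :- con 2 :* ((m :+ l) :* (k :- l)))
            refl α xP xQ xR λ₁ λ₂ μ)

        sums : SumView xP yP xT yT → SumView xR yR xU yU → R ⊕ aff xU yU ≡ P ⊕ aff xT yT
        sums (inj₁ opp) _ = ⊥-elim (QR≢-P (trans QR≡T (opposite⇒neg opp)))
        sums _ (inj₁ opp) = ⊥-elim (PQ≢-R (trans PQ≡U (opposite⇒neg opp)))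
        sums (inj₂ (¬oppPT , μ , slPT)) (inj₂ (¬oppRU , μ' , slRU)) =
          trans (⊕-slope ¬oppRU slRU) (trans (chords
            (slope-sum onP onQ onR xP≢xR ¬oppPQ slPQ ¬oppQR slQR ¬oppPT slPT ha)
            (slope-sum onR onQ onP xR≢xP (λ opp → ¬oppQR (opposite-sym opp)) (slope-sym slQR)
              ¬oppQP slQP ¬oppRU slRU ha'))
          (sym (⊕-slope ¬oppPT slPT)))

      -- The comparison of slopes requires xP ≠ xR and that no sum met on the way is the origin.
      -- Each excluded position is settled by commutativity, `⊕-cancel` and `rotate`.
      ⊕-assoc : ∀ P Q R → On P → On Q → On R → P ⊕ Q ⊕ R ≡ P ⊕ (Q ⊕ R)
      ⊕-assoc O Q R _ _ _ = refl
      ⊕-assoc P@(aff _ _) O R _ _ _ = refl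
      ⊕-assoc P@(aff _ _) Q@(aff _ _) O _ _ _ = ⊕-identityʳ (P ⊕ Q)
      ⊕-assoc P@(aff xP yP) Q@(aff xQ yQ) R@(aff xR yR) onP onQ onR
        with xP - xR ≟ 0# | sumView onP onQ | sumView onQ onR
      ... | yes x= | _ | _ = by-R (yP - yR ≟ 0#)
        where
        open ≡-Reasoning
        -P = neg P
        on-P : On -P
        on-P = On-neg P onP
        by-R : Dec (yP - yR ≡ 0#) → P ⊕ Q ⊕ R ≡ P ⊕ (Q ⊕ R)
        by-R (yes y=) with -≡0⇒≡ x= | -≡0⇒≡ y=
        ... | refl | refl = trans (⊕-comm (P ⊕ Q) P (On-⊕ P Q onP onQ) onP) (cong (P ⊕_) (⊕-comm P Q onP onQ))
        by-R (no y≢) = begin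
          P ⊕ Q ⊕ R           ≡⟨ cong (P ⊕ Q ⊕_) R≡-P ⟩
          P ⊕ Q ⊕ -P          ≡⟨ ⊕-cancel P Q onP onQ ⟩
          Q                   ≡⟨ ⊕-cancel -P Q on-P onQ ⟨
          -P ⊕ Q ⊕ neg -P     ≡⟨ cong (-P ⊕ Q ⊕_) (neg-neg P) ⟩
          -P ⊕ Q ⊕ P          ≡⟨ ⊕-comm (-P ⊕ Q) P (On-⊕ -P Q on-P onQ) onP ⟩
          P ⊕ (-P ⊕ Q)        ≡⟨ cong (P ⊕_) (⊕-comm -P Q on-P onQ) ⟩
          P ⊕ (Q ⊕ -P)        ≡⟨ cong (λ S → P ⊕ (Q ⊕ S)) R≡-P ⟨
          P ⊕ (Q ⊕ R)         ∎
          where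
          R≡-P : R ≡ -P
          R≡-P = opposite⇒neg (x= , *≡0⇒ y≢ (combine₂ 1# (On-difference onP onR) (D xP xR) x=
            (solve 4 (λ s m d e → m :* s :+ (con 1 :* (d :* e) :+ e :* con 0) :=
              con 0 :+ (con 1 :* (s :* m) :+ e :* d)) refl (yP + yR) (yP - yR) (xP - xR) (D xP xR))))
      ... | no _ | inj₁ opp | _ = begin
          P ⊕ Q ⊕ R                ≡⟨ cong (_⊕ R) (⊕-opposite opp) ⟩
          R                        ≡⟨ ⊕-cancel Q R onQ onR ⟨
          Q ⊕ R ⊕ neg Q            ≡⟨ cong (Q ⊕ R ⊕_) (sym (opposite⇒neg (opposite-sym opp))) ⟩
          Q ⊕ R ⊕ P                ≡⟨ ⊕-comm (Q ⊕ R) P (On-⊕ Q R onQ onR) onP ⟩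
          P ⊕ (Q ⊕ R)              ∎
        where open ≡-Reasoning
      ... | no _ | inj₂ _ | inj₁ opp = begin
          P ⊕ Q ⊕ R                ≡⟨ cong (_⊕ R) (⊕-comm P Q onP onQ) ⟩
          Q ⊕ P ⊕ R                ≡⟨ cong (Q ⊕ P ⊕_) (opposite⇒neg opp) ⟩
          Q ⊕ P ⊕ neg Q            ≡⟨ ⊕-cancel Q P onQ onP ⟩
          P                        ≡⟨ cong (P ⊕_) (⊕-opposite opp) ⟨
          P ⊕ (Q ⊕ R)              ∎
        where open ≡-Reasoning
      ... | no xP≢xR | inj₂ (¬oppPQ , _ , slPQ) | inj₂ (¬oppQR , _ , slQR)
        with (P ⊕ Q) ≟Pt neg R | (Q ⊕ R) ≟Pt neg P
      ...   | yes PQ≡-R | _ = begin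
          P ⊕ Q ⊕ R                ≡⟨ cong (_⊕ R) PQ≡-R ⟩
          neg R ⊕ R                ≡⟨ ⊕-comm (neg R) R (On-neg R onR) onR ⟩
          R ⊕ neg R                ≡⟨ ⊕-inverseʳ R ⟩
          O                        ≡⟨ ⊕-inverseʳ P ⟨
          P ⊕ neg P                ≡⟨ cong (P ⊕_) (rotate Q P R onQ onP onR (trans (⊕-comm Q P onQ onP) PQ≡-R)) ⟨
          P ⊕ (R ⊕ Q)              ≡⟨ cong (P ⊕_) (⊕-comm R Q onR onQ) ⟩
          P ⊕ (Q ⊕ R)              ∎
        where open ≡-Reasoning
      ...   | no _ | yes QR≡-P = begin
          P ⊕ Q ⊕ R                ≡⟨ cong (_⊕ R) (rotate Q R P onQ onR onP QR≡-P) ⟩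
          neg R ⊕ R                ≡⟨ ⊕-comm (neg R) R (On-neg R onR) onR ⟩
          R ⊕ neg R                ≡⟨ ⊕-inverseʳ R ⟩
          O                        ≡⟨ ⊕-inverseʳ P ⟨
          P ⊕ neg P                ≡⟨ cong (P ⊕_) QR≡-P ⟨
          P ⊕ (Q ⊕ R)              ∎
        where open ≡-Reasoning
      ...   | no PQ≢-R | no QR≢-P =
        ⊕-assoc-generic onP onQ onR xP≢xR ¬oppPQ slPQ ¬oppQR slQR PQ≢-R QR≢-P

-- Sums, differences and doubles in terms of x-coordinates

module _ (F : Field) where
  open FieldTheory F

  module Formulas (α β γ : Carrier) where
    open CubicCurve F α β γ
    open Slope
    private
      fP DP : ∀ {n} (α β γ x : Polynomial n) → Polynomial n
      fP α β γ x = x :* x :* x :+ α :* x :* x :+ β :* x :+ γ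
      DP α β x y = x :* x :+ x :* y :+ y :* y :+ α :* (x :+ y) :+ β

    -- The product of x(P + Q) - e and x(P - Q) - e, multiplied by (x₁ - x₂)². The base point e is 0
    -- in the arguments that must hold at 2, and for large primes it is the value that removes the
    -- quadratic term of the cubic.
    numerator : Carrier → Carrier → Carrier → Carrier
    numerator e x₁ x₂ = let m = (x₁ - e) * (x₂ - e) - D e e in
      m * m - # (+ 4) * f e * (x₁ + x₂ + e + α)

    record SumDifference (x₁ y₁ x₂ y₂ : Carrier) : Set where
      field
        x₊ y₊ x₋ y₋ : Carrier
        sum≡ : aff x₁ y₁ ⊕ aff x₂ y₂ ≡ aff x₊ y₊
        difference≡ : aff x₁ y₁ ⊕ neg (aff x₂ y₂) ≡ aff x₋ y₋
        x-sum : (x₊ + x₋) * ((x₁ - x₂) * (x₁ - x₂)) ≡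
          # (+ 2) * ((x₁ + x₂) * (x₁ * x₂ + β) + # (+ 2) * (α * (x₁ * x₂)) + # (+ 2) * γ)
        x-product : ∀ e → (x₊ - e) * (x₋ - e) * ((x₁ - x₂) * (x₁ - x₂)) ≡ numerator e x₁ x₂

    -- The ordinates enter only through `λ₊`² + `λ₋`² and `λ₊` `λ₋`, whose numerators are 2(y₁² +
    -- y₂²) and y₁² - y₂²; the curve equation turns both into polynomials in x₁ and x₂.
    sumDifference : ∀ {x₁ y₁ x₂ y₂} → On (aff x₁ y₁) → On (aff x₂ y₂) → x₁ - x₂ ≢ 0# →
      SumDifference x₁ y₁ x₂ y₂
    sumDifference {x₁} {y₁} {x₂} {y₂} on₁ on₂ x≢ = record
      { sum≡ = ⊕-slope (λ opp → x≢ (proj₁ opp)) (secant⇒slope on₁ on₂ x≢ s₊)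
      ; difference≡ = ⊕-slope (λ opp → x≢ (proj₁ opp)) (secant⇒slope on₁ (On-neg (aff x₂ y₂) on₂) x≢ s₋)
      ; x-sum = trans (solve 5 (λ α l k x₁ x₂ → (l :* l :- α :- x₁ :- x₂ :+ (k :* k :- α :- x₁ :- x₂)) :* ((x₁ :- x₂) :* (x₁ :- x₂)) :=
            (l :* l :+ k :* k) :* ((x₁ :- x₂) :* (x₁ :- x₂)) :- con 2 :* (α :+ x₁ :+ x₂) :* ((x₁ :- x₂) :* (x₁ :- x₂))) refl α λ₊ λ₋ x₁ x₂)
          (trans (cong (_- # (+ 2) * (α + x₁ + x₂) * ((x₁ - x₂) * (x₁ - x₂))) squares) (solve 5 (λ α β γ x₁ x₂ →
            con 2 :* (fP α β γ x₁ :+ fP α β γ x₂) :- con 2 :* (α :+ x₁ :+ x₂) :* ((x₁ :- x₂) :* (x₁ :- x₂)) :=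
            con 2 :* ((x₁ :+ x₂) :* (x₁ :* x₂ :+ β) :+ con 2 :* (α :* (x₁ :* x₂)) :+ con 2 :* γ)) refl α β γ x₁ x₂))
      ; x-product = λ e → trans (combine₂ (- (α + x₁ + x₂ + e)) squares (λ₊ * λ₋ * (x₁ - x₂) + D x₁ x₂) product
          (solve 8 (λ α l k x₁ x₂ e F D → let s = α :+ x₁ :+ x₂ :+ e
                                              d = x₁ :- x₂ in
            (l :* l :- α :- x₁ :- x₂ :- e) :* (k :* k :- α :- x₁ :- x₂ :- e) :* (d :* d) :+
              (:- s :* F :+ (l :* k :* d :+ D) :* D) :=
            D :* D :- s :* F :+ s :* s :* (d :* d) :+
              (:- s :* ((l :* l :+ k :* k) :* (d :* d)) :+ (l :* k :* d :+ D) :* (l :* k :* d)))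
            refl α λ₊ λ₋ x₁ x₂ e (# (+ 2) * (f x₁ + f x₂)) (D x₁ x₂)))
          (solve 6 (λ α β γ x₁ x₂ e → let s = α :+ x₁ :+ x₂ :+ e
                                          d = x₁ :- x₂
                                          m = (x₁ :- e) :* (x₂ :- e) :- DP α β e e in
            DP α β x₁ x₂ :* DP α β x₁ x₂ :- s :* (con 2 :* (fP α β γ x₁ :+ fP α β γ x₂)) :+ s :* s :* (d :* d) :=
            m :* m :- con 4 :* fP α β γ e :* (x₁ :+ x₂ :+ e :+ α)) refl α β γ x₁ x₂ e)
      }
      where
      i = proj₁ (inverse (x₁ - x₂) x≢)
      λ₊ = i * (y₁ - y₂)
      λ₋ = i * (y₁ - - y₂)
      s : ∀ m → (x₁ - x₂) * (i * m) ≡ m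
      s m = combine₁ m (proj₂ (inverse (x₁ - x₂) x≢)) (solve 3 (λ d i m →
        d :* (i :* m) :+ m :* con 1 := m :+ m :* (d :* i)) refl (x₁ - x₂) i m)
      s₊ = s (y₁ - y₂)
      s₋ = s (y₁ - - y₂)
      squares : (λ₊ * λ₊ + λ₋ * λ₋) * ((x₁ - x₂) * (x₁ - x₂)) ≡ # (+ 2) * (f x₁ + f x₂)
      squares = begin
        (λ₊ * λ₊ + λ₋ * λ₋) * ((x₁ - x₂) * (x₁ - x₂))
          ≡⟨ solve 3 (λ l k d → (l :* l :+ k :* k) :* (d :* d) := d :* l :* (d :* l) :+ d :* k :* (d :* k)) refl λ₊ λ₋ (x₁ - x₂) ⟩
        (x₁ - x₂) * λ₊ * ((x₁ - x₂) * λ₊) + (x₁ - x₂) * λ₋ * ((x₁ - x₂) * λ₋)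
          ≡⟨ cong₂ (λ u v → u * u + v * v) s₊ s₋ ⟩
        (y₁ - y₂) * (y₁ - y₂) + (y₁ - - y₂) * (y₁ - - y₂)
          ≡⟨ solve 2 (λ u v → (u :- v) :* (u :- v) :+ (u :- :- v) :* (u :- :- v) := con 2 :* (u :* u :+ v :* v)) refl y₁ y₂ ⟩
        # (+ 2) * (y₁ * y₁ + y₂ * y₂)
          ≡⟨ cong₂ (λ u v → # (+ 2) * (u + v)) on₁ on₂ ⟩
        # (+ 2) * (f x₁ + f x₂) ∎
        where open ≡-Reasoning
      product : λ₊ * λ₋ * (x₁ - x₂) ≡ D x₁ x₂
      product = *-cancelˡ x≢ (begin
        (x₁ - x₂) * (λ₊ * λ₋ * (x₁ - x₂))
          ≡⟨ solve 3 (λ l k d → d :* (l :* k :* d) := d :* l :* (d :* k)) refl λ₊ λ₋ (x₁ - x₂) ⟩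
        (x₁ - x₂) * λ₊ * ((x₁ - x₂) * λ₋)
          ≡⟨ cong₂ _*_ s₊ s₋ ⟩
        (y₁ - y₂) * (y₁ - - y₂)
          ≡⟨ solve 2 (λ u v → (u :- v) :* (u :- :- v) := (u :+ v) :* (u :- v)) refl y₁ y₂ ⟩
        (y₁ + y₂) * (y₁ - y₂)
          ≡⟨ On-difference on₁ on₂ ⟩
        (x₁ - x₂) * D x₁ x₂ ∎)
        where open ≡-Reasoning

    double : ∀ {x y} → On (aff x y) → y + y ≢ 0# →
      ∃ λ x₂ → ∃ λ y₂ → (aff x y ⊕ aff x y ≡ aff x₂ y₂) ×
        (∀ e → (x₂ - e) * (# (+ 4) * f x) ≡ numerator e x x)
    double {x} {y} on y≢ = λ' * λ' - α - x - x , _ ,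
      ⊕-slope (λ opp → y≢ (proj₂ opp)) (tangent⇒slope on on y≢ tan) ,
      λ e → trans (combine₂ ((y + y) * λ' + D x x) tan (- # (+ 4) * (λ' * λ')) on
        (solve 7 (λ α l x y e F D →
          (l :* l :- α :- x :- x :- e) :* (con 4 :* F) :+
            (((y :+ y) :* l :+ D) :* D :+ :- con 4 :* (l :* l) :* F) :=
          D :* D :- con 4 :* (α :+ x :+ x :+ e) :* F :+
            (((y :+ y) :* l :+ D) :* ((y :+ y) :* l) :+ :- con 4 :* (l :* l) :* (y :* y)))
          refl α λ' x y e (f x) (D x x)))
        (solve 5 (λ α β γ x e → let m = (x :- e) :* (x :- e) :- DP α β e e in
          DP α β x x :* DP α β x x :- con 4 :* (α :+ x :+ x :+ e) :* fP α β γ x :=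
          m :* m :- con 4 :* fP α β γ e :* (x :+ x :+ e :+ α)) refl α β γ x e)
      where
      i = proj₁ (inverse (y + y) y≢)
      λ' = i * D x x
      tan : (y + y) * λ' ≡ D x x
      tan = combine₁ (D x x) (proj₂ (inverse (y + y) y≢)) (solve 3 (λ d i m →
        d :* (i :* m) :+ m :* con 1 := m :+ m :* (d :* i)) refl (y + y) i (D x x))

-- Valuation rings and ramified quadratic extensions

-- A valuation ring given by membership alone: `π-or-unit` makes `π` generate the maximal ideal, and
-- `valuation` says that an element is integral or the reciprocal of a nonunit. No valuation
-- function has to be constructed.
record Localization (F : Field) : Set₁ where
  open FieldTheory F
  field
    Int : Carrier → Set
    Int-+ : ∀ {x y} → Int x → Int y → Int (x + y)
    Int-* : ∀ {x y} → Int x → Int y → Int (x * y)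
    Int-neg : ∀ {x} → Int x → Int (- x)
    Int-# : ∀ i → Int (# i)
    π : Carrier
    Int-π : Int π
    π-or-unit : ∀ {x} → Int x → (∃ λ r → Int r × x ≡ π * r) ⊎ (∃ λ r → Int r × x * r ≡ 1#)
    π≢0 : π ≢ 0#
    π-nonunit : ∀ {r} → Int r → π * r ≢ 1#
    valuation : ∀ x → Int x ⊎ (∃ λ r → Int r × x * (π * r) ≡ 1#)

module LocalTheory {F : Field} (loc : Localization F) where
  open FieldTheory F public
  open Localization loc public

  Max : Carrier → Set
  Max x = ∃ λ r → Int r × x ≡ π * r

  Unit : Carrier → Set
  Unit x = Int x × (∃ λ r → Int r × x * r ≡ 1#)

  Int-- : ∀ {x y} → Int x → Int y → Int (x - y)
  Int-- ix iy = Int-+ ix (Int-neg iy)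

  Max-Int : ∀ {x} → Max x → Int x
  Max-Int (r , ir , refl) = Int-* Int-π ir

  Max-π : Max π
  Max-π = 1# , Int-# (+ 1) , solve 1 (λ p → p := p :* con 1) refl π

  Max-0 : Max 0#
  Max-0 = 0# , Int-# (+ 0) , solve 1 (λ p → con 0 := p :* con 0) refl π

  Max-+ : ∀ {x y} → Max x → Max y → Max (x + y)
  Max-+ (r , ir , refl) (s , is , refl) = r + s , Int-+ ir is ,
    solve 3 (λ p r s → p :* r :+ p :* s := p :* (r :+ s)) refl π r s

  Max-*ʳ : ∀ {x y} → Max x → Int y → Max (x * y)
  Max-*ʳ {y = y} (r , ir , refl) iy = r * y , Int-* ir iy ,
    solve 3 (λ p r s → p :* r :* s := p :* (r :* s)) refl π r y

  Max-*ˡ : ∀ {x y} → Int x → Max y → Max (x * y)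
  Max-*ˡ {x = x} ix (r , ir , refl) = x * r , Int-* ix ir ,
    solve 3 (λ p r s → s :* (p :* r) := p :* (s :* r)) refl π r x

  Max-neg : ∀ {x} → Max x → Max (- x)
  Max-neg (r , ir , refl) = - r , Int-neg ir , solve 2 (λ p r → :- (p :* r) := p :* :- r) refl π r

  Max-- : ∀ {x y} → Max x → Max y → Max (x - y)
  Max-- mx my = Max-+ mx (Max-neg my)

  ¬Max-1 : ¬ Max 1#
  ¬Max-1 (r , ir , e) = π-nonunit ir (sym e)

  Unit⇒¬Max : ∀ {x} → Unit x → ¬ Max x
  Unit⇒¬Max (_ , s , is , e) m = ¬Max-1 (subst Max e (Max-*ʳ m is))

  Unit⇒≢0 : ∀ {x} → Unit x → x ≢ 0#
  Unit⇒≢0 u refl = Unit⇒¬Max u Max-0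

  Max-or-Unit : ∀ {x} → Int x → Max x ⊎ Unit x
  Max-or-Unit ix with π-or-unit ix
  ... | inj₁ m = inj₁ m
  ... | inj₂ u = inj₂ (ix , u)

  ¬Max⇒Unit : ∀ {x} → Int x → ¬ Max x → Unit x
  ¬Max⇒Unit ix ¬m with Max-or-Unit ix
  ... | inj₁ m = ⊥-elim (¬m m)
  ... | inj₂ u = u

  Unit-+Max : ∀ {x y} → Unit x → Max y → Unit (x + y)
  Unit-+Max {x} {y} u m = ¬Max⇒Unit (Int-+ (proj₁ u) (Max-Int m))
    (λ m' → Unit⇒¬Max u (subst Max (solve 2 (λ x y → x :+ y :- y := x) refl x y) (Max-- m' m)))

  Unit-* : ∀ {x y} → Unit x → Unit y → Unit (x * y)
  Unit-* {x} {y} (ix , r , ir , e) (iy , s , is , e') = Int-* ix iy , r * s , Int-* ir is ,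
    trans (solve 4 (λ x y r s → x :* y :* (r :* s) := x :* r :* (y :* s)) refl x y r s)
      (trans (cong₂ _*_ e e') (solve 0 (con 1 :* con 1 := con 1) refl))

  Unit-1 : Unit 1#
  Unit-1 = Int-# (+ 1) , 1# , Int-# (+ 1) , solve 0 (con 1 :* con 1 := con 1) refl

  Unit-inverse : ∀ {x} → Unit x → ∃ λ r → Unit r × x * r ≡ 1#
  Unit-inverse {x} (ix , r , ir , e) = r , (ir , x , ix , trans (solve 2 (λ x r → r :* x := x :* r) refl x r) e) , e

  Unit-factorˡ : ∀ {x y} → Int x → Int y → Unit (x * y) → Unit x
  Unit-factorˡ {x} {y} ix iy (_ , r , ir , e) = ix , y * r , Int-* iy ir ,
    trans (solve 3 (λ x y r → x :* (y :* r) := x :* y :* r) refl x y r) e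

  Max-square : ∀ {x} → Int x → Max (x * x) → Max x
  Max-square ix m with Max-or-Unit ix
  ... | inj₁ mx = mx
  ... | inj₂ u = ⊥-elim (Unit⇒¬Max (Unit-* u u) m)

  -- If x had a pole with reciprocal t in the maximal ideal, multiplying the equation by t² would
  -- put 1 into the maximal ideal.
  integrally-closed : ∀ {x a b} → Int a → Int b → x * x + a * x + b ≡ 0# → Int x
  integrally-closed {x} {a} {b} ia ib e with valuation x
  ... | inj₁ ix = ix
  ... | inj₂ (r , ir , xr) = ⊥-elim (¬Max-1 (subst Max
    (sym (combine₂ (t * t) e (- (x * t + 1# + a * t)) xr
      (solve 4 (λ x t a b → con 1 :+ (t :* t :* con 0 :+ :- (x :* t :+ con 1 :+ a :* t) :* con 1) :=
        :- (t :* (a :+ b :* t)) :+ (t :* t :* (x :* x :+ a :* x :+ b) :+ :- (x :* t :+ con 1 :+ a :* t) :* (x :* t)))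
        refl x t a b)))
    (Max-neg (Max-*ʳ (r , ir , refl) (Int-+ ia (Int-* ib it))))))
    where
    t = π * r
    it = Int-* Int-π ir

  -- A square root of πδ would be integral, then divisible by π, and δ would be divisible by π as
  -- well. This is what makes the adjunction of √(πδ) a field.
  uniformizer-nonsquare : ∀ {δ} → Unit δ → ∀ r → r * r ≢ π * δ
  uniformizer-nonsquare {δ} uδ r e with Int-r ← integrally-closed {r} (Int-# (+ 0)) (Int-neg (Int-* Int-π (proj₁ uδ)))
      (combine₁ 1# e (solve 2 (λ r d → r :* r :+ con 0 :* r :+ :- d :+ con 1 :* d := con 0 :+ con 1 :* (r :* r)) refl r (π * δ)))
    with Max-square Int-r (subst Max (sym e) (Max-*ʳ Max-π (proj₁ uδ)))
  ... | s , is , refl = Unit⇒¬Max uδ (subst Max (*-cancelˡ π≢0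
        (trans (solve 2 (λ p s → p :* (p :* (s :* s)) := p :* s :* (p :* s)) refl π s) e))
        (s * s , Int-* is is , refl))

module _ (F : Field) where
  open FieldTheory F

  module QuadraticExtension (d : Carrier)
    (nonsquare : ∀ r → r * r ≢ d) where

    K : Set
    K = Carrier × Carrier

    ι : Carrier → K
    ι a = a , 0#

    addK mulK : K → K → K
    addK (a , b) (c , e) = a + c , b + e
    mulK (a , b) (c , e) = a * c + d * (b * e) , a * e + b * c

    negK conj : K → K
    negK (a , b) = - a , - b
    conj (a , b) = a , - b

    _≟K_ : (x y : K) → Dec (x ≡ y)
    (a , b) ≟K (c , e) with a ≟ c | b ≟ e
    ... | yes refl | yes refl = yes refl
    ... | no ne | _ = no λ { refl → ne refl }
    ... | yes _ | no ne = no λ { refl → ne refl }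

    norm≢0 : ∀ {x} → x ≢ ι 0# → proj₁ x * proj₁ x - d * (proj₂ x * proj₂ x) ≢ 0#
    norm≢0 {a , b} x≢0 e with b ≟ 0#
    ... | no b≢0 with i , bi ← inverse b b≢0 = nonsquare (a * i) (combine₂ (i * i) e (d * (b * i + 1#)) bi
      (solve 4 (λ a b d i → a :* i :* (a :* i) :+ (i :* i :* con 0 :+ d :* (b :* i :+ con 1) :* con 1) :=
        d :+ (i :* i :* (a :* a :- d :* (b :* b)) :+ d :* (b :* i :+ con 1) :* (b :* i))) refl a b d i))
    ... | yes refl with a ≟ 0#
    ...   | yes refl = x≢0 refl
    ...   | no a≢0 = a≢0 (*≡0⇒ a≢0 (trans (solve 2 (λ a d → a :* a := a :* a :- d :* (con 0 :* con 0)) refl a d) e))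

    norm-inverse : ∀ {a b i} → (a * a - d * (b * b)) * i ≡ 1# → mulK (a , b) (a * i , - (b * i)) ≡ ι 1#
    norm-inverse {a} {b} {i} ni = cong₂ _,_
      (trans (solve 4 (λ a b d i → a :* (a :* i) :+ d :* (b :* :- (b :* i)) := (a :* a :- d :* (b :* b)) :* i) refl a b d i) ni)
      (solve 3 (λ a b i → a :* :- (b :* i) :+ b :* (a :* i) := con 0) refl a b i)

    inverseK : ∀ x → x ≢ ι 0# → ∃ λ y → mulK x y ≡ ι 1#
    inverseK (a , b) x≢0 = let i , ni = inverse _ (norm≢0 x≢0) in (a * i , - (b * i)) , norm-inverse ni

    isCommutativeRingK : IsCommutativeRing _≡_ addK mulK negK (ι 0#) (ι 1#)
    isCommutativeRingK = record
      { isRing = record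
        { +-isAbelianGroup = record
          { isGroup = record
            { isMonoid = record
              { isSemigroup = record
                { isMagma = record { isEquivalence = isEquivalence ; ∙-cong = cong₂ addK }
                ; assoc = λ { (a , b) (c , e) (g , h) → cong₂ _,_ (+-assoc a c g) (+-assoc b e h) } }
              ; identity = (λ { (a , b) → cong₂ _,_ (+-identityˡ a) (+-identityˡ b) })
                         , (λ { (a , b) → cong₂ _,_ (+-identityʳ a) (+-identityʳ b) }) }
            ; inverse = (λ { (a , b) → cong₂ _,_ (-‿inverseˡ a) (-‿inverseˡ b) })
                      , (λ { (a , b) → cong₂ _,_ (-‿inverseʳ a) (-‿inverseʳ b) })
            ; ⁻¹-cong = cong negK }
          ; comm = λ { (a , b) (c , e) → cong₂ _,_ (+-comm a c) (+-comm b e) } }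
        ; *-cong = cong₂ mulK
        ; *-assoc = λ { (a , b) (c , e) (g , h) → cong₂ _,_
            (solve 7 (λ d a b c e g h → (a :* c :+ d :* (b :* e)) :* g :+ d :* ((a :* e :+ b :* c) :* h) :=
              a :* (c :* g :+ d :* (e :* h)) :+ d :* (b :* (c :* h :+ e :* g))) refl d a b c e g h)
            (solve 7 (λ d a b c e g h → (a :* c :+ d :* (b :* e)) :* h :+ (a :* e :+ b :* c) :* g :=
              a :* (c :* h :+ e :* g) :+ b :* (c :* g :+ d :* (e :* h))) refl d a b c e g h) }
        ; *-identity = (λ { (a , b) → cong₂ _,_
            (solve 3 (λ d a b → con 1 :* a :+ d :* (con 0 :* b) := a) refl d a b)
            (solve 2 (λ a b → con 1 :* b :+ con 0 :* a := b) refl a b) })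
          , (λ { (a , b) → cong₂ _,_
            (solve 3 (λ d a b → a :* con 1 :+ d :* (b :* con 0) := a) refl d a b)
            (solve 2 (λ a b → a :* con 0 :+ b :* con 1 := b) refl a b) })
        ; distrib = (λ { (a , b) (c , e) (g , h) → cong₂ _,_
            (solve 7 (λ d a b c e g h → a :* (c :+ g) :+ d :* (b :* (e :+ h)) :=
              a :* c :+ d :* (b :* e) :+ (a :* g :+ d :* (b :* h))) refl d a b c e g h)
            (solve 6 (λ a b c e g h → a :* (e :+ h) :+ b :* (c :+ g) := a :* e :+ b :* c :+ (a :* h :+ b :* g)) refl a b c e g h) })
          , (λ { (a , b) (c , e) (g , h) → cong₂ _,_
            (solve 7 (λ d a b c e g h → (c :+ g) :* a :+ d :* ((e :+ h) :* b) :=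
              c :* a :+ d :* (e :* b) :+ (g :* a :+ d :* (h :* b))) refl d a b c e g h)
            (solve 6 (λ a b c e g h → (c :+ g) :* b :+ (e :+ h) :* a := c :* b :+ e :* a :+ (g :* b :+ h :* a)) refl a b c e g h) }) }
      ; *-comm = λ { (a , b) (c , e) → cong₂ _,_
          (solve 5 (λ d a b c e → a :* c :+ d :* (b :* e) := c :* a :+ d :* (e :* b)) refl d a b c e)
          (solve 4 (λ a b c e → a :* e :+ b :* c := c :* b :+ e :* a) refl a b c e) } }
      where open CommutativeRing commutativeRing
              using (+-assoc; +-identityˡ; +-identityʳ; -‿inverseˡ; -‿inverseʳ; +-comm)

    quadratic : Field
    quadratic = record
      { Carrier = K ; _+_ = addK ; _*_ = mulK ; -_ = negK ; # = λ i → ι (# i)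
      ; isCommutativeRing = isCommutativeRingK
      ; _≟_ = _≟K_
      ; inverse = inverseK
      ; #-+ = λ i j → cong₂ _,_ (#-+ i j) (solve 0 (con 0 := con 0 :+ con 0) refl)
      ; #-* = λ i j → cong₂ _,_
          (trans (#-* i j) (solve 3 (λ d x y → x :* y := x :* y :+ d :* (con 0 :* con 0)) refl d (# i) (# j)))
          (solve 2 (λ x y → con 0 := x :* con 0 :+ con 0 :* y) refl (# i) (# j))
      ; #-neg = λ i → cong₂ _,_ (#-neg i) (solve 0 (con 0 := :- con 0) refl) }

    ι-+ : ∀ x y → addK (ι x) (ι y) ≡ ι (x + y)
    ι-+ x y = cong (x + y ,_) (solve 0 (con 0 :+ con 0 := con 0) refl)

    ι-neg : ∀ x → negK (ι x) ≡ ι (- x)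
    ι-neg x = cong (- x ,_) (solve 0 (:- con 0 := con 0) refl)

    ι-* : ∀ x y → mulK (ι x) (ι y) ≡ ι (x * y)
    ι-* x y = cong₂ _,_ (solve 3 (λ d x y → x :* y :+ d :* (con 0 :* con 0) := x :* y) refl d x y)
      (solve 2 (λ x y → x :* con 0 :+ con 0 :* y := con 0) refl x y)

    infix 8 ‵_
    infixl 6 _⟨+⟩_ _⟨-⟩_
    infixl 7 _⟨*⟩_

    -- These operators copy the syntax of a polynomial expression; composing them along the
    -- expression proves that `ι` commutes with it.
    _⟨+⟩_ : ∀ {u v x y} → u ≡ ι x → v ≡ ι y → addK u v ≡ ι (x + y)
    refl ⟨+⟩ refl = ι-+ _ _

    _⟨-⟩_ : ∀ {u v x y} → u ≡ ι x → v ≡ ι y → addK u (negK v) ≡ ι (x - y)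
    refl ⟨-⟩ refl = trans (cong (addK (ι _)) (ι-neg _)) (ι-+ _ _)

    _⟨*⟩_ : ∀ {u v x y} → u ≡ ι x → v ≡ ι y → mulK u v ≡ ι (x * y)
    refl ⟨*⟩ refl = ι-* _ _

    ‵_ : ∀ x → ι x ≡ ι x
    ‵ x = refl

    irrational-part : ∀ {u q} → u ≡ ι q → ∀ x → proj₂ (mulK u x) ≡ q * proj₂ x
    irrational-part {q = q} refl (a , b) = solve 3 (λ q a b → q :* b :+ con 0 :* a := q :* b) refl q a b

module _ {F : Field} (loc : Localization F) where
  open LocalTheory loc

  module Ramified (δ : Carrier) (δ-unit : Unit δ) where

    d : Carrier
    d = π * δ

    open QuadraticExtension F d (LocalTheory.uniformizer-nonsquare loc δ-unit) public

    Max-d : Max d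
    Max-d = δ , proj₁ δ-unit , refl

    private module KF = FieldTheory quadratic

    √d : K
    √d = 0# , 1#

    IntK : K → Set
    IntK x = Int (proj₁ x) × Int (proj₂ x)

    private
      Int-0 : Int 0#
      Int-0 = Int-# (+ 0)

      IntK-* : ∀ {x y} → IntK x → IntK y → IntK (mulK x y)
      IntK-* (ia , ib) (ic , ie) = Int-+ (Int-* ia ic) (Int-* (Max-Int Max-d) (Int-* ib ie)) , Int-+ (Int-* ia ie) (Int-* ib ic)

      -- a + b√d is a unit as soon as a is, because its norm is.
      inverse-of-unit : ∀ {a b} → Unit a → Int b → ∃ λ r → IntK r × mulK (a , b) r ≡ KF.1#
      inverse-of-unit {a} {b} ua ib =
        let _ , n , int-n , e = Unit-+Max (Unit-* ua ua) (Max-neg (Max-*ʳ Max-d (Int-* ib ib))) in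
        (a * n , - (b * n)) , (Int-* (proj₁ ua) int-n , Int-neg (Int-* ib int-n)) , norm-inverse e

      δ⁻¹ : Carrier
      δ⁻¹ = proj₁ (Unit-inverse δ-unit)
      Int-δ⁻¹ : Int δ⁻¹
      Int-δ⁻¹ = proj₁ (proj₁ (proj₂ (Unit-inverse δ-unit)))
      δδ⁻¹ : δ * δ⁻¹ ≡ 1#
      δδ⁻¹ = proj₂ (proj₂ (Unit-inverse δ-unit))

      √d*√d : ∀ s → mulK √d (mulK √d (ι (s * δ⁻¹))) ≡ ι (π * s)
      √d*√d s = cong₂ _,_
        (combine₁ (π * s) δδ⁻¹ (solve 4 (λ p δ s i →
          con 0 :* (con 0 :* (s :* i) :+ p :* δ :* (con 1 :* con 0)) :+ p :* δ :* (con 1 :* (con 0 :* con 0 :+ con 1 :* (s :* i)))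
            :+ p :* s :* con 1 := p :* s :+ p :* s :* (δ :* i)) refl π δ s δ⁻¹))
        (solve 4 (λ p δ s i → con 0 :* (con 0 :* con 0 :+ con 1 :* (s :* i)) :+ con 1 :* (con 0 :* (s :* i) :+ p :* δ :* (con 1 :* con 0)) := con 0) refl π δ s δ⁻¹)

      √d* : ∀ b c → mulK √d (b , c) ≡ (d * c , b)
      √d* b c = cong₂ _,_ (solve 3 (λ d b c → con 0 :* b :+ d :* (con 1 :* c) := d :* c) refl d b c)
        (solve 2 (λ b c → con 0 :* c :+ con 1 :* b := b) refl b c)

      ι*pair : ∀ a b c → mulK (ι a) (b , c) ≡ (a * b , a * c)
      ι*pair a b c = cong₂ _,_ (solve 4 (λ d a b c → a :* b :+ d :* (con 0 :* c) := a :* b) refl d a b c)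
        (solve 3 (λ a b c → a :* c :+ con 0 :* b := a :* c) refl a b c)

      π-or-unitK : ∀ {x} → IntK x → (∃ λ r → IntK r × x ≡ mulK √d r) ⊎ (∃ λ r → IntK r × mulK x r ≡ KF.1#)
      π-or-unitK {a , b} (ia , ib) with Max-or-Unit ia
      ... | inj₂ ua = inj₂ (inverse-of-unit ua ib)
      ... | inj₁ (a' , ia' , refl) = inj₁ ((b , a' * δ⁻¹) , (ib , Int-* ia' Int-δ⁻¹) , sym (trans (√d* b (a' * δ⁻¹))
        (cong (_, b) (combine₁ (π * a') δδ⁻¹ (solve 4 (λ p δ i a → p :* δ :* (a :* i) :+ p :* a :* con 1 :=
          p :* a :+ p :* a :* (δ :* i)) refl π δ δ⁻¹ a')))))

      π-nonunitK : ∀ {r} → IntK r → mulK √d r ≢ KF.1#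
      π-nonunitK {b , c} (_ , ic) e = ¬Max-1 (subst Max (trans (sym (cong proj₁ (√d* b c))) (cong proj₁ e)) (Max-*ʳ Max-d ic))

      Reciprocal : K → Set
      Reciprocal x = ∃ λ r → IntK r × mulK x (mulK √d r) ≡ KF.1#

      rational-part-dominates : ∀ {a c s} → a * (π * s) ≡ 1# → Int s → Int c → Reciprocal (a , a * c)
      rational-part-dominates {a} {c} {s} as is ic =
        let w , iw , e = inverse-of-unit {1#} {c} Unit-1 ic in
        mulK √d (mulK (ι (s * δ⁻¹)) w) , IntK-* (Int-0 , Int-# (+ 1)) (IntK-* (Int-* is Int-δ⁻¹ , Int-0) iw) , (begin
          mulK (a , a * c) (mulK √d (mulK √d (mulK (ι (s * δ⁻¹)) w)))
            ≡⟨ cong (λ x → mulK x (mulK √d (mulK √d (mulK (ι (s * δ⁻¹)) w)))) (sym (trans (ι*pair a 1# c) (cong (_, a * c) (solve 1 (λ a → a :* con 1 := a) refl a)))) ⟩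
          mulK (mulK (ι a) (1# , c)) (mulK √d (mulK √d (mulK (ι (s * δ⁻¹)) w)))
            ≡⟨ KF.solve 5 (λ A u q i w → A KF.:* u KF.:* (q KF.:* (q KF.:* (i KF.:* w))) KF.:= A KF.:* (q KF.:* (q KF.:* i)) KF.:* (u KF.:* w)) refl
                (ι a) (1# , c) √d (ι (s * δ⁻¹)) w ⟩
          mulK (mulK (ι a) (mulK √d (mulK √d (ι (s * δ⁻¹))))) (mulK (1# , c) w)
            ≡⟨ cong₂ mulK (trans (cong (mulK (ι a)) (√d*√d s)) (trans (ι-* a (π * s)) (cong ι as))) e ⟩
          mulK KF.1# KF.1#
            ≡⟨ KF.solve 0 (KF.con 1 KF.:* KF.con 1 KF.:= KF.con 1) refl ⟩
          KF.1# ∎)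
        where open ≡-Reasoning

      irrational-part-dominates : ∀ {b w s} → b * (π * s) ≡ 1# → Int s → Int w → Reciprocal (b * (π * w) , b)
      irrational-part-dominates {b} {w} {s} bs is iw =
        let v , iv , e = inverse-of-unit {1#} {w * δ⁻¹} Unit-1 (Int-* iw Int-δ⁻¹) in
        mulK (ι (s * δ⁻¹)) v , IntK-* (Int-* is Int-δ⁻¹ , Int-0) iv , (begin
          mulK (b * (π * w) , b) (mulK √d (mulK (ι (s * δ⁻¹)) v))
            ≡⟨ cong (λ x → mulK x (mulK √d (mulK (ι (s * δ⁻¹)) v))) (sym (trans (cong (mulK (ι b)) (√d* 1# (w * δ⁻¹))) (trans (ι*pair b (d * (w * δ⁻¹)) 1#)
                 (cong₂ _,_ (combine₁ (b * π * w) δδ⁻¹ (solve 5 (λ b p δ w i → b :* (p :* δ :* (w :* i)) :+ b :* p :* w :* con 1 :=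
                     b :* (p :* w) :+ b :* p :* w :* (δ :* i)) refl b π δ w δ⁻¹)) (solve 1 (λ a → a :* con 1 := a) refl b))))) ⟩
          mulK (mulK (ι b) (mulK √d (1# , w * δ⁻¹))) (mulK √d (mulK (ι (s * δ⁻¹)) v))
            ≡⟨ KF.solve 5 (λ A u q i w → A KF.:* (q KF.:* u) KF.:* (q KF.:* (i KF.:* w)) KF.:= A KF.:* (q KF.:* (q KF.:* i)) KF.:* (u KF.:* w)) refl
                (ι b) (1# , w * δ⁻¹) √d (ι (s * δ⁻¹)) v ⟩
          mulK (mulK (ι b) (mulK √d (mulK √d (ι (s * δ⁻¹))))) (mulK (1# , w * δ⁻¹) v)
            ≡⟨ cong₂ mulK (trans (cong (mulK (ι b)) (√d*√d s)) (trans (ι-* b (π * s)) (cong ι bs))) e ⟩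
          mulK KF.1# KF.1#
            ≡⟨ KF.solve 0 (KF.con 1 KF.:* KF.con 1 KF.:= KF.con 1) refl ⟩
          KF.1# ∎)
        where open ≡-Reasoning

      times-inverse : ∀ {a b t} → a * t ≡ 1# → a * (b * t) ≡ b
      times-inverse {a} {b} {t} e = combine₁ b e (solve 3 (λ a b t → a :* (b :* t) :+ b :* con 1 := b :+ b :* (a :* t)) refl a b t)

      -- In K the valuation of a is even and that of b√d odd, so one of the two dominates. Factoring
      -- it out leaves an element with rational part 1, which is a unit.
      valuationK : ∀ x → IntK x ⊎ Reciprocal x
      valuationK (a , b) with valuation a
      ... | inj₂ (s , is , as) = by-ratio (valuation (b * (π * s)))
        where
        by-ratio : Int (b * (π * s)) ⊎ (∃ λ r → Int r × b * (π * s) * (π * r) ≡ 1#) → IntK (a , b) ⊎ Reciprocal (a , b)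
        by-ratio (inj₁ ic) = inj₂ (subst (λ z → Reciprocal (a , z)) (times-inverse as) (rational-part-dominates as is ic))
        by-ratio (inj₂ (w , iw , e)) = inj₂ (subst (λ z → Reciprocal (z , b))
          (combine₂ a e (- (b * (π * w))) as (solve 5 (λ a b p s w →
            b :* (p :* w) :+ (a :* con 1 :+ :- (b :* (p :* w)) :* con 1) :=
            a :+ (a :* (b :* (p :* s) :* (p :* w)) :+ :- (b :* (p :* w)) :* (a :* (p :* s)))) refl a b π s w))
          (irrational-part-dominates (trans (solve 4 (λ b p s w → b :* (p :* (p :* s :* w)) := b :* (p :* s) :* (p :* w)) refl b π s w) e)
            (Int-* (Int-* Int-π is) iw) iw))
      ... | inj₁ ia with valuation b
      ...   | inj₁ ib = inj₁ (ia , ib)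
      ...   | inj₂ (s , is , bs) = inj₂ (subst (λ z → Reciprocal (z , b))
          (trans (cong (b *_) (solve 3 (λ a p s → p :* (a :* s) := a :* (p :* s)) refl a π s)) (times-inverse bs))
          (irrational-part-dominates bs is (Int-* ia is)))

    quadraticLocalization : Localization quadratic
    quadraticLocalization = record
      { Int = IntK
      ; Int-+ = λ { (ia , ib) (ic , ie) → Int-+ ia ic , Int-+ ib ie }
      ; Int-* = IntK-*
      ; Int-neg = λ { (ia , ib) → Int-neg ia , Int-neg ib }
      ; Int-# = λ i → Int-# i , Int-0
      ; π = √d
      ; Int-π = Int-0 , Int-# (+ 1)
      ; π-or-unit = π-or-unitK
      ; π≢0 = λ e → ¬Max-1 (subst Max (sym (cong proj₂ e)) Max-0)
      ; π-nonunit = π-nonunitK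
      ; valuation = valuationK }

-- Conjugation as an automorphism of the group of points

module _ (F : Field) where
  open FieldTheory F

  module Involution (α β γ : Carrier) (σ : Carrier → Carrier)
    (σ-+ : ∀ x y → σ (x + y) ≡ σ x + σ y) (σ-* : ∀ x y → σ (x * y) ≡ σ x * σ y)
    (σ-neg : ∀ x → σ (- x) ≡ - σ x) (σ-# : ∀ i → σ (# i) ≡ # i) (σσ : ∀ x → σ (σ x) ≡ x)
    (σα : σ α ≡ α) (σβ : σ β ≡ β) (σγ : σ γ ≡ γ) where
    open CubicCurve F α β γ

    σPt : Pt → Pt
    σPt O = O
    σPt (aff x y) = aff (σ x) (σ y)

    private
      σ-- : ∀ x y → σ (x - y) ≡ σ x - σ y
      σ-- x y = trans (σ-+ x (- y)) (cong (λ z → σ x + z) (σ-neg y))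

      σ-D : ∀ x y → σ (D x y) ≡ D (σ x) (σ y)
      σ-D x y = trans (σ-+ _ β) (cong₂ _+_ (trans (σ-+ _ _) (cong₂ _+_ (trans (σ-+ _ _) (cong₂ _+_
        (trans (σ-+ _ _) (cong₂ _+_ (σ-* x x) (σ-* x y))) (σ-* y y))) (trans (σ-* _ _) (cong₂ _*_ σα (σ-+ x y))))) σβ)

      σ-f : ∀ x → σ (f x) ≡ f (σ x)
      σ-f x = trans (σ-+ _ γ) (cong₂ _+_ (trans (σ-+ _ _) (cong₂ _+_ (trans (σ-+ _ _) (cong₂ _+_
        (trans (σ-* _ x) (cong (_* σ x) (σ-* x x)))
        (trans (σ-* _ x) (cong (_* σ x) (trans (σ-* α x) (cong (_* σ x) σα))))))
        (trans (σ-* β x) (cong (_* σ x) σβ)))) σγ)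

      σ-opposite : ∀ {x₁ y₁ x₂ y₂} → Opposite x₁ y₁ x₂ y₂ → Opposite (σ x₁) (σ y₁) (σ x₂) (σ y₂)
      σ-opposite {x₁} {y₁} {x₂} {y₂} (x= , y=) =
        trans (sym (σ-- x₁ x₂)) (trans (cong σ x=) (σ-# (+ 0))) , trans (sym (σ-+ y₁ y₂)) (trans (cong σ y=) (σ-# (+ 0)))

      σ-slope : ∀ {x₁ y₁ x₂ y₂ λ'} → Slope λ' x₁ y₁ x₂ y₂ → Slope (σ λ') (σ x₁) (σ y₁) (σ x₂) (σ y₂)
      σ-slope {x₁} {y₁} {x₂} {y₂} {l} (slope e₁ e₂) = slope
        (trans (cong (_* σ l) (sym (σ-- x₁ x₂))) (trans (sym (σ-* (x₁ - x₂) l)) (trans (cong σ e₁) (σ-- y₁ y₂))))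
        (trans (cong (_* σ l) (sym (σ-+ y₁ y₂))) (trans (sym (σ-* (y₁ + y₂) l)) (trans (cong σ e₂) (σ-D x₁ x₂))))

      σ-chord : ∀ l x₁ y₁ x₂ → σPt (chord l x₁ y₁ x₂) ≡ chord (σ l) (σ x₁) (σ y₁) (σ x₂)
      σ-chord l x₁ y₁ x₂ = aff-cong x₃-eq (trans (σ-- _ y₁) (cong (_- σ y₁) (trans (σ-* l _) (cong (λ z → σ l * z)
          (trans (σ-- x₁ _) (cong (λ z → σ x₁ - z) x₃-eq))))))
        where
        x₃-eq : σ (l * l - α - x₁ - x₂) ≡ σ l * σ l - α - σ x₁ - σ x₂
        x₃-eq = trans (σ-- _ x₂) (cong (_- σ x₂) (trans (σ-- _ x₁) (cong (_- σ x₁) (trans (σ-- _ α) (cong₂ _-_ (σ-* l l) σα)))))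

    σ-On : ∀ P → On P → On (σPt P)
    σ-On O _ = tt
    σ-On (aff x y) on = trans (sym (σ-* y y)) (trans (cong σ on) (σ-f x))

    σ-involutive : ∀ P → σPt (σPt P) ≡ P
    σ-involutive O = refl
    σ-involutive (aff x y) = aff-cong (σσ x) (σσ y)

    σ-neg-Pt : ∀ P → σPt (neg P) ≡ neg (σPt P)
    σ-neg-Pt O = refl
    σ-neg-Pt (aff x y) = cong (aff (σ x)) (σ-neg y)

    σ-⊕ : ∀ P Q → On P → On Q → σPt (P ⊕ Q) ≡ σPt P ⊕ σPt Q
    σ-⊕ O Q _ _ = refl
    σ-⊕ (aff _ _) O _ _ = refl
    σ-⊕ (aff x₁ y₁) (aff x₂ y₂) on₁ on₂ = by-cases (sumView on₁ on₂)
      where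
      by-cases : SumView x₁ y₁ x₂ y₂ → σPt (aff x₁ y₁ ⊕ aff x₂ y₂) ≡ aff (σ x₁) (σ y₁) ⊕ aff (σ x₂) (σ y₂)
      by-cases (inj₁ opp) = trans (cong σPt (⊕-opposite opp)) (sym (⊕-opposite (σ-opposite opp)))
      by-cases (inj₂ (¬opp , l , sl)) = trans (cong σPt (⊕-slope ¬opp sl)) (trans (σ-chord l x₁ y₁ x₂)
        (sym (⊕-slope (λ opp → ¬opp (subst₂ (λ P Q → Opposite′ P Q) (σ-involutive (aff x₁ y₁)) (σ-involutive (aff x₂ y₂)) (σ-opposite opp)))
          (σ-slope sl))))
        where
        Opposite′ : Pt → Pt → Set
        Opposite′ (aff x y) (aff x' y') = Opposite x y x' y'
        Opposite′ _ _ = ⊥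

-- Multiples of a point

module _ (F : Field) (α β γ : Field.Carrier F) where
  open FieldTheory F
  open CubicCurve F α β γ

  module Multiples
    (nonsingular : ∀ {x y} → On (aff x y) → y + y ≡ 0# → D x x ≡ 0# → ⊥) where
    open Associativity nonsingular
    open import Data.Nat as ℕ using (ℕ; zero; suc)
    import Data.Nat.Properties as ℕP

    On-· : ∀ n P → On P → On (n · P)
    On-· zero P on = tt
    On-· (suc n) P on = On-⊕ P (n · P) on (On-· n P on)

    ·-+ : ∀ m n P → On P → (m ℕ.+ n) · P ≡ m · P ⊕ n · P
    ·-+ zero n P on = refl
    ·-+ (suc m) n P on = trans (cong (P ⊕_) (·-+ m n P on)) (sym (⊕-assoc P (m · P) (n · P) on (On-· m P on) (On-· n P on)))

    ·-O : ∀ n → n · O ≡ O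
    ·-O zero = refl
    ·-O (suc n) = ·-O n

    ·-* : ∀ m n P → On P → (m ℕ.* n) · P ≡ m · (n · P)
    ·-* zero n P on = refl
    ·-* (suc m) n P on = trans (·-+ n (m ℕ.* n) P on) (cong (n · P ⊕_) (·-* m n P on))

    interchange : ∀ P Q R S → On P → On Q → On R → On S → (P ⊕ Q) ⊕ (R ⊕ S) ≡ (P ⊕ R) ⊕ (Q ⊕ S)
    interchange P Q R S p q r s = begin
      (P ⊕ Q) ⊕ (R ⊕ S)    ≡⟨ ⊕-assoc P Q (R ⊕ S) p q (On-⊕ R S r s) ⟩
      P ⊕ (Q ⊕ (R ⊕ S))    ≡⟨ cong (P ⊕_) (⊕-assoc Q R S q r s) ⟨
      P ⊕ (Q ⊕ R ⊕ S)      ≡⟨ cong (λ T → P ⊕ (T ⊕ S)) (⊕-comm Q R q r) ⟩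
      P ⊕ (R ⊕ Q ⊕ S)      ≡⟨ cong (P ⊕_) (⊕-assoc R Q S r q s) ⟩
      P ⊕ (R ⊕ (Q ⊕ S))    ≡⟨ ⊕-assoc P R (Q ⊕ S) p r (On-⊕ Q S q s) ⟨
      (P ⊕ R) ⊕ (Q ⊕ S)    ∎
      where open ≡-Reasoning

    ·-⊕ : ∀ n P Q → On P → On Q → n · (P ⊕ Q) ≡ n · P ⊕ n · Q
    ·-⊕ zero P Q _ _ = refl
    ·-⊕ (suc n) P Q p q = trans (cong (P ⊕ Q ⊕_) (·-⊕ n P Q p q))
      (interchange P Q (n · P) (n · Q) p q (On-· n P p) (On-· n Q q))

    ·-neg : ∀ n P → On P → n · neg P ≡ neg (n · P)
    ·-neg zero P _ = refl
    ·-neg (suc n) P p = trans (cong (neg P ⊕_) (·-neg n P p)) (sym (neg-⊕ P (n · P) p (On-· n P p)))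

-- Good reduction

module _ (F : Field) where
  open FieldTheory F

  module Coefficients (a₁ a₂ a₃ a₄ a₆ : Carrier) where

    b₂ b₄ b₆ b₈ Δ : Carrier
    b₂ = a₁ * a₁ + # (+ 4) * a₂
    b₄ = # (+ 2) * a₄ + a₁ * a₃
    b₆ = a₃ * a₃ + # (+ 4) * a₆
    b₈ = a₁ * a₁ * a₆ + # (+ 4) * a₂ * a₆ - a₁ * a₃ * a₄ + a₂ * a₃ * a₃ - a₄ * a₄
    Δ = - (b₂ * b₂ * b₈) - # (+ 8) * (b₄ * b₄ * b₄) - # (+ 27) * (b₆ * b₆) + # (+ 9) * b₂ * b₄ * b₆

    4b₈ : # (+ 4) * b₈ ≡ b₂ * b₆ - b₄ * b₄
    4b₈ = solve 5 (λ a₁ a₂ a₃ a₄ a₆ → con 4 :* (a₁ :* a₁ :* a₆ :+ con 4 :* a₂ :* a₆ :- a₁ :* a₃ :* a₄ :+ a₂ :* a₃ :* a₃ :- a₄ :* a₄) :=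
      (a₁ :* a₁ :+ con 4 :* a₂) :* (a₃ :* a₃ :+ con 4 :* a₆) :- (con 2 :* a₄ :+ a₁ :* a₃) :* (con 2 :* a₄ :+ a₁ :* a₃))
      refl a₁ a₂ a₃ a₄ a₆

    4Δ : # (+ 4) * Δ ≡ - (b₂ * b₂ * (b₂ * b₆ - b₄ * b₄)) - # (+ 32) * (b₄ * b₄ * b₄) - # (+ 108) * (b₆ * b₆) + # (+ 36) * b₂ * b₄ * b₆
    4Δ = combine₁ (- (b₂ * b₂)) 4b₈ (solve 4 (λ b₂ b₄ b₆ b₈ →
      con 4 :* (:- (b₂ :* b₂ :* b₈) :- con 8 :* (b₄ :* b₄ :* b₄) :- con 27 :* (b₆ :* b₆) :+ con 9 :* b₂ :* b₄ :* b₆) :+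
        :- (b₂ :* b₂) :* (b₂ :* b₆ :- b₄ :* b₄) :=
      :- (b₂ :* b₂ :* (b₂ :* b₆ :- b₄ :* b₄)) :- con 32 :* (b₄ :* b₄ :* b₄) :- con 108 :* (b₆ :* b₆) :+ con 36 :* b₂ :* b₄ :* b₆ :+
        :- (b₂ :* b₂) :* (con 4 :* b₈)) refl b₂ b₄ b₆ b₈)

    -- The value at (x , y) and, up to sign, the partial derivatives of the Weierstrass equation.
    value ∂x ∂y : Carrier → Carrier → Carrier
    value x y = y * y + a₁ * x * y + a₃ * y - (x * x * x + a₂ * x * x + a₄ * x + a₆)
    ∂x x y = # (+ 3) * x * x + # (+ 2) * a₂ * x + a₄ - a₁ * y
    ∂y x y = # (+ 2) * y + a₁ * x + a₃

    completed-square : ∀ {α β γ x y Y} → # (+ 4) ≢ 0# → # (+ 4) * α ≡ b₂ → # (+ 2) * β ≡ b₄ → # (+ 4) * γ ≡ b₆ →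
      Y + Y ≡ y + y + (a₁ * x + a₃) → CubicCurve.On F α β γ (CubicCurve.aff x Y) →
      y * y + (a₁ * x + a₃) * y + - (x * x * x + a₂ * x * x + a₄ * x + a₆) ≡ 0#
    completed-square {α} {β} {γ} {x} {y} {Y} 4≢0 e₂ e₄ e₆ eY on = *≡0⇒ 4≢0 (begin
      # (+ 4) * (y * y + k * y + - (x * x * x + a₂ * x * x + a₄ * x + a₆))
        ≡⟨ solve 7 (λ y k x a₂ a₄ a₆ r → con 4 :* (y :* y :+ k :* y :+ :- (x :* x :* x :+ a₂ :* x :* x :+ a₄ :* x :+ a₆)) :=
             (y :+ y :+ k) :* (y :+ y :+ k) :- (con 4 :* (x :* x :* x) :+ (k :* k :+ con 4 :* (a₂ :* x :* x :+ a₄ :* x :+ a₆)))) refl y k x a₂ a₄ a₆ 0# ⟩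
      (y + y + k) * (y + y + k) - (# (+ 4) * (x * x * x) + (k * k + # (+ 4) * (a₂ * x * x + a₄ * x + a₆)))
        ≡⟨ cong₂ (λ u v → u * u - (# (+ 4) * (x * x * x) + v)) (sym eY)
             (solve 6 (λ a₁ a₂ a₃ a₄ a₆ x → (a₁ :* x :+ a₃) :* (a₁ :* x :+ a₃) :+ con 4 :* (a₂ :* x :* x :+ a₄ :* x :+ a₆) :=
               (a₁ :* a₁ :+ con 4 :* a₂) :* (x :* x) :+ con 2 :* (con 2 :* a₄ :+ a₁ :* a₃) :* x :+ (a₃ :* a₃ :+ con 4 :* a₆)) refl a₁ a₂ a₃ a₄ a₆ x) ⟩
      (Y + Y) * (Y + Y) - (# (+ 4) * (x * x * x) + (b₂ * (x * x) + # (+ 2) * b₄ * x + b₆))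
        ≡⟨ cong (λ z → (Y + Y) * (Y + Y) - (# (+ 4) * (x * x * x) + z)) (trans (cong₂ (λ u v → u * (x * x) + # (+ 2) * v * x + b₆) (sym e₂) (sym e₄))
             (cong (λ w → # (+ 4) * α * (x * x) + # (+ 2) * (# (+ 2) * β) * x + w) (sym e₆))) ⟩
      (Y + Y) * (Y + Y) - (# (+ 4) * (x * x * x) + (# (+ 4) * α * (x * x) + # (+ 2) * (# (+ 2) * β) * x + # (+ 4) * γ))
        ≡⟨ combine₁ (# (+ 4)) on (solve 5 (λ α β γ x Y →
             (Y :+ Y) :* (Y :+ Y) :- (con 4 :* (x :* x :* x) :+ (con 4 :* α :* (x :* x) :+ con 2 :* (con 2 :* β) :* x :+ con 4 :* γ)) :+
               con 4 :* (x :* x :* x :+ α :* x :* x :+ β :* x :+ γ) :=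
             con 0 :+ con 4 :* (Y :* Y)) refl α β γ x Y) ⟩
      0# ∎)
      where
      open ≡-Reasoning
      k = a₁ * x + a₃

module _ (F : Field) where
  open FieldTheory F

  module Translation (a₁ a₂ a₃ a₄ a₆ x y : Carrier) where
    open Coefficients F a₁ a₂ a₃ a₄ a₆
    -- The equation with (x , y) moved to the origin: there a₃, a₄ and a₆ are, up to sign, the
    -- partial derivatives and the value of the equation at the point.
    module C' = Coefficients F a₁ (a₂ + # (+ 3) * x) (∂y x y) (∂x x y) (- value x y)

    Δ-translation : # (+ 4) ≢ 0# → C'.Δ ≡ Δ
    Δ-translation 4≢0 = *-cancelˡ 4≢0 (begin
      # (+ 4) * C'.Δ                 ≡⟨ C'.4Δ ⟩
      Δ₄ C'.b₂ C'.b₄ C'.b₆           ≡⟨ cong₂ (λ u v → Δ₄ u v C'.b₆) b₂-eq b₄-eq ⟩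
      Δ₄ B₂ B₄ C'.b₆                 ≡⟨ cong (Δ₄ B₂ B₄) b₆-eq ⟩
      Δ₄ B₂ B₄ B₆                    ≡⟨ solve 4 (λ b₂ b₄ b₆ x → Δ₄P (b₂ :+ con 12 :* x) (b₄ :+ x :* b₂ :+ con 6 :* (x :* x))
                                          (b₆ :+ con 2 :* x :* b₄ :+ x :* x :* b₂ :+ con 4 :* (x :* x :* x)) := Δ₄P b₂ b₄ b₆) refl b₂ b₄ b₆ x ⟩
      Δ₄ b₂ b₄ b₆                    ≡⟨ 4Δ ⟨
      # (+ 4) * Δ                    ∎)
      where
      open ≡-Reasoning
      Δ₄ : Carrier → Carrier → Carrier → Carrier
      Δ₄ b₂ b₄ b₆ = - (b₂ * b₂ * (b₂ * b₆ - b₄ * b₄)) - # (+ 32) * (b₄ * b₄ * b₄) - # (+ 108) * (b₆ * b₆) + # (+ 36) * b₂ * b₄ * b₆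
      Δ₄P : ∀ {n} (b₂ b₄ b₆ : Polynomial n) → Polynomial n
      Δ₄P b₂ b₄ b₆ = :- (b₂ :* b₂ :* (b₂ :* b₆ :- b₄ :* b₄)) :- con 32 :* (b₄ :* b₄ :* b₄) :- con 108 :* (b₆ :* b₆) :+ con 36 :* b₂ :* b₄ :* b₆
      B₂ = b₂ + # (+ 12) * x
      B₄ = b₄ + x * b₂ + # (+ 6) * (x * x)
      B₆ = b₆ + # (+ 2) * x * b₄ + x * x * b₂ + # (+ 4) * (x * x * x)
      b₂-eq : C'.b₂ ≡ B₂
      b₂-eq = solve 3 (λ a₁ a₂ x → a₁ :* a₁ :+ con 4 :* (a₂ :+ con 3 :* x) := a₁ :* a₁ :+ con 4 :* a₂ :+ con 12 :* x) refl a₁ a₂ x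
      b₄-eq : C'.b₄ ≡ B₄
      b₄-eq = solve 6 (λ a₁ a₂ a₃ a₄ x y → con 2 :* (con 3 :* x :* x :+ con 2 :* a₂ :* x :+ a₄ :- a₁ :* y) :+ a₁ :* (con 2 :* y :+ a₁ :* x :+ a₃) :=
        con 2 :* a₄ :+ a₁ :* a₃ :+ x :* (a₁ :* a₁ :+ con 4 :* a₂) :+ con 6 :* (x :* x)) refl a₁ a₂ a₃ a₄ x y
      b₆-eq : C'.b₆ ≡ B₆
      b₆-eq = solve 7 (λ a₁ a₂ a₃ a₄ a₆ x y → let ∂y = con 2 :* y :+ a₁ :* x :+ a₃ in
        ∂y :* ∂y :+ con 4 :* :- (y :* y :+ a₁ :* x :* y :+ a₃ :* y :- (x :* x :* x :+ a₂ :* x :* x :+ a₄ :* x :+ a₆)) :=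
        a₃ :* a₃ :+ con 4 :* a₆ :+ con 2 :* x :* (con 2 :* a₄ :+ a₁ :* a₃) :+ x :* x :* (a₁ :* a₁ :+ con 4 :* a₂) :+ con 4 :* (x :* x :* x))
        refl a₁ a₂ a₃ a₄ a₆ x y

module Shift (F : Field) where
  open FieldTheory F

  discP : ∀ {n} (α β γ : Polynomial n) → Polynomial n
  discP α β γ = α :* α :* β :* β :+ con 18 :* α :* β :* γ :- con 4 :* α :* α :* α :* γ :- con 4 :* β :* β :* β :- con 27 :* γ :* γ

  disc : Carrier → Carrier → Carrier → Carrier
  disc α β γ = α * α * β * β + # (+ 18) * α * β * γ - # (+ 4) * α * α * α * γ - # (+ 4) * β * β * β - # (+ 27) * γ * γ

  disc-shift : ∀ α β γ x → disc (α + # (+ 3) * x) (CubicCurve.D F α β γ x x) (CubicCurve.f F α β γ x) ≡ disc α β γ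
  disc-shift = solve 4 (λ α β γ x → discP (α :+ con 3 :* x) (x :* x :+ x :* x :+ x :* x :+ α :* (x :+ x) :+ β)
    (x :* x :* x :+ α :* x :* x :+ β :* x :+ γ) := discP α β γ) refl

  -- Move the singular point to abscissa 0: the new linear and constant coefficients are `D x x` and
  -- `f x`, and the discriminant vanishes with them.
  disc≢0⇒nonsingular : ∀ {α β γ} → # (+ 2) ≢ 0# → disc α β γ ≢ 0# → let open CubicCurve F α β γ in
    ∀ {x y} → On (aff x y) → y + y ≡ 0# → D x x ≡ 0# → ⊥
  disc≢0⇒nonsingular {α} {β} {γ} 2≢0 disc≢0 {x} {y} on 2y≡0 D≡0 = disc≢0 (begin
    disc α β γ                                       ≡⟨ disc-shift α β γ x ⟨
    disc (α + # (+ 3) * x) (D x x) (f x)             ≡⟨ cong₂ (disc (α + # (+ 3) * x)) D≡0 f≡0 ⟩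
    disc (α + # (+ 3) * x) 0# 0#                     ≡⟨ solve 1 (λ α → discP α (con 0) (con 0) := con 0) refl (α + # (+ 3) * x) ⟩
    0#                                               ∎)
    where
    open ≡-Reasoning
    open CubicCurve F α β γ
    y≡0 : y ≡ 0#
    y≡0 = *≡0⇒ 2≢0 (trans (solve 1 (λ y → con 2 :* y := y :+ y) refl y) 2y≡0)
    f≡0 : f x ≡ 0#
    f≡0 = trans (sym on) (trans (cong (λ y → y * y) y≡0) (solve 0 (con 0 :* con 0 := con 0) refl))

module _ {F : Field} (loc : Localization F) where
  open LocalTheory loc

  -- At 2 the coefficients α, β, γ need not be integral. Only the combinations b₂, b₄, b₆, b₈ are
  -- assumed integral, and the formulas for sum and product are rearranged until nothing else occurs
  -- in them.
  module IntegralDifference {α β γ b₂ b₄ b₆ b₈ : Carrier}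
    (4α : # (+ 4) * α ≡ b₂) (2β : # (+ 2) * β ≡ b₄) (4γ : # (+ 4) * γ ≡ b₆) (b₈≡ : b₈ ≡ # (+ 4) * (α * γ) - β * β)
    (int-b₂ : Int b₂) (int-b₄ : Int b₄) (int-b₆ : Int b₆) (int-b₈ : Int b₈) where

    -- If X has a pole and x is integral then x₊ and x₋ are the roots of an integral quadratic
    -- polynomial.
    module _ {X x x₊ x₋ τ v : Carrier} (Xτ : X * τ ≡ 1#) (int-τ : Int τ) (int-x : Int x) (int-v : Int v) (ev : (1# - x * τ) * v ≡ 1#)
      (x-sum : (x₊ + x₋) * ((X - x) * (X - x)) ≡
        # (+ 2) * ((X + x) * (X * x + β) + # (+ 2) * (α * (X * x)) + # (+ 2) * γ))
      (x-product : (x₊ - 0#) * (x₋ - 0#) * ((X - x) * (X - x)) ≡ Formulas.numerator F α β γ 0# X x) where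
      private
        open ≡-Reasoning
        unit : (X - x) * (τ * v) ≡ 1#
        unit = combine₂ 1# ev v Xτ (solve 4 (λ X x t v → (X :- x) :* (t :* v) :+ (con 1 :* con 1 :+ v :* con 1) :=
          con 1 :+ (con 1 :* ((con 1 :- x :* t) :* v) :+ v :* (X :* t))) refl X x τ v)
        A : (X + x) * τ ≡ 1# + x * τ
        A = combine₁ 1# Xτ (solve 3 (λ X x t → (X :+ x) :* t :+ con 1 :* con 1 := con 1 :+ x :* t :+ con 1 :* (X :* t)) refl X x τ)
        times : ∀ {z w} → z * ((X - x) * (X - x)) ≡ w → z ≡ v * v * (w * (τ * τ))
        times {z} {w} e = begin
          z                                                      ≡⟨ solve 1 (λ z → z := z :* (con 1 :* con 1)) refl z ⟩
          z * (1# * 1#)                                          ≡⟨ cong (λ u → z * (u * u)) unit ⟨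
          z * ((X - x) * (τ * v) * ((X - x) * (τ * v)))          ≡⟨ solve 4 (λ z u t v → z :* (u :* (t :* v) :* (u :* (t :* v))) := v :* v :* (z :* (u :* u) :* (t :* t))) refl z (X - x) τ v ⟩
          v * v * (z * ((X - x) * (X - x)) * (τ * τ))            ≡⟨ cong (λ w → v * v * (w * (τ * τ))) e ⟩
          v * v * (w * (τ * τ))                                  ∎

        sum-eq : x₊ + x₋ ≡ v * v * (# (+ 2) * (1# + x * τ) * x + (1# + x * τ) * b₄ * τ + b₂ * x * τ + b₆ * (τ * τ))
        sum-eq = trans (times x-sum) (cong (v * v *_) (begin
          # (+ 2) * ((X + x) * (X * x + β) + # (+ 2) * (α * (X * x)) + # (+ 2) * γ) * (τ * τ)
            ≡⟨ solve 6 (λ X x t α β γ → con 2 :* ((X :+ x) :* (X :* x :+ β) :+ con 2 :* (α :* (X :* x)) :+ con 2 :* γ) :* (t :* t) :=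
                (X :+ x) :* t :* (con 2 :* (X :* t) :* x :+ con 2 :* β :* t) :+ con 4 :* α :* x :* (X :* t) :* t :+ con 4 :* γ :* (t :* t)) refl X x τ α β γ ⟩
          (X + x) * τ * (# (+ 2) * (X * τ) * x + # (+ 2) * β * τ) + # (+ 4) * α * x * (X * τ) * τ + # (+ 4) * γ * (τ * τ)
            ≡⟨ cong₂ (λ a c → a * (# (+ 2) * c * x + # (+ 2) * β * τ) + # (+ 4) * α * x * c * τ + # (+ 4) * γ * (τ * τ)) A Xτ ⟩
          (1# + x * τ) * (# (+ 2) * 1# * x + # (+ 2) * β * τ) + # (+ 4) * α * x * 1# * τ + # (+ 4) * γ * (τ * τ)
            ≡⟨ cong₂ (λ b c → (1# + x * τ) * (# (+ 2) * 1# * x + b * τ) + # (+ 4) * α * x * 1# * τ + c * (τ * τ)) 2β 4γ ⟩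
          (1# + x * τ) * (# (+ 2) * 1# * x + b₄ * τ) + # (+ 4) * α * x * 1# * τ + b₆ * (τ * τ)
            ≡⟨ cong (λ a → (1# + x * τ) * (# (+ 2) * 1# * x + b₄ * τ) + a * x * 1# * τ + b₆ * (τ * τ)) 4α ⟩
          (1# + x * τ) * (# (+ 2) * 1# * x + b₄ * τ) + b₂ * x * 1# * τ + b₆ * (τ * τ)
            ≡⟨ solve 5 (λ x t a b c → (con 1 :+ x :* t) :* (con 2 :* con 1 :* x :+ b :* t) :+ a :* x :* con 1 :* t :+ c :* (t :* t) :=
                 con 2 :* (con 1 :+ x :* t) :* x :+ (con 1 :+ x :* t) :* b :* t :+ a :* x :* t :+ c :* (t :* t)) refl x τ b₂ b₄ b₆ ⟩
          # (+ 2) * (1# + x * τ) * x + (1# + x * τ) * b₄ * τ + b₂ * x * τ + b₆ * (τ * τ) ∎))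

        product-eq : (x₊ - 0#) * (x₋ - 0#) ≡ v * v * (x * x - b₄ * x * τ - b₆ * τ * (1# + x * τ) - b₈ * (τ * τ))
        product-eq = trans (times x-product) (cong (v * v *_) (begin
          Formulas.numerator F α β γ 0# X x * (τ * τ)
            ≡⟨ solve 6 (λ X x t α β γ → let z = con 0
                                            m = (X :- z) :* (x :- z) :- (z :* z :+ z :* z :+ z :* z :+ α :* (z :+ z) :+ β) in
                 (m :* m :- con 4 :* (z :* z :* z :+ α :* z :* z :+ β :* z :+ γ) :* (X :+ x :+ z :+ α)) :* (t :* t) :=
                 (X :* t :* x :- β :* t) :* (X :* t :* x :- β :* t) :- con 4 :* γ :* (t :* ((X :+ x) :* t)) :- con 4 :* (α :* γ) :* (t :* t)) refl X x τ α β γ ⟩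
          (X * τ * x - β * τ) * (X * τ * x - β * τ) - # (+ 4) * γ * (τ * ((X + x) * τ)) - # (+ 4) * (α * γ) * (τ * τ)
            ≡⟨ cong₂ (λ a c → (c * x - β * τ) * (c * x - β * τ) - # (+ 4) * γ * (τ * a) - # (+ 4) * (α * γ) * (τ * τ)) A Xτ ⟩
          (1# * x - β * τ) * (1# * x - β * τ) - # (+ 4) * γ * (τ * (1# + x * τ)) - # (+ 4) * (α * γ) * (τ * τ)
            ≡⟨ solve 5 (λ x t β g ag → (con 1 :* x :- β :* t) :* (con 1 :* x :- β :* t) :- g :* (t :* (con 1 :+ x :* t)) :- ag :* (t :* t) :=
                 x :* x :- con 2 :* β :* x :* t :- g :* t :* (con 1 :+ x :* t) :- (ag :- β :* β) :* (t :* t)) refl x τ β (# (+ 4) * γ) (# (+ 4) * (α * γ)) ⟩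
          x * x - # (+ 2) * β * x * τ - # (+ 4) * γ * τ * (1# + x * τ) - (# (+ 4) * (α * γ) - β * β) * (τ * τ)
            ≡⟨ cong₂ (λ b c → x * x - b * x * τ - # (+ 4) * γ * τ * (1# + x * τ) - c * (τ * τ)) 2β (sym b₈≡) ⟩
          x * x - b₄ * x * τ - # (+ 4) * γ * τ * (1# + x * τ) - b₈ * (τ * τ)
            ≡⟨ cong (λ g → x * x - b₄ * x * τ - g * τ * (1# + x * τ) - b₈ * (τ * τ)) 4γ ⟩
          x * x - b₄ * x * τ - b₆ * τ * (1# + x * τ) - b₈ * (τ * τ) ∎))

        int-1+xτ : Int (1# + x * τ)
        int-1+xτ = Int-+ (Int-# (+ 1)) (Int-* int-x int-τ)
        int-v² : Int (v * v)
        int-v² = Int-* int-v int-v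
        int-τ² : Int (τ * τ)
        int-τ² = Int-* int-τ int-τ

      difference-integral : Int x₋
      difference-integral = integrally-closed
        (Int-neg (subst Int (sym sum-eq) (Int-* int-v² (Int-+ (Int-+ (Int-+ (Int-* (Int-* (Int-# (+ 2)) int-1+xτ) int-x)
          (Int-* (Int-* int-1+xτ int-b₄) int-τ)) (Int-* (Int-* int-b₂ int-x) int-τ)) (Int-* int-b₆ int-τ²)))))
        (subst Int (sym product-eq) (Int-* int-v² (Int-- (Int-- (Int-- (Int-* int-x int-x) (Int-* (Int-* int-b₄ int-x) int-τ))
          (Int-* (Int-* int-b₆ int-τ) int-1+xτ)) (Int-* int-b₈ int-τ²))))
        (solve 2 (λ x₊ x₋ → x₋ :* x₋ :+ :- (x₊ :+ x₋) :* x₋ :+ (x₊ :- con 0) :* (x₋ :- con 0) := con 0) refl x₊ x₋)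

module _ {F : Field} (loc : Localization F) where
  open LocalTheory loc

  module IntegralInvariants {a₁ a₂ a₃ a₄ a₆ : Carrier}
    (int₁ : Int a₁) (int₂ : Int a₂) (int₃ : Int a₃) (int₄ : Int a₄) (int₆ : Int a₆) where
    open Coefficients F a₁ a₂ a₃ a₄ a₆ using (b₂; b₄; b₆; b₈; Δ)

    Int-b₂ : Int b₂
    Int-b₂ = Int-+ (Int-* int₁ int₁) (Int-* (Int-# (+ 4)) int₂)
    Int-b₄ : Int b₄
    Int-b₄ = Int-+ (Int-* (Int-# (+ 2)) int₄) (Int-* int₁ int₃)
    Int-b₆ : Int b₆
    Int-b₆ = Int-+ (Int-* int₃ int₃) (Int-* (Int-# (+ 4)) int₆)
    Int-b₈ : Int b₈
    Int-b₈ = Int-- (Int-+ (Int-- (Int-+ (Int-* (Int-* int₁ int₁) int₆) (Int-* (Int-* (Int-# (+ 4)) int₂) int₆))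
      (Int-* (Int-* int₁ int₃) int₄)) (Int-* (Int-* int₂ int₃) int₃)) (Int-* int₄ int₄)
    Int-Δ : Int Δ
    Int-Δ = Int-+ (Int-- (Int-- (Int-neg (Int-* (Int-* Int-b₂ Int-b₂) Int-b₈)) (Int-* (Int-# (+ 8)) (Int-* (Int-* Int-b₄ Int-b₄) Int-b₄)))
      (Int-* (Int-# (+ 27)) (Int-* Int-b₆ Int-b₆))) (Int-* (Int-* (Int-* (Int-# (+ 9)) Int-b₂) Int-b₄) Int-b₆)

module _ {F : Field} (loc : Localization F) where
  open LocalTheory loc

  module GoodReduction
    (δ : Carrier) (δ-unit : Unit δ) (2≢0 : # (+ 2) ≢ 0#) (a₁ a₂ a₃ a₄ a₆ α β γ : Carrier)
    (4α : # (+ 4) * α ≡ Coefficients.b₂ F a₁ a₂ a₃ a₄ a₆)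
    (2β : # (+ 2) * β ≡ Coefficients.b₄ F a₁ a₂ a₃ a₄ a₆)
    (4γ : # (+ 4) * γ ≡ Coefficients.b₆ F a₁ a₂ a₃ a₄ a₆)
    (int₁ : Int a₁) (int₂ : Int a₂) (int₃ : Int a₃) (int₄ : Int a₄) (int₆ : Int a₆)
    (Δ-unit : Unit (Coefficients.Δ F a₁ a₂ a₃ a₄ a₆)) where
    open Coefficients F a₁ a₂ a₃ a₄ a₆ using (b₂; b₄; b₆; b₈; Δ; 4b₈; value; ∂x; ∂y)
    open Ramified loc δ δ-unit public
    open Shift F using (disc; discP)

    open IntegralInvariants loc int₁ int₂ int₃ int₄ int₆ public using (Int-b₂; Int-b₄; Int-b₆; Int-b₈)

    4≢0 : # (+ 4) ≢ 0#
    4≢0 e = 2≢0 (*≡0⇒ 2≢0 (trans (solve 0 (con 2 :* con 2 := con 4) refl) e))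

    b₈≡ : b₈ ≡ # (+ 4) * (α * γ) - β * β
    b₈≡ = *-cancelˡ 4≢0 (trans 4b₈ (trans (cong₂ _-_ (cong₂ _*_ (sym 4α) (sym 4γ)) (cong₂ _*_ (sym 2β) (sym 2β)))
      (solve 3 (λ α β γ → con 4 :* α :* (con 4 :* γ) :- con 2 :* β :* (con 2 :* β) :=
        con 4 :* (con 4 :* (α :* γ) :- β :* β)) refl α β γ)))

    Δ≡ : Δ ≡ # (+ 16) * disc α β γ
    Δ≡ = begin
      Δ ≡⟨ cong₂ (λ u v → - (u * u * b₈) - # (+ 8) * (v * v * v) - # (+ 27) * (b₆ * b₆) + # (+ 9) * u * v * b₆) (sym 4α) (sym 2β) ⟩
      - (# (+ 4) * α * (# (+ 4) * α) * b₈) - # (+ 8) * (# (+ 2) * β * (# (+ 2) * β) * (# (+ 2) * β)) - # (+ 27) * (b₆ * b₆)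
        + # (+ 9) * (# (+ 4) * α) * (# (+ 2) * β) * b₆
        ≡⟨ cong₂ (λ u v → - (# (+ 4) * α * (# (+ 4) * α) * u) - # (+ 8) * (# (+ 2) * β * (# (+ 2) * β) * (# (+ 2) * β))
             - # (+ 27) * (v * v) + # (+ 9) * (# (+ 4) * α) * (# (+ 2) * β) * v) b₈≡ (sym 4γ) ⟩
      - (# (+ 4) * α * (# (+ 4) * α) * (# (+ 4) * (α * γ) - β * β)) - # (+ 8) * (# (+ 2) * β * (# (+ 2) * β) * (# (+ 2) * β))
             - # (+ 27) * (# (+ 4) * γ * (# (+ 4) * γ)) + # (+ 9) * (# (+ 4) * α) * (# (+ 2) * β) * (# (+ 4) * γ)
        ≡⟨ solve 3 (λ α β γ → let A = con 4 :* α
                                  B = con 2 :* β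
                                  C = con 4 :* γ in
             :- (A :* A :* (con 4 :* (α :* γ) :- β :* β)) :- con 8 :* (B :* B :* B) :- con 27 :* (C :* C) :+ con 9 :* A :* B :* C :=
             con 16 :* discP α β γ) refl α β γ ⟩
      # (+ 16) * disc α β γ ∎
      where open ≡-Reasoning

    disc≢0 : disc α β γ ≢ 0#
    disc≢0 e = Unit⇒≢0 Δ-unit (trans Δ≡ (trans (cong (# (+ 16) *_) e) (solve 0 (con 16 :* con 0 := con 0) refl)))

    module KL = LocalTheory quadraticLocalization
    module KF = FieldTheory quadratic

    private
      ι-disc : Shift.disc quadratic (ι α) (ι β) (ι γ) ≡ ι (disc α β γ)
      ι-disc = ‵ α ⟨*⟩ ‵ α ⟨*⟩ ‵ β ⟨*⟩ ‵ β ⟨+⟩ ‵ (# (+ 18)) ⟨*⟩ ‵ α ⟨*⟩ ‵ β ⟨*⟩ ‵ γ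
        ⟨-⟩ ‵ (# (+ 4)) ⟨*⟩ ‵ α ⟨*⟩ ‵ α ⟨*⟩ ‵ α ⟨*⟩ ‵ γ
        ⟨-⟩ ‵ (# (+ 4)) ⟨*⟩ ‵ β ⟨*⟩ ‵ β ⟨*⟩ ‵ β
        ⟨-⟩ ‵ (# (+ 27)) ⟨*⟩ ‵ γ ⟨*⟩ ‵ γ

    open CubicCurve quadratic (ι α) (ι β) (ι γ) public

    nonsingular : ∀ {x y} → On (aff x y) → KF._+_ y y ≡ KF.0# → D x x ≡ KF.0# → ⊥
    nonsingular = Shift.disc≢0⇒nonsingular quadratic (λ e → 2≢0 (cong proj₁ e)) (λ e → disc≢0 (cong proj₁ (trans (sym ι-disc) e)))

    open Associativity nonsingular public
    open Multiples quadratic (ι α) (ι β) (ι γ) nonsingular public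

    private
      conj-ι : ∀ x → conj (ι x) ≡ ι x
      conj-ι x = cong (x ,_) (solve 0 (:- con 0 := con 0) refl)

      conj-+ : ∀ x y → conj (addK x y) ≡ addK (conj x) (conj y)
      conj-+ (a , b) (c , e) = cong (a + c ,_) (solve 2 (λ b e → :- (b :+ e) := :- b :+ :- e) refl b e)

      conj-* : ∀ x y → conj (mulK x y) ≡ mulK (conj x) (conj y)
      conj-* (a , b) (c , e) = cong₂ _,_
        (solve 5 (λ d a b c e → a :* c :+ d :* (b :* e) := a :* c :+ d :* (:- b :* :- e)) refl d a b c e)
        (solve 4 (λ a b c e → :- (a :* e :+ b :* c) := a :* :- e :+ :- b :* c) refl a b c e)

      conj-involutive : ∀ x → conj (conj x) ≡ x
      conj-involutive (a , b) = cong (a ,_) (solve 1 (λ b → :- (:- b) := b) refl b)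

    open Involution quadratic (ι α) (ι β) (ι γ) conj conj-+ conj-* (λ _ → refl) (λ i → conj-ι (# i)) conj-involutive
      (conj-ι α) (conj-ι β) (conj-ι γ) public

    -- After translating the point to the origin a₃, a₄, a₆ lie in the maximal ideal, hence so do
    -- b₄, b₆, b₈, and every term of Δ contains one of these.
    singular⇒Max-Δ : ∀ {x y} → Int x → Int y →
      Max (value x y) → Max (∂x x y) → Max (∂y x y) → Max Δ
    singular⇒Max-Δ {x} {y} ix iy m-value m∂x m∂y = subst Max (Δ-translation 4≢0)
      (Max-+ (Max-- (Max-- (Max-neg (Max-*ˡ (Int-* int-b₂ int-b₂) m-b₈)) (Max-*ˡ (Int-# (+ 8)) (Max-*ˡ (Int-* (Max-Int m-b₄) (Max-Int m-b₄)) m-b₄)))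
        (Max-*ˡ (Int-# (+ 27)) (Max-*ˡ (Max-Int m-b₆) m-b₆)))
        (Max-*ˡ (Int-* (Int-* (Int-# (+ 9)) int-b₂) (Max-Int m-b₄)) m-b₆))
      where
      open Translation F a₁ a₂ a₃ a₄ a₆ x y using (module C'; Δ-translation)
      int-a₂ : Int (a₂ + # (+ 3) * x)
      int-a₂ = Int-+ int₂ (Int-* (Int-# (+ 3)) ix)
      int-b₂ : Int C'.b₂
      int-b₂ = Int-+ (Int-* int₁ int₁) (Int-* (Int-# (+ 4)) int-a₂)
      m-b₄ : Max C'.b₄
      m-b₄ = Max-+ (Max-*ˡ (Int-# (+ 2)) m∂x) (Max-*ˡ int₁ m∂y)
      m-b₆ : Max C'.b₆
      m-b₆ = Max-+ (Max-*ˡ (Max-Int m∂y) m∂y) (Max-*ˡ (Int-# (+ 4)) (Max-neg m-value))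
      m-b₈ : Max C'.b₈
      m-b₈ = Max-- (Max-+ (Max-- (Max-+ (Max-*ˡ (Int-* int₁ int₁) (Max-neg m-value)) (Max-*ˡ (Int-* (Int-# (+ 4)) int-a₂) (Max-neg m-value)))
        (Max-*ˡ (Int-* int₁ (Max-Int m∂y)) m∂x)) (Max-*ˡ (Int-* int-a₂ (Max-Int m∂y)) m∂y)) (Max-*ˡ (Max-Int m∂x) m∂x)

    -- The slope of P and -P̄ is (0 , ℓ) for a point P = (a + b√d , …); the hypotheses on ℓ say so in
    -- Weierstrass coordinates P = (a + b√d , e + g√d), and x is the first coordinate of P - P̄.
    near-origin : ∀ {a b e g ℓ x} → let u = ∂x a e + b * b * d in
      Int a → Int b → Int e → Int g →
      value a e ≡ d * (# (+ 3) * a * b * b + a₂ * b * b - g * g - a₁ * b * g) →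
      # (+ 2) * b * d * ℓ ≡ ∂y a e → # (+ 2) * g * d * ℓ ≡ u →
      # (+ 4) * x ≡ # (+ 4) * (d * ℓ * ℓ) - (b₂ + # (+ 8) * a) → ∃ λ t → Max t × x * t ≡ 1#
    near-origin {a} {b} {e} {g} {ℓ} {x} ia ib ie ig e-value e-ε e-u e-x =
      by-cases (Max-or-Unit int-ε) (Max-or-Unit int-u)
      where
      ε = ∂y a e
      u = ∂x a e + b * b * d
      m-bbd : Max (b * b * d)
      m-bbd = Max-*ˡ (Int-* ib ib) Max-d
      int-ε : Int ε
      int-ε = Int-+ (Int-+ (Int-* (Int-# (+ 2)) ie) (Int-* int₁ ia)) int₃
      int-u : Int u
      int-u = Int-+ (Int-- (Int-+ (Int-+ (Int-* (Int-* (Int-# (+ 3)) ia) ia) (Int-* (Int-* (Int-# (+ 2)) int₂) ia)) int₄) (Int-* int₁ ie)) (Max-Int m-bbd)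
      int-s : Int (b₂ + # (+ 8) * a)
      int-s = Int-+ Int-b₂ (Int-* (Int-# (+ 8)) ia)
      -- Multiplying the formula for 4x by c²d gives v² minus an element of the maximal ideal. This
      -- is a unit, so the reciprocal of x is a multiple of d.
      quotient : ∀ {c v} → Int c → # (+ 2) * c * d * ℓ ≡ v → Unit v → ∃ λ t → Max t × x * t ≡ 1#
      quotient {c} {v} ic e-v uv =
        let _ , w , iw , e-w = Unit-+Max (Unit-* uv uv) (Max-neg (Max-*ˡ int-s (Max-*ˡ (Int-* ic ic) Max-d))) in
        # (+ 4) * (c * c * d) * w , Max-*ʳ (Max-*ˡ (Int-# (+ 4)) (Max-*ˡ (Int-* ic ic) Max-d)) iw ,
        combine₃ (c * c * d * w) e-x (w * (# (+ 2) * c * d * ℓ + v)) e-v 1# e-w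
          (solve 7 (λ x c d w l s v → x :* (con 4 :* (c :* c :* d) :* w) :+
            (c :* c :* d :* w :* (con 4 :* (d :* l :* l) :- s) :+ w :* (con 2 :* c :* d :* l :+ v) :* v :+ con 1 :* con 1) :=
            con 1 :+ (c :* c :* d :* w :* (con 4 :* x) :+ w :* (con 2 :* c :* d :* l :+ v) :* (con 2 :* c :* d :* l) :+
              con 1 :* ((v :* v :+ :- (s :* (c :* c :* d))) :* w)))
            refl x c d w ℓ (b₂ + # (+ 8) * a) v)
      by-cases : Max ε ⊎ Unit ε → Max u ⊎ Unit u → ∃ λ t → Max t × x * t ≡ 1#
      by-cases (inj₂ uε) _ = quotient ib e-ε uε
      by-cases _ (inj₂ uu) = quotient ig e-u uu
      -- If both quantities reduce to zero, (a , e), the common reduction of P and P̄, is a singular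
      -- point of the reduced curve, against the unit discriminant.
      by-cases (inj₁ mε) (inj₁ mu) = ⊥-elim (Unit⇒¬Max Δ-unit (singular⇒Max-Δ ia ie
        (subst Max (sym e-value) (Max-*ʳ Max-d (Int-- (Int-- (Int-+ (Int-* (Int-* (Int-* (Int-# (+ 3)) ia) ib) ib)
          (Int-* (Int-* int₂ ib) ib)) (Int-* ig ig)) (Int-* (Int-* int₁ ib) ig))))
        (subst Max (solve 2 (λ u m → u :+ m :- m := u) refl (∂x a e) (b * b * d)) (Max-- mu m-bbd)) mε))

    ι-b₈≡ : ι b₈ ≡ KF._-_ (KF._*_ (KF.# (+ 4)) (KF._*_ (ι α) (ι γ))) (KF._*_ (ι β) (ι β))
    ι-b₈≡ = trans (cong ι b₈≡) (sym (‵ (# (+ 4)) ⟨*⟩ (‵ α ⟨*⟩ ‵ γ) ⟨-⟩ ‵ β ⟨*⟩ ‵ β))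

    private
      module CK = Coefficients quadratic (ι a₁) (ι a₂) (ι a₃) (ι a₄) (ι a₆)
      module ID = IntegralDifference quadraticLocalization
        {ι α} {ι β} {ι γ} {ι b₂} {ι b₄} {ι b₆} {ι b₈}
        (trans (ι-* (# (+ 4)) α) (cong ι 4α)) (trans (ι-* (# (+ 2)) β) (cong ι 2β)) (trans (ι-* (# (+ 4)) γ) (cong ι 4γ))
        ι-b₈≡
        (Int-b₂ , Int-# (+ 0)) (Int-b₄ , Int-# (+ 0)) (Int-b₆ , Int-# (+ 0)) (Int-b₈ , Int-# (+ 0))

    defect : Pt → Pt
    defect P = P ⊕ neg (σPt P)

    σ-defect : ∀ P → On P → σPt (defect P) ≡ neg (defect P)
    σ-defect P on = begin
      σPt (P ⊕ neg (σPt P))              ≡⟨ σ-⊕ P (neg (σPt P)) on (On-neg (σPt P) onσ) ⟩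
      σPt P ⊕ σPt (neg (σPt P))          ≡⟨ cong (σPt P ⊕_) (trans (σ-neg-Pt (σPt P)) (cong neg (σ-involutive P))) ⟩
      σPt P ⊕ neg P                      ≡⟨ ⊕-comm (σPt P) (neg P) onσ (On-neg P on) ⟩
      neg P ⊕ σPt P                      ≡⟨ cong (neg P ⊕_) (neg-neg (σPt P)) ⟨
      neg P ⊕ neg (neg (σPt P))          ≡⟨ neg-⊕ P (neg (σPt P)) on (On-neg (σPt P) onσ) ⟨
      neg (P ⊕ neg (σPt P))              ∎
      where
      open ≡-Reasoning
      onσ = σ-On P on

    minus-defect : ∀ P → On P → P ⊕ neg (defect P) ≡ σPt P
    minus-defect P on = begin
      P ⊕ neg (P ⊕ neg (σPt P))          ≡⟨ cong (P ⊕_) (neg-⊕ P (neg (σPt P)) on (On-neg (σPt P) onσ)) ⟩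
      P ⊕ (neg P ⊕ neg (neg (σPt P)))    ≡⟨ cong (λ R → P ⊕ (neg P ⊕ R)) (neg-neg (σPt P)) ⟩
      P ⊕ (neg P ⊕ σPt P)                ≡⟨ ⊕-assoc P (neg P) (σPt P) on (On-neg P on) onσ ⟨
      P ⊕ neg P ⊕ σPt P                  ≡⟨ cong (_⊕ σPt P) (⊕-inverseʳ P) ⟩
      σPt P                              ∎
      where
      open ≡-Reasoning
      onσ = σ-On P on

    private
      own-negative : ∀ {z} → - z ≡ z → z ≡ 0#
      own-negative {z} e = *≡0⇒ 2≢0 (combine₁ (- 1#) e (solve 1 (λ z → con 2 :* z :+ :- con 1 :* z :=
        con 0 :+ :- con 1 :* :- z) refl z))

      aff-injective : ∀ {x y x' y'} → aff x y ≡ aff x' y' → x ≡ x' × y ≡ y'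
      aff-injective refl = refl , refl

    anti-invariant : ∀ {x y} → σPt (aff x y) ≡ neg (aff x y) → x ≡ ι (proj₁ x) × y ≡ (0# , proj₂ y)
    anti-invariant {x₀ , x₁} {y₀ , y₁} e =
      cong (x₀ ,_) (own-negative (cong proj₂ (proj₁ (aff-injective e)))) ,
      cong (_, y₁) (own-negative (sym (cong proj₁ (proj₂ (aff-injective e)))))

    fixed⇒rational : ∀ {x y} → σPt (aff x y) ≡ aff x y → proj₂ x ≡ 0# × proj₂ y ≡ 0#
    fixed⇒rational e = own-negative (cong proj₂ (proj₁ (aff-injective e))) , own-negative (cong proj₂ (proj₂ (aff-injective e)))

    -- Subtracting P - P̄ from P gives P̄. If X had a pole while x is integral,
    -- `difference-integral` would make the abscissa of this difference integral; but that abscissa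
    -- is the conjugate of X.
    integral-x : ∀ {X Y x y} → On (aff X Y) → defect (aff X Y) ≡ aff (ι x) y → On (aff (ι x) y) → Int x → IntK X
    integral-x {X} {Y} {x} {y} onP eQ onQ ix = by-valuation (KL.valuation X) (X KF.- ι x KF.≟ KF.0#)
      where
      by-valuation : IntK X ⊎ (∃ λ r → IntK r × mulK X (mulK √d r) ≡ KF.1#) → Dec (X KF.- ι x ≡ KF.0#) → IntK X
      by-valuation (inj₁ iX) _ = iX
      by-valuation _ (yes X≡x) = subst IntK (sym (KF.-≡0⇒≡ X≡x)) (ix , Int-# (+ 0))
      by-valuation (inj₂ (r , ir , e)) (no X≢x) =
        let open Formulas quadratic (ι α) (ι β) (ι γ)
            sd = sumDifference onP onQ X≢x
            open SumDifference sd
            iK = ix , Int-# (+ 0)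
            _ , v , iv , ev = KL.Unit-+Max KL.Unit-1 (KL.Max-neg (KL.Max-*ˡ {ι x} iK (KL.Max-*ʳ KL.Max-π ir)))
            iX₋ = ID.difference-integral e (KL.Int-* KL.Int-π ir) iK iv ev x-sum (x-product KF.0#)
            eσ = trans (sym difference≡) (trans (cong (λ R → aff X Y ⊕ neg R) (sym eQ)) (minus-defect (aff X Y) onP))
            i₀ , i₁ = subst IntK (proj₁ (aff-injective eσ)) iX₋ in
        i₀ , subst Int (solve 1 (λ z → :- :- z := z) refl (proj₂ X)) (Int-neg i₁)

    private
      -- Multiplication in K on the level of polynomial expressions, so that the solver over F can
      -- expand products of elements of K.
      pair-* : ∀ {n} (d : Polynomial n) (x y : Polynomial n × Polynomial n) → Polynomial n × Polynomial n
      pair-* d (a , b) (c , e) = a :* c :+ d :* (b :* e) , a :* e :+ b :* c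

    module _ {a b Y₀ Y₁ l₀ ℓ} (onP : On (aff (a , b) (Y₀ , Y₁)))
      (sl : Slope (l₀ , ℓ) (a , b) (Y₀ , Y₁) (conj (a , b)) (negK (conj (Y₀ , Y₁))))
      (not-rational : ¬ (b ≡ 0# × Y₁ ≡ 0#)) (ia : Int a) (ib : Int b) where
      private
        ½ : Carrier
        ½ = proj₁ (inverse (# (+ 2)) 2≢0)
        half : ∀ z → ½ * z + ½ * z ≡ z
        half z = combine₁ z (proj₂ (inverse (# (+ 2)) 2≢0)) (solve 2 (λ h z → h :* z :+ h :* z :+ z :* con 1 := z :+ z :* (con 2 :* h)) refl ½ z)
        e g : Carrier
        e = ½ * (Y₀ + Y₀ - (a₁ * a + a₃))
        g = ½ * (Y₁ + Y₁ - a₁ * b)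

        Y₀≡ : Y₀ + Y₀ ≡ ∂y a e
        Y₀≡ = combine₁ (- 1#) (half (Y₀ + Y₀ - (a₁ * a + a₃))) (solve 5 (λ Y k a a₃ e →
            Y :+ Y :+ :- con 1 :* (Y :+ Y :- (k :* a :+ a₃)) := con 2 :* e :+ k :* a :+ a₃ :+ :- con 1 :* (e :+ e))
          refl Y₀ a₁ a a₃ e)
        Y₁≡ : Y₁ + Y₁ ≡ g + g + a₁ * b
        Y₁≡ = combine₁ (- 1#) (half (Y₁ + Y₁ - a₁ * b)) (solve 3 (λ Y k g →
            Y :+ Y :+ :- con 1 :* (Y :+ Y :- k) := g :+ g :+ k :+ :- con 1 :* (g :+ g))
          refl Y₁ (a₁ * b) g)

        y-rational : Y₀ + Y₀ ≡ e + e + (a₁ * a + d * (0# * b) + a₃)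
        y-rational = combine₁ 1# Y₀≡ (solve 7 (λ Y e k a b a₃ d →
          Y :+ Y :+ con 1 :* (con 2 :* e :+ k :* a :+ a₃) := e :+ e :+ (k :* a :+ d :* (con 0 :* b) :+ a₃) :+ con 1 :* (Y :+ Y)) refl Y₀ e a₁ a b a₃ d)

        y-irrational : Y₁ + Y₁ ≡ g + g + (a₁ * b + 0# * a + 0#)
        y-irrational = trans Y₁≡ (solve 3 (λ g k a → g :+ g :+ k := g :+ g :+ (k :+ con 0 :* a :+ con 0)) refl g (a₁ * b) a)

        weierstrass = CK.completed-square {ι α} {ι β} {ι γ} {a , b} {e , g} {Y₀ , Y₁} (λ z → 4≢0 (cong proj₁ z))
          (trans (ι-* (# (+ 4)) α) (trans (cong ι 4α) (sym (‵ a₁ ⟨*⟩ ‵ a₁ ⟨+⟩ ‵ (# (+ 4)) ⟨*⟩ ‵ a₂))))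
          (trans (ι-* (# (+ 2)) β) (trans (cong ι 2β) (sym (‵ (# (+ 2)) ⟨*⟩ ‵ a₄ ⟨+⟩ ‵ a₁ ⟨*⟩ ‵ a₃))))
          (trans (ι-* (# (+ 4)) γ) (trans (cong ι 4γ) (sym (‵ a₃ ⟨*⟩ ‵ a₃ ⟨+⟩ ‵ (# (+ 4)) ⟨*⟩ ‵ a₆))))
          (cong₂ _,_ y-rational y-irrational)
          onP

        -- Here y = e + g√d is the ordinate before completing the square. Since 1/2 need not be
        -- integral, integrality is not read off the definitions of e and g but from the Weierstrass
        -- equation, which is monic in y.
        int-eg : IntK (e , g)
        int-eg = KL.integrally-closed
          (KL.Int-+ {mulK (ι a₁) (a , b)} {ι a₃} (KL.Int-* {ι a₁} {a , b} (int₁ , i0) (ia , ib)) (int₃ , i0))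
          (KL.Int-neg (KL.Int-+ {_} {ι a₆} (KL.Int-+ (KL.Int-+ (KL.Int-* (KL.Int-* (ia , ib) (ia , ib)) (ia , ib))
            (KL.Int-* {_} {a , b} (KL.Int-* {ι a₂} {a , b} (int₂ , i0) (ia , ib)) (ia , ib))) (KL.Int-* {ι a₄} {a , b} (int₄ , i0) (ia , ib))) (int₆ , i0)))
          weierstrass
          where i0 = Int-# (+ 0)

        value≡ : value a e ≡ d * (# (+ 3) * a * b * b + a₂ * b * b - g * g - a₁ * b * g)
        value≡ = combine₁ 1# (cong proj₁ weierstrass) (solve 10 (λ d a₁ a₂ a₃ a₄ a₆ a b e g →
          let infixl 7 _⊛_
              _⊛_ = pair-* d
              z = con 0
              X = a , b
              y = e , g in
          e :* e :+ a₁ :* a :* e :+ a₃ :* e :- (a :* a :* a :+ a₂ :* a :* a :+ a₄ :* a :+ a₆) :+ con 1 :* z :=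
          d :* (con 3 :* a :* b :* b :+ a₂ :* b :* b :- g :* g :- a₁ :* b :* g) :+
            con 1 :* (proj₁ (y ⊛ y) :+ proj₁ ((proj₁ ((a₁ , z) ⊛ X) :+ a₃ , proj₂ ((a₁ , z) ⊛ X) :+ z) ⊛ y) :+
              :- (proj₁ (X ⊛ X ⊛ X) :+ proj₁ ((a₂ , z) ⊛ X ⊛ X) :+ proj₁ ((a₄ , z) ⊛ X) :+ a₆)))
          refl d a₁ a₂ a₃ a₄ a₆ a b e g)

        -- The irrational parts of the secant and tangent equations read 2bl₀ = 0 and 2Y₁l₀ = 0, and
        -- b and Y₁ are not both zero because P is not rational.
        l₀≡0 : l₀ ≡ 0#
        l₀≡0 = by-cases (b ≟ 0#) (Y₁ ≟ 0#)
          where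
          by-cases : Dec (b ≡ 0#) → Dec (Y₁ ≡ 0#) → l₀ ≡ 0#
          by-cases (no b≢0) _ = *≡0⇒ b≢0 (*≡0⇒ 2≢0 (combine₁ 1# (cong proj₂ (Slope.secant sl)) (solve 5 (λ a b l m y →
            con 2 :* (b :* l) :+ con 1 :* (y :+ :- :- :- y) :=
            con 0 :+ con 1 :* ((a :+ :- a) :* m :+ (b :+ :- :- b) :* l)) refl a b l₀ ℓ Y₁)))
          by-cases (yes b≡0) (no Y₁≢0) = *≡0⇒ Y₁≢0 (*≡0⇒ 2≢0 (combine₁ 1# (cong proj₂ (Slope.tangent sl)) (solve 7 (λ a b l m y w α →
            con 2 :* (w :* l) :+ con 1 :* (a :* b :+ b :* a :+ (a :* :- b :+ b :* a) :+ (a :* :- b :+ :- b :* a) :+ (α :* (b :+ :- b) :+ con 0 :* (a :+ a)) :+ con 0) :=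
            con 0 :+ con 1 :* ((y :+ :- y) :* m :+ (w :+ :- :- w) :* l)) refl a b l₀ ℓ Y₀ Y₁ α)))
          by-cases (yes b≡0) (yes Y₁≡0) = ⊥-elim (not-rational (b≡0 , Y₁≡0))

        secant≡ : # (+ 2) * b * d * ℓ ≡ ∂y a e
        secant≡ = trans (combine₁ 1# (cong proj₁ (Slope.secant sl)) (solve 6 (λ d a b l m y →
            con 2 :* b :* d :* m :+ con 1 :* (y :+ :- :- y) :=
            y :+ y :+ con 1 :* ((a :+ :- a) :* l :+ d :* ((b :+ :- :- b) :* m))) refl d a b l₀ ℓ Y₀)) Y₀≡

        tangent≡ : d * (Y₁ + Y₁) * ℓ ≡ # (+ 3) * a * a + d * b * b + # (+ 2) * α * a + β
        tangent≡ = combine₁ 1# (cong proj₁ (Slope.tangent sl)) (solve 9 (λ d a b l m y w α β →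
            d :* (w :+ w) :* m :+ con 1 :* (a :* a :+ d :* (b :* b) :+ (a :* a :+ d :* (b :* :- b)) :+ (a :* a :+ d :* (:- b :* :- b)) :+
              (α :* (a :+ a) :+ d :* (con 0 :* (b :+ :- b))) :+ β) :=
            con 3 :* a :* a :+ d :* b :* b :+ con 2 :* α :* a :+ β :+
              con 1 :* ((y :+ :- y) :* l :+ d :* ((w :+ :- :- w) :* m))) refl d a b l₀ ℓ Y₀ Y₁ α β)

        partial≡ : # (+ 2) * g * d * ℓ ≡ ∂x a e + b * b * d
        partial≡ = *-cancelˡ 2≢0 (begin
          # (+ 2) * (# (+ 2) * g * d * ℓ)
            ≡⟨ solve 5 (λ g d l k b → con 2 :* (con 2 :* g :* d :* l) :=
                 con 2 :* (d :* (g :+ g :+ k :* b) :* l) :- k :* (con 2 :* b :* d :* l)) refl g d ℓ a₁ b ⟩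
          # (+ 2) * (d * (g + g + a₁ * b) * ℓ) - a₁ * (# (+ 2) * b * d * ℓ)
            ≡⟨ cong₂ (λ u v → # (+ 2) * (d * u * ℓ) - a₁ * v) (sym Y₁≡) secant≡ ⟩
          # (+ 2) * (d * (Y₁ + Y₁) * ℓ) - a₁ * ∂y a e
            ≡⟨ cong (λ u → # (+ 2) * u - a₁ * ∂y a e) tangent≡ ⟩
          # (+ 2) * (# (+ 3) * a * a + d * b * b + # (+ 2) * α * a + β) - a₁ * ∂y a e
            ≡⟨ combine₂ a 4α 1# 2β (solve 10 (λ d a b e α β a₁ a₂ a₃ a₄ →
                 con 2 :* (con 3 :* a :* a :+ d :* b :* b :+ con 2 :* α :* a :+ β) :- a₁ :* (con 2 :* e :+ a₁ :* a :+ a₃) :+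
                   (a :* (a₁ :* a₁ :+ con 4 :* a₂) :+ con 1 :* (con 2 :* a₄ :+ a₁ :* a₃)) :=
                 con 2 :* (con 3 :* a :* a :+ con 2 :* a₂ :* a :+ a₄ :- a₁ :* e :+ b :* b :* d) :+
                   (a :* (con 4 :* α) :+ con 1 :* (con 2 :* β))) refl d a b e α β a₁ a₂ a₃ a₄) ⟩
          # (+ 2) * (∂x a e + b * b * d) ∎)
          where open ≡-Reasoning

        chord-x : # (+ 4) * (l₀ * l₀ + d * (ℓ * ℓ) + - α + - a + - a) ≡ # (+ 4) * (d * ℓ * ℓ) - (b₂ + # (+ 8) * a)
        chord-x = combine₂ (# (+ 4) * l₀) l₀≡0 (- 1#) 4α (solve 6 (λ d l m α a b₂ →
          con 4 :* (l :* l :+ d :* (m :* m) :+ :- α :+ :- a :+ :- a) :+ (con 4 :* l :* con 0 :+ :- con 1 :* b₂) :=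
          con 4 :* (d :* m :* m) :- (b₂ :+ con 8 :* a) :+ (con 4 :* l :* l :+ :- con 1 :* (con 4 :* α))) refl d l₀ ℓ α a b₂)

      defect-of-integral : ∃ λ t → Max t × (l₀ * l₀ + d * (ℓ * ℓ) + - α + - a + - a) * t ≡ 1#
      defect-of-integral = near-origin ia ib (proj₁ int-eg) (proj₂ int-eg) value≡ secant≡ partial≡ chord-x

    -- P and its conjugate have the same reduction, so P - P̄ reduces to the origin.
    defect-near-origin : ∀ P → On P → σPt P ≢ P →
      ∃ λ x → ∃ λ m → defect P ≡ aff (ι x) (0# , m) × (∃ λ t → Max t × x * t ≡ 1#)
    defect-near-origin O _ ≢ = ⊥-elim (≢ refl)
    defect-near-origin P@(aff X@(a , b) Y@(Y₀ , Y₁)) onP ≢ = by-cases (sumView onP on-σ)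
      where
      on-σ = On-neg (σPt P) (σ-On P onP)
      Result = ∃ λ x → ∃ λ m → defect P ≡ aff (ι x) (0# , m) × (∃ λ t → Max t × x * t ≡ 1#)
      by-cases : SumView X Y (conj X) (negK (conj Y)) → Result
      by-cases (inj₁ opp) = ⊥-elim (≢ (trans (sym (neg-neg (σPt P))) (trans (cong neg (opposite⇒neg opp)) (neg-neg P))))
      by-cases (inj₂ (¬opp , λ' , sl)) = x , proj₂ y₃ , eQ , by-valuation (valuation x)
        where
        x₃ y₃ : K
        x₃ = KF._-_ (KF._-_ (KF._-_ (mulK λ' λ') (ι α)) X) (conj X)
        y₃ = KF._-_ (mulK λ' (KF._-_ X x₃)) Y
        x = proj₁ x₃
        eQ₀ : defect P ≡ aff x₃ y₃
        eQ₀ = ⊕-slope ¬opp sl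
        anti : x₃ ≡ ι x × y₃ ≡ (0# , proj₂ y₃)
        anti = anti-invariant (subst (λ R → σPt R ≡ neg R) eQ₀ (σ-defect P onP))
        eQ : defect P ≡ aff (ι x) (0# , proj₂ y₃)
        eQ = trans eQ₀ (aff-cong (proj₁ anti) (proj₂ anti))
        by-valuation : Int x ⊎ (∃ λ r → Int r × x * (π * r) ≡ 1#) → ∃ λ t → Max t × x * t ≡ 1#
        by-valuation (inj₂ (r , ir , e)) = π * r , (r , ir , refl) , e
        by-valuation (inj₁ ix) =
          -- Should x be integral, P itself has integral coordinates, and the explicit slope of the
          -- line through P and -P̄ produces the reciprocal of x.
          let ia , ib = integral-x onP eQ (subst On eQ (On-⊕ P (neg (σPt P)) onP on-σ)) ix
              t , mt , e = defect-of-integral onP sl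
                (λ { (b≡0 , Y₁≡0) → ≢ (aff-cong (cong (a ,_) (trans (cong (-_) b≡0) (trans -0≡0 (sym b≡0))))
                                                 (cong (Y₀ ,_) (trans (cong (-_) Y₁≡0) (trans -0≡0 (sym Y₁≡0))))) }) ia ib in
          t , mt , e
          where
          -0≡0 : - 0# ≡ 0#
          -0≡0 = solve 0 (:- con 0 := con 0) refl

-- Multiplication by p near the origin

module _ {F : Field} (loc : Localization F) (α β γ : Field.Carrier F) where
  open LocalTheory loc
  open CubicCurve F α β γ

  module Neighbourhood
    (nonsingular : ∀ {x y} → On (aff x y) → y + y ≡ 0# → D x x ≡ 0# → ⊥)
    (p : ℕ) (Max-p : Max (# (+ p))) (p≢0 : # (+ p) ≢ 0#) where
    open Associativity nonsingular
    open Multiples F α β γ nonsingular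
    open Formulas F α β γ

    ϖ : Carrier
    ϖ = # (+ p)

    -- T is the reciprocal of x(Q) - e and measures how close Q is to the origin.
    Near : Carrier → Pt → Carrier → Set
    Near e Q T = ∃ λ x → ∃ λ y → Q ≡ aff x y × (x - e) * T ≡ 1# × (∃ λ r → Int r × T ≡ ϖ * r)

    Near-cong : ∀ {e Q T T'} → T ≡ T' → Near e Q T → Near e Q T'
    Near-cong refl near = near

    Near-unique : ∀ {e Q T T'} → Near e Q T → Near e Q T' → T ≡ T'
    Near-unique {e} {T = T} {T'} (x , y , refl , xT , _) (_ , _ , refl , xT' , _) =
      combine₂ (- T) xT' T' xT (solve 3 (λ X T T' → T :+ (:- T :* con 1 :+ T' :* con 1) :=
        T' :+ (:- T :* (X :* T') :+ T' :* (X :* T))) refl (x - e) T T')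

    Near⇒≢O : ∀ {e Q T} → Near e Q T → Q ≢ O
    Near⇒≢O (_ , _ , refl , _) ()

    -- The alternative that p · Q is the origin is left open in `step`: it occurs for doubling,
    -- while for p ≥ 5 only the second alternative is ever supplied.
    module Torsion (e : Carrier)
      (step : ∀ {Q T} → On Q → Near e Q T → (p · Q ≡ O) ⊎ (∃ λ c → Int c × Near e (p · Q) (ϖ * c * T))) where

      Killed : Pt → Set
      Killed Q = ∃ λ j → ∃ λ T → Near e ((p ℕ.^ j) · Q) T × p · ((p ℕ.^ j) · Q) ≡ O

      private
        1·_ : ∀ Q → 1 · Q ≡ Q
        1· Q = ⊕-identityʳ Q

        power-· : ∀ k Q → On Q → p · ((p ℕ.^ k) · Q) ≡ (p ℕ.^ suc k) · Q
        power-· k Q on = sym (·-* p (p ℕ.^ k) Q on)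

        powers-· : ∀ i j Q → On Q → (p ℕ.^ j) · ((p ℕ.^ i) · Q) ≡ (p ℕ.^ (j ℕ.+ i)) · Q
        powers-· i j Q on = trans (sym (·-* (p ℕ.^ j) (p ℕ.^ i) Q on)) (cong (_· Q) (sym (ℕP.^-distribˡ-+-* p j i)))

      chain : ∀ {Q T} → On Q → Near e Q T → ∀ k →
        Killed Q ⊎ (∃ λ c → Int c × Near e ((p ℕ.^ suc k) · Q) (ϖ * c * T))
      chain {Q} {T} on near zero = by-cases (step on near)
        where
        by-cases : _ → _
        by-cases (inj₁ e₀) = inj₁ (0 , T , subst (λ R → Near e R T) (sym (1· Q)) near , trans (cong (p ·_) (1· Q)) e₀)
        by-cases (inj₂ (c , ic , near')) = inj₂ (c , ic , subst (λ k → Near e (k · Q) (ϖ * c * T)) (sym (ℕP.*-identityʳ p)) near')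
      chain {Q} {T} on near (suc k) = by-cases (chain on near k)
        where
        by-cases : _ → _
        by-cases (inj₁ killed) = inj₁ killed
        by-cases (inj₂ (c , ic , near')) = by-step (step (On-· (p ℕ.^ suc k) Q on) near')
          where
          by-step : _ → _
          by-step (inj₁ e₀) = inj₁ (suc k , _ , near' , e₀)
          by-step (inj₂ (c' , ic' , near'')) = inj₂ (c' * (ϖ * c) , Int-* ic' (Int-* (Int-# (+ p)) ic) ,
            subst (λ R → Near e R (ϖ * (c' * (ϖ * c)) * T)) (power-· (suc k) Q on)
              (Near-cong (solve 4 (λ w c c' T → w :* c' :* (w :* c :* T) := w :* (c' :* (w :* c)) :* T) refl ϖ c c' T) near''))

      -- By the pigeonhole principle two powers of p agree modulo n, so two p-power multiples of Q
      -- coincide. If no multiple vanished in between, T' = ϖcT' with c integral and T' invertible,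
      -- which puts 1 into the maximal ideal.
      torsion-killed : ∀ {Q T} n → .{{_ : ℕ.NonZero n}} → On Q → Near e Q T → n · Q ≡ O → Killed Q
      torsion-killed {Q} {T} n on near nQ≡O = by-collision (FinP.pigeonhole (ℕP.n<1+n n) (λ i → DivMod._mod_ (p ℕ.^ toℕ i) n))
        where
        open ≡-Reasoning
        reduce : ∀ a → a · Q ≡ (a DivMod.% n) · Q
        reduce a = begin
          a · Q                                                    ≡⟨ cong (_· Q) (DivMod.m≡m%n+[m/n]*n a n) ⟩
          (a DivMod.% n ℕ.+ (a DivMod./ n) ℕ.* n) · Q              ≡⟨ ·-+ (a DivMod.% n) _ Q on ⟩
          (a DivMod.% n) · Q ⊕ ((a DivMod./ n) ℕ.* n) · Q          ≡⟨ cong ((a DivMod.% n) · Q ⊕_) (trans (·-* (a DivMod./ n) n Q on) (trans (cong ((a DivMod./ n) ·_) nQ≡O) (·-O (a DivMod./ n)))) ⟩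
          (a DivMod.% n) · Q ⊕ O                                   ≡⟨ ⊕-identityʳ _ ⟩
          (a DivMod.% n) · Q                                       ∎

        start : ∀ i → Killed Q ⊎ (∃ λ T' → Near e ((p ℕ.^ i) · Q) T')
        start zero = inj₂ (T , subst (λ R → Near e R T) (sym (1· Q)) near)
        start (suc i) with chain on near i
        ... | inj₁ killed = inj₁ killed
        ... | inj₂ (_ , _ , near') = inj₂ (_ , near')

        by-collision : _ → Killed Q
        by-collision (i , j , i<j , eq) = by-start (start (toℕ i))
          where
          k = toℕ j ℕ.∸ suc (toℕ i)
          j≡ : toℕ j ≡ suc k ℕ.+ toℕ i
          j≡ = sym (trans (sym (ℕP.+-suc k (toℕ i))) (ℕP.m∸n+n≡m i<j))
          same : (p ℕ.^ toℕ j) · Q ≡ (p ℕ.^ toℕ i) · Q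
          same = begin
            (p ℕ.^ toℕ j) · Q                    ≡⟨ reduce (p ℕ.^ toℕ j) ⟩
            ((p ℕ.^ toℕ j) DivMod.% n) · Q       ≡⟨ cong (_· Q) (trans (sym (FinP.toℕ-fromℕ< _)) (trans (cong toℕ (sym eq)) (FinP.toℕ-fromℕ< _))) ⟩
            ((p ℕ.^ toℕ i) DivMod.% n) · Q       ≡⟨ reduce (p ℕ.^ toℕ i) ⟨
            (p ℕ.^ toℕ i) · Q                    ∎
          by-start : _ → Killed Q
          by-start (inj₁ killed) = killed
          by-start (inj₂ (T' , near')) = by-chain (chain (On-· (p ℕ.^ toℕ i) Q on) near' k)
            where
            by-chain : _ → Killed Q
            by-chain (inj₁ (l , T'' , near'' , e₀)) = l ℕ.+ toℕ i , T'' ,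
              subst (λ R → Near e R T'') (powers-· (toℕ i) l Q on) near'' ,
              trans (cong (p ·_) (sym (powers-· (toℕ i) l Q on))) e₀
            by-chain (inj₂ (c , ic , near'')) = ⊥-elim (no-growth near'
              (Near-unique near' (subst (λ R → Near e R (ϖ * c * T')) (trans (powers-· (toℕ i) (suc k) Q on) (trans (cong (λ l → (p ℕ.^ l) · Q) (sym j≡)) same)) near'')))
              where
              no-growth : Near e ((p ℕ.^ toℕ i) · Q) T' → T' ≡ ϖ * c * T' → ⊥
              no-growth (x , _ , _ , xT , _) eT = ¬Max-1 (subst Max (sym (combine₂ {l = 1#} {r = ϖ * c} (- (1# - ϖ * c)) xT (x - e) eT
                (solve 3 (λ X T u → con 1 :+ (:- (con 1 :- u) :* con 1 :+ X :* (u :* T)) :=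
                  u :+ (:- (con 1 :- u) :* (X :* T) :+ X :* T)) refl (x - e) T' (ϖ * c)))) (Max-*ʳ Max-p ic))

    module Doubling (p≡2 : p ≡ 2) {b₂ b₄ b₆ b₈ : Carrier}
      (4α : # (+ 4) * α ≡ b₂) (2β : # (+ 2) * β ≡ b₄) (4γ : # (+ 4) * γ ≡ b₆) (b₈≡ : b₈ ≡ # (+ 4) * (α * γ) - β * β)
      (int-b₂ : Int b₂) (int-b₄ : Int b₄) (int-b₆ : Int b₆) (int-b₈ : Int b₈) where

      private
        2≡ϖ : # (+ 2) ≡ ϖ
        2≡ϖ = cong (λ n → # (+ n)) (sym p≡2)

        module _ {x T} (xT : (x - 0#) * T ≡ 1#) where
          open ≡-Reasoning
          xT' : x * T ≡ 1#
          xT' = trans (solve 2 (λ x T → x :* T := (x :- con 0) :* T) refl x T) xT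

          denominator : # (+ 4) * f x * (T * T * T) ≡ # (+ 4) + b₂ * T + # (+ 2) * b₄ * (T * T) + b₆ * (T * T * T)
          denominator = begin
            # (+ 4) * f x * (T * T * T)
              ≡⟨ solve 5 (λ x T α β γ → con 4 :* (x :* x :* x :+ α :* x :* x :+ β :* x :+ γ) :* (T :* T :* T) :=
                   let z = x :* T in con 4 :* (z :* z :* z) :+ con 4 :* α :* (z :* z) :* T :+ con 2 :* (con 2 :* β) :* z :* (T :* T) :+ con 4 :* γ :* (T :* T :* T)) refl x T α β γ ⟩
            # (+ 4) * (x * T * (x * T) * (x * T)) + # (+ 4) * α * (x * T * (x * T)) * T + # (+ 2) * (# (+ 2) * β) * (x * T) * (T * T) + # (+ 4) * γ * (T * T * T)
              ≡⟨ cong₂ (λ z b → # (+ 4) * (z * z * z) + # (+ 4) * α * (z * z) * T + # (+ 2) * b * z * (T * T) + # (+ 4) * γ * (T * T * T)) xT' 2β ⟩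
            # (+ 4) * (1# * 1# * 1#) + # (+ 4) * α * (1# * 1#) * T + # (+ 2) * b₄ * 1# * (T * T) + # (+ 4) * γ * (T * T * T)
              ≡⟨ cong₂ (λ a c → # (+ 4) * (1# * 1# * 1#) + a * (1# * 1#) * T + # (+ 2) * b₄ * 1# * (T * T) + c * (T * T * T)) 4α 4γ ⟩
            # (+ 4) * (1# * 1# * 1#) + b₂ * (1# * 1#) * T + # (+ 2) * b₄ * 1# * (T * T) + b₆ * (T * T * T)
              ≡⟨ solve 4 (λ T a b c → let o = con 1 in con 4 :* (o :* o :* o) :+ a :* (o :* o) :* T :+ con 2 :* b :* o :* (T :* T) :+ c :* (T :* T :* T) :=
                   con 4 :+ a :* T :+ con 2 :* b :* (T :* T) :+ c :* (T :* T :* T)) refl T b₂ b₄ b₆ ⟩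
            # (+ 4) + b₂ * T + # (+ 2) * b₄ * (T * T) + b₆ * (T * T * T) ∎

          numerator≡ : numerator 0# x x * (T * T * (T * T)) ≡ 1# + T * (- b₄ * T - # (+ 2) * b₆ * (T * T) - b₈ * (T * T * T))
          numerator≡ = begin
            numerator 0# x x * (T * T * (T * T))
              ≡⟨ solve 5 (λ x T α β γ → let z = con 0
                                            u = x :* T
                                            m = (x :- z) :* (x :- z) :- (z :* z :+ z :* z :+ z :* z :+ α :* (z :+ z) :+ β) in
                   (m :* m :- con 4 :* (z :* z :* z :+ α :* z :* z :+ β :* z :+ γ) :* (x :+ x :+ z :+ α)) :* (T :* T :* (T :* T)) :=
                   u :* u :* (u :* u) :- con 2 :* β :* (u :* u) :* (T :* T) :- con 2 :* (con 4 :* γ) :* u :* (T :* T :* T) :-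
                     (con 4 :* (α :* γ) :- β :* β) :* (T :* T :* (T :* T))) refl x T α β γ ⟩
            x * T * (x * T) * (x * T * (x * T)) - # (+ 2) * β * (x * T * (x * T)) * (T * T) - # (+ 2) * (# (+ 4) * γ) * (x * T) * (T * T * T)
              - (# (+ 4) * (α * γ) - β * β) * (T * T * (T * T))
              ≡⟨ cong₂ (λ u b → u * u * (u * u) - b * (u * u) * (T * T) - # (+ 2) * (# (+ 4) * γ) * u * (T * T * T) - (# (+ 4) * (α * γ) - β * β) * (T * T * (T * T))) xT' 2β ⟩
            1# * 1# * (1# * 1#) - b₄ * (1# * 1#) * (T * T) - # (+ 2) * (# (+ 4) * γ) * 1# * (T * T * T) - (# (+ 4) * (α * γ) - β * β) * (T * T * (T * T))
              ≡⟨ cong₂ (λ c e → 1# * 1# * (1# * 1#) - b₄ * (1# * 1#) * (T * T) - # (+ 2) * c * 1# * (T * T * T) - e * (T * T * (T * T))) 4γ (sym b₈≡) ⟩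
            1# * 1# * (1# * 1#) - b₄ * (1# * 1#) * (T * T) - # (+ 2) * b₆ * 1# * (T * T * T) - b₈ * (T * T * (T * T))
              ≡⟨ solve 4 (λ T b c e → let o = con 1 in o :* o :* (o :* o) :- b :* (o :* o) :* (T :* T) :- con 2 :* c :* o :* (T :* T :* T) :- e :* (T :* T :* (T :* T)) :=
                   o :+ T :* (:- b :* T :- con 2 :* c :* (T :* T) :- e :* (T :* T :* T))) refl T b₄ b₆ b₈ ⟩
            1# + T * (- b₄ * T - # (+ 2) * b₆ * (T * T) - b₈ * (T * T * T)) ∎

      -- The reciprocal of x(2Q) is 4f(x) over `numerator`. In terms of T = 1/x it equals T (4 + b₂T
      -- + 2b₄T² + b₆T³) divided by a unit, and the bracket is even because T is.
      doubling-step : ∀ {Q T} → On Q → Near 0# Q T → (p · Q ≡ O) ⊎ (∃ λ c → Int c × Near 0# (p · Q) (ϖ * c * T))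
      doubling-step {T = T} on (x , y , refl , xT , r , ir , eT) = by-y (y + y ≟ 0#)
        where
        pQ≡ : p · aff x y ≡ aff x y ⊕ aff x y
        pQ≡ = trans (cong (_· aff x y) p≡2) (cong (aff x y ⊕_) (⊕-identityʳ (aff x y)))
        int-T : Int T
        int-T = subst Int (sym eT) (Int-* (Int-# (+ p)) ir)
        int-T² : Int (T * T)
        int-T² = Int-* int-T int-T
        E-unit : Unit (1# + T * (- b₄ * T - # (+ 2) * b₆ * (T * T) - b₈ * (T * T * T)))
        E-unit = Unit-+Max Unit-1 (Max-*ʳ (subst Max (sym eT) (Max-*ʳ Max-p ir))
          (Int-- (Int-- (Int-* (Int-neg int-b₄) int-T) (Int-* (Int-* (Int-# (+ 2)) int-b₆) int-T²)) (Int-* int-b₈ (Int-* int-T² int-T))))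
        by-y : Dec (y + y ≡ 0#) → (p · aff x y ≡ O) ⊎ (∃ λ c → Int c × Near 0# (p · aff x y) (ϖ * c * T))
        by-y (yes 2y≡0) = inj₁ (trans pQ≡ (⊕-opposite (solve 1 (λ x → x :- x := con 0) refl x , 2y≡0)))
        by-y (no 2y≢0) =
          let x₂ , y₂ , eq , ex = double on 2y≢0
              _ , v , iv , ev = E-unit
              -- The bracket 4 + b₂T + 2b₄T² + b₆T³ with one factor 2 taken out by means of T = 2r.
              h = # (+ 2) + b₂ * r + # (+ 2) * b₄ * r * T + b₆ * r * (T * T)
              ih = Int-+ (Int-+ (Int-+ (Int-# (+ 2)) (Int-* int-b₂ ir)) (Int-* (Int-* (Int-* (Int-# (+ 2)) int-b₄) ir) int-T)) (Int-* (Int-* int-b₆ ir) int-T²) in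
          inj₂ (h * v , Int-* ih iv , x₂ , y₂ , trans pQ≡ eq , reciprocal {x₂} {v} ev (ex 0#) ,
            h * v * T , Int-* (Int-* ih iv) int-T , solve 3 (λ w c T → w :* c :* T := w :* (c :* T)) refl ϖ (h * v) T)
          where
          open ≡-Reasoning
          reciprocal : ∀ {x₂ v} → (1# + T * (- b₄ * T - # (+ 2) * b₆ * (T * T) - b₈ * (T * T * T))) * v ≡ 1# →
            (x₂ - 0#) * (# (+ 4) * f x) ≡ numerator 0# x x →
            (x₂ - 0#) * (ϖ * ((# (+ 2) + b₂ * r + # (+ 2) * b₄ * r * T + b₆ * r * (T * T)) * v) * T) ≡ 1#
          reciprocal {x₂} {v} ev ex = begin
            (x₂ - 0#) * (ϖ * ((# (+ 2) + b₂ * r + # (+ 2) * b₄ * r * T + b₆ * r * (T * T)) * v) * T)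
              ≡⟨ solve 8 (λ X w r T v a b c → X :* (w :* ((con 2 :+ a :* r :+ con 2 :* b :* r :* T :+ c :* r :* (T :* T)) :* v) :* T) :=
                   X :* (con 2 :* w :+ a :* (w :* r) :+ con 2 :* b :* (w :* r) :* T :+ c :* (w :* r) :* (T :* T)) :* v :* T) refl (x₂ - 0#) ϖ r T v b₂ b₄ b₆ ⟩
            (x₂ - 0#) * (# (+ 2) * ϖ + b₂ * (ϖ * r) + # (+ 2) * b₄ * (ϖ * r) * T + b₆ * (ϖ * r) * (T * T)) * v * T
              ≡⟨ cong₂ (λ w t → (x₂ - 0#) * (# (+ 2) * w + b₂ * t + # (+ 2) * b₄ * t * T + b₆ * t * (T * T)) * v * T) (sym 2≡ϖ) (sym eT) ⟩
            (x₂ - 0#) * (# (+ 2) * # (+ 2) + b₂ * T + # (+ 2) * b₄ * T * T + b₆ * T * (T * T)) * v * T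
              ≡⟨ cong (λ z → (x₂ - 0#) * z * v * T) (trans (solve 4 (λ T a b c → con 2 :* con 2 :+ a :* T :+ con 2 :* b :* T :* T :+ c :* T :* (T :* T) :=
                   con 4 :+ a :* T :+ con 2 :* b :* (T :* T) :+ c :* (T :* T :* T)) refl T b₂ b₄ b₆) (sym (denominator xT))) ⟩
            (x₂ - 0#) * (# (+ 4) * f x * (T * T * T)) * v * T
              ≡⟨ solve 4 (λ X F T v → X :* (F :* (T :* T :* T)) :* v :* T := X :* F :* (T :* T :* (T :* T)) :* v) refl (x₂ - 0#) (# (+ 4) * f x) T v ⟩
            (x₂ - 0#) * (# (+ 4) * f x) * (T * T * (T * T)) * v
              ≡⟨ cong (λ z → z * (T * T * (T * T)) * v) ex ⟩
            numerator 0# x x * (T * T * (T * T)) * v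
              ≡⟨ cong (_* v) (numerator≡ xT) ⟩
            (1# + T * (- b₄ * T - # (+ 2) * b₆ * (T * T) - b₈ * (T * T * T))) * v
              ≡⟨ ev ⟩
            1# ∎

    module MultiplicationByP {q : ℕ} (p≡ : p ≡ suc (suc q)) (3≤q : 3 ℕ.≤ q)
      (unit-< : ∀ m → 1 ℕ.≤ m → m ℕ.< p → Unit (# (+ m)))
      {e : Carrier} (centred : α + # (+ 3) * e ≡ 0#) (int-A : Int (D e e)) (int-B : Int (f e)) where

      private
        A B : Carrier
        A = D e e
        B = f e

      -- The precision ϖ² is forced by the last step: m²u - 1 at m = p - 1 must have exactly one
      -- factor p, and an error of order ϖ in u would spoil this.
      Principal : Carrier → Set
      Principal u = ∃ λ c → Int c × u ≡ 1# + ϖ * ϖ * c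

      private
        Max-ϖϖ : ∀ {c} → Int c → Max (ϖ * ϖ * c)
        Max-ϖϖ ic = Max-*ʳ (Max-*ʳ Max-p (Int-# (+ p))) ic

      Principal⇒Unit : ∀ {u} → Principal u → Unit u
      Principal⇒Unit (c , ic , refl) = Unit-+Max Unit-1 (Max-ϖϖ ic)

      Principal-* : ∀ {u v} → Principal u → Principal v → Principal (u * v)
      Principal-* (c , ic , refl) (c' , ic' , refl) = c + c' + ϖ * ϖ * c * c' ,
        Int-+ (Int-+ ic ic') (Int-* (Int-* (Int-* (Int-# (+ p)) (Int-# (+ p))) ic) ic') ,
        solve 3 (λ w c c' → (con 1 :+ w :* w :* c) :* (con 1 :+ w :* w :* c') :=
          con 1 :+ w :* w :* (c :+ c' :+ w :* w :* c :* c')) refl ϖ c c'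

      Principal-inverse : ∀ {u} → Principal u → ∃ λ v → Principal v × u * v ≡ 1#
      Principal-inverse pu@(c , ic , refl) =
        let _ , v , iv , e = Principal⇒Unit pu in
        v , (- (c * v) , Int-neg (Int-* ic iv) , combine₁ 1# e (solve 3 (λ w c v →
          v :+ con 1 :* con 1 := con 1 :+ w :* w :* :- (c :* v) :+ con 1 :* ((con 1 :+ w :* w :* c) :* v)) refl ϖ c v)) , e

      Principal-1 : Principal 1#
      Principal-1 = 0# , Int-# (+ 0) , solve 1 (λ w → con 1 := con 1 :+ w :* w :* con 0) refl ϖ

      #-suc : ∀ n → # (+ suc n) ≡ # (+ n) + 1#
      #-suc n = trans (cong (λ m → # (+ m)) (ℕP.+-comm 1 n)) (#-+ (+ n) (+ 1))

      module _ {x y T r} (on : On (aff x y)) (xT : (x - e) * T ≡ 1#) (ir : Int r) (eT : T ≡ ϖ * r) where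
        private
          Q = aff x y

          int-T : Int T
          int-T = subst Int (sym eT) (Int-* (Int-# (+ p)) ir)

          T≢0 : T ≢ 0#
          T≢0 refl = ¬Max-1 (subst Max (trans (solve 1 (λ x → con 0 := x :* con 0) refl (x - e)) xT) Max-0)

          -- The reciprocal of x(m Q) - e is m² T up to a principal unit.
          At : ℕ → Carrier → Set
          At m u = ∃ λ x' → ∃ λ y' → m · Q ≡ aff x' y' × (x' - e) * (# (+ m) * # (+ m) * T * u) ≡ 1#

          numerator≡ : ∀ {x' t} → (x' - e) * t ≡ 1# →
            numerator e x' x * (t * T * (t * T)) ≡ (1# - A * (t * T)) * (1# - A * (t * T)) - # (+ 4) * B * (t * T) * (t + T)
          numerator≡ {x'} {t} x't = begin
            numerator e x' x * (t * T * (t * T))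
              ≡⟨ solve 8 (λ x x' e t T α A B →
                   (((x' :- e) :* (x :- e) :- A) :* ((x' :- e) :* (x :- e) :- A) :- con 4 :* B :* (x' :+ x :+ e :+ α)) :* (t :* T :* (t :* T)) :=
                   ((x' :- e) :* t :* ((x :- e) :* T) :- A :* (t :* T)) :* ((x' :- e) :* t :* ((x :- e) :* T) :- A :* (t :* T)) :-
                     con 4 :* B :* (t :* T) :* ((x' :- e) :* t :* T :+ (x :- e) :* T :* t :+ (α :+ con 3 :* e) :* (t :* T))) refl x x' e t T α A B ⟩
            ((x' - e) * t * ((x - e) * T) - A * (t * T)) * ((x' - e) * t * ((x - e) * T) - A * (t * T)) -
              # (+ 4) * B * (t * T) * ((x' - e) * t * T + (x - e) * T * t + (α + # (+ 3) * e) * (t * T))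
              ≡⟨ cong₂ (λ a b → (a * b - A * (t * T)) * (a * b - A * (t * T)) - # (+ 4) * B * (t * T) * (a * T + b * t + (α + # (+ 3) * e) * (t * T))) x't xT ⟩
            (1# * 1# - A * (t * T)) * (1# * 1# - A * (t * T)) - # (+ 4) * B * (t * T) * (1# * T + 1# * t + (α + # (+ 3) * e) * (t * T))
              ≡⟨ cong (λ z → (1# * 1# - A * (t * T)) * (1# * 1# - A * (t * T)) - # (+ 4) * B * (t * T) * (1# * T + 1# * t + z * (t * T))) centred ⟩
            (1# * 1# - A * (t * T)) * (1# * 1# - A * (t * T)) - # (+ 4) * B * (t * T) * (1# * T + 1# * t + 0# * (t * T))
              ≡⟨ solve 4 (λ t T A B → let o = con 1 in
                   (o :* o :- A :* (t :* T)) :* (o :* o :- A :* (t :* T)) :- con 4 :* B :* (t :* T) :* (o :* T :+ o :* t :+ con 0 :* (t :* T)) :=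
                   (o :- A :* (t :* T)) :* (o :- A :* (t :* T)) :- con 4 :* B :* (t :* T) :* (t :+ T)) refl t T A B ⟩
            (1# - A * (t * T)) * (1# - A * (t * T)) - # (+ 4) * B * (t * T) * (t + T) ∎
            where open ≡-Reasoning

          -- Every term besides 1 contains tT, and t and T are both divisible by ϖ.
          numerator-principal : ∀ {t s} → t ≡ T * s → Int s →
            Principal ((1# - A * (t * T)) * (1# - A * (t * T)) - # (+ 4) * B * (t * T) * (t + T))
          numerator-principal {t} {s} refl is = r * r * s * h , Int-* (Int-* (Int-* ir ir) is) ih ,
            trans (solve 4 (λ t T A B → (con 1 :- A :* (t :* T)) :* (con 1 :- A :* (t :* T)) :- con 4 :* B :* (t :* T) :* (t :+ T) :=
                con 1 :+ t :* T :* (A :* A :* (t :* T) :- con 2 :* A :- con 4 :* B :* (t :+ T))) refl t T A B)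
              (cong (λ z → 1# + z) (trans (cong (λ T → T * s * T * h) eT) (solve 4 (λ w r s h → w :* r :* s :* (w :* r) :* h := w :* w :* (r :* r :* s :* h)) refl ϖ r s h)))
            where
            h = A * A * (t * T) - # (+ 2) * A - # (+ 4) * B * (t + T)
            it : Int t
            it = Int-* int-T is
            ih : Int h
            ih = Int-- (Int-- (Int-* (Int-* int-A int-A) (Int-* it int-T)) (Int-* (Int-# (+ 2)) int-A))
              (Int-* (Int-* (Int-# (+ 4)) int-B) (Int-+ it int-T))

          -- `x-product` is applied to (n + 1)Q and Q, whose difference nQ is known. Scaled by tT,
          -- the difference of their abscissae is -Tk, so k ≠ 0 says that the secant formula
          -- applies.
          recurrence : ∀ n {u u'} → At n u → At (suc n) u' → Int u' →
            ∀ k → # (+ suc n) * # (+ suc n) * u' ≡ 1# + k → k ≢ 0# →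
            ∃ λ x₊ → ∃ λ y₊ → suc (suc n) · Q ≡ aff x₊ y₊ ×
              (∃ λ E → Principal E × (x₊ - e) * (T * (k * k)) ≡ E * (# (+ n) * # (+ n) * u))
          recurrence n {u} {u'} (xₙ , yₙ , nQ≡ , xₙt) (xₘ , yₘ , mQ≡ , xₘt) iu' k ek k≢0 =
            x₊ , y₊ , trans (cong (Q ⊕_) mQ≡) (trans (⊕-comm Q (aff xₘ yₘ) on onₘ) sum≡) ,
            E , numerator-principal t≡ (Int-* (Int-* (Int-# (+ suc n)) (Int-# (+ suc n))) iu') , final
            where
            open ≡-Reasoning
            N = # (+ n)
            M = # (+ suc n)
            t = M * M * T * u'
            t≡ : t ≡ T * (M * M * u')
            t≡ = solve 3 (λ M T u → M :* M :* T :* u := T :* (M :* M :* u)) refl M T u'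
            E = (1# - A * (t * T)) * (1# - A * (t * T)) - # (+ 4) * B * (t * T) * (t + T)
            onₘ : On (aff xₘ yₘ)
            onₘ = subst On mQ≡ (On-· (suc n) Q on)
            gap : (xₘ - x) * (t * T) ≡ - (T * k)
            gap = combine₃ T xₘt (- t) xT (- T) ek (solve 7 (λ X x e T M u k → let t = M :* M :* T :* u in
              (X :- x) :* (t :* T) :+ (T :* con 1 :+ :- t :* con 1 :+ :- T :* (con 1 :+ k)) :=
              :- (T :* k) :+ (T :* ((X :- e) :* t) :+ :- t :* ((x :- e) :* T) :+ :- T :* (M :* M :* u))) refl xₘ x e T M u' k)
            x≢ : xₘ - x ≢ 0#
            x≢ x≡ = k≢0 (*≡0⇒ T≢0 (combine₂ 1# gap (- (t * T)) x≡ (solve 3 (λ d s k →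
              k :+ (con 1 :* :- k :+ :- s :* con 0) := con 0 :+ (con 1 :* (d :* s) :+ :- s :* d)) refl (xₘ - x) (t * T) (T * k))))
            sd = sumDifference onₘ on x≢
            open SumDifference sd
            x₋≡xₙ : x₋ ≡ xₙ
            x₋≡xₙ = aff-injective (trans (sym difference≡) (trans (cong (_⊕ neg Q) (sym mQ≡))
              (trans (⊕-cancel Q (n · Q) on (On-· n Q on)) nQ≡)))
              where
              aff-injective : ∀ {x y x' y'} → aff x y ≡ aff x' y' → x ≡ x'
              aff-injective refl = refl
            final : (x₊ - e) * (T * (k * k)) ≡ E * (N * N * u)
            final = *-cancelˡ T≢0 (begin
              T * ((x₊ - e) * (T * (k * k)))
                ≡⟨ solve 3 (λ X T k → T :* (X :* (T :* (k :* k))) := X :* con 1 :* (:- (T :* k) :* :- (T :* k))) refl (x₊ - e) T k ⟩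
              (x₊ - e) * 1# * (- (T * k) * - (T * k))
                ≡⟨ cong₂ (λ a b → (x₊ - e) * a * (b * b)) (sym xₙt) (sym gap) ⟩
              (x₊ - e) * ((xₙ - e) * (N * N * T * u)) * ((xₘ - x) * (t * T) * ((xₘ - x) * (t * T)))
                ≡⟨ solve 6 (λ X Y d s T z → X :* (Y :* z) :* (d :* s :* (d :* s)) := X :* Y :* (d :* d) :* (s :* s) :* z) refl (x₊ - e) (xₙ - e) (xₘ - x) (t * T) T (N * N * T * u) ⟩
              (x₊ - e) * (xₙ - e) * ((xₘ - x) * (xₘ - x)) * (t * T * (t * T)) * (N * N * T * u)
                ≡⟨ cong (λ z → (x₊ - e) * (z - e) * ((xₘ - x) * (xₘ - x)) * (t * T * (t * T)) * (N * N * T * u)) x₋≡xₙ ⟨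
              (x₊ - e) * (x₋ - e) * ((xₘ - x) * (xₘ - x)) * (t * T * (t * T)) * (N * N * T * u)
                ≡⟨ cong (λ z → z * (t * T * (t * T)) * (N * N * T * u)) (x-product e) ⟩
              numerator e xₘ x * (t * T * (t * T)) * (N * N * T * u)
                ≡⟨ cong (_* (N * N * T * u)) (numerator≡ xₘt) ⟩
              E * (N * N * T * u)
                ≡⟨ solve 4 (λ E N T u → E :* (N :* N :* T :* u) := T :* (E :* (N :* N :* u))) refl E N T u ⟩
              T * (E * (N * N * u)) ∎)

          State : ℕ → Set
          State m = ∃ λ u → Principal u × At m u

          state₁ : State 1
          state₁ = 1# , Principal-1 , x , y , refl , trans (solve 2 (λ X T → X :* (con 1 :* con 1 :* T :* con 1) := X :* T) refl (x - e) T) xT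

          -- The choice α + 3e = 0 removes the term linear in T, which would leave only a congruence
          -- modulo ϖ instead of ϖ².
          f-scaled : f x * (T * T * T) ≡ 1# + T * T * (A + B * T)
          f-scaled = trans (solve 6 (λ x e T α β γ → let X = (x :- e) :* T in
              (x :* x :* x :+ α :* x :* x :+ β :* x :+ γ) :* (T :* T :* T) :=
              X :* X :* X :+ (α :+ con 3 :* e) :* (X :* X) :* T :+ (e :* e :+ e :* e :+ e :* e :+ α :* (e :+ e) :+ β) :* X :* (T :* T) :+
                (e :* e :* e :+ α :* e :* e :+ β :* e :+ γ) :* (T :* T :* T)) refl x e T α β γ)
            (trans (cong₂ (λ X z → X * X * X + z * (X * X) * T + A * X * (T * T) + B * (T * T * T)) xT centred)
              (solve 3 (λ T A B → let o = con 1 in o :* o :* o :+ con 0 :* (o :* o) :* T :+ A :* o :* (T :* T) :+ B :* (T :* T :* T) :=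
                o :+ T :* T :* (A :+ B :* T)) refl T A B))

          f-principal : Principal (1# + T * T * (A + B * T))
          f-principal = r * r * (A + B * T) , Int-* (Int-* ir ir) (Int-+ int-A (Int-* int-B int-T)) ,
            cong (λ z → 1# + z) (trans (cong (λ t → t * t * (A + B * T)) eT)
              (solve 3 (λ w r h → w :* r :* (w :* r) :* h := w :* w :* (r :* r :* h)) refl ϖ r (A + B * T)))

          2y≢0 : y + y ≢ 0#
          2y≢0 2y≡0 = Unit⇒≢0 (Unit-* (unit-< 4 (s≤s z≤n) 4<p) (Principal⇒Unit f-principal)) (begin
            # (+ 4) * (1# + T * T * (A + B * T))    ≡⟨ cong (# (+ 4) *_) f-scaled ⟨
            # (+ 4) * (f x * (T * T * T))           ≡⟨ cong (λ z → # (+ 4) * (z * (T * T * T))) on ⟨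
            # (+ 4) * (y * y * (T * T * T))         ≡⟨ solve 2 (λ y s → con 4 :* (y :* y :* s) := (y :+ y) :* ((y :+ y) :* s)) refl y (T * T * T) ⟩
            (y + y) * ((y + y) * (T * T * T))       ≡⟨ cong (_* ((y + y) * (T * T * T))) 2y≡0 ⟩
            0# * ((y + y) * (T * T * T))            ≡⟨ solve 1 (λ z → con 0 :* z := con 0) refl ((y + y) * (T * T * T)) ⟩
            0#                                      ∎)
            where
            open ≡-Reasoning
            4<p : 4 ℕ.< p
            4<p = subst (4 ℕ.<_) (sym p≡) (s≤s (s≤s 3≤q))

          -- The recurrence cannot start from Q and Q, which have the same abscissa; the duplication
          -- formula supplies 2Q.
          state₂ : State 2
          state₂ =
            let x₂ , y₂ , eq , ex = double on 2y≢0
                E-principal = numerator-principal {T} {1#} (solve 1 (λ T → T := T :* con 1) refl T) (Int-# (+ 1))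
                v , v-principal , ev = Principal-inverse E-principal in
            (1# + T * T * (A + B * T)) * v , Principal-* f-principal v-principal , x₂ , y₂ ,
            trans (cong (Q ⊕_) (⊕-identityʳ Q)) eq , reciprocal (ex e) ev
            where
            open ≡-Reasoning
            E = (1# - A * (T * T)) * (1# - A * (T * T)) - # (+ 4) * B * (T * T) * (T + T)
            reciprocal : ∀ {x₂ v} → (x₂ - e) * (# (+ 4) * f x) ≡ numerator e x x → E * v ≡ 1# →
              (x₂ - e) * (# (+ 2) * # (+ 2) * T * ((1# + T * T * (A + B * T)) * v)) ≡ 1#
            reciprocal {x₂} {v} ex ev = begin
              (x₂ - e) * (# (+ 2) * # (+ 2) * T * ((1# + T * T * (A + B * T)) * v))
                ≡⟨ cong (λ z → (x₂ - e) * (# (+ 2) * # (+ 2) * T * (z * v))) f-scaled ⟨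
              (x₂ - e) * (# (+ 2) * # (+ 2) * T * (f x * (T * T * T) * v))
                ≡⟨ solve 4 (λ X T F v → X :* (con 2 :* con 2 :* T :* (F :* (T :* T :* T) :* v)) := X :* (con 4 :* F) :* (T :* T :* (T :* T)) :* v) refl (x₂ - e) T (f x) v ⟩
              (x₂ - e) * (# (+ 4) * f x) * (T * T * (T * T)) * v
                ≡⟨ cong (λ z → z * (T * T * (T * T)) * v) ex ⟩
              numerator e x x * (T * T * (T * T)) * v
                ≡⟨ cong (_* v) (numerator≡ xT) ⟩
              E * v
                ≡⟨ ev ⟩
              1# ∎

          -- With M = n + 1, the number M² - 1 = n(n + 2) is a unit as long as n + 2 < p, so k is NP
          -- times a principal unit w. The factor N² cancels in the recurrence and P²T times a
          -- principal unit remains.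
          state-suc : ∀ n → 1 ℕ.≤ n → suc (suc n) ℕ.< p → State n → State (suc n) → State (suc (suc n))
          state-suc n 1≤n n+2<p (u , pu , at) (u' , (c , ic , eu') , at') =
            let _ , j , ij , ej = NP-unit
                w = 1# + ϖ * ϖ * (M * M * c * j)
                pw : Principal w
                pw = M * M * c * j , Int-* (Int-* (Int-* iM iM) ic) ij , refl
                x₊ , y₊ , eq , E , pE , e₊ = recurrence n at at' (subst Int (sym eu') (proj₁ (Principal⇒Unit (c , ic , refl)))) (N * P * w) (k≡ ej)
                  (Unit⇒≢0 (Unit-* NP-unit (Principal⇒Unit pw)))
                v , pv , ev = Principal-inverse (Principal-* pE pu) in
            w * w * v , Principal-* (Principal-* pw pw) pv , x₊ , y₊ , eq , reciprocal e₊ ev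
            where
            open ≡-Reasoning
            N = # (+ n)
            M = # (+ suc n)
            P = # (+ suc (suc n))
            iM = Int-# (+ suc n)
            NP-unit : Unit (N * P)
            NP-unit = Unit-* (unit-< n 1≤n (ℕP.<-trans (ℕP.<-trans (ℕP.n<1+n n) (ℕP.n<1+n (suc n))) n+2<p)) (unit-< (suc (suc n)) (s≤s z≤n) n+2<p)
            N-unit : Unit N
            N-unit = unit-< n 1≤n (ℕP.<-trans (ℕP.<-trans (ℕP.n<1+n n) (ℕP.n<1+n (suc n))) n+2<p)
            k≡ : ∀ {j} → N * P * j ≡ 1# → M * M * u' ≡ 1# + N * P * (1# + ϖ * ϖ * (M * M * c * j))
            k≡ {j} ej = trans (cong (M * M *_) eu') (combine₁ (- (ϖ * ϖ * (M * M * c))) ej (trans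
              (cong (λ M → M * M * (1# + ϖ * ϖ * c) + - (ϖ * ϖ * (M * M * c)) * 1#) M≡)
              (trans (solve 4 (λ N w c j → let M = N :+ con 1
                                               P = N :+ con 1 :+ con 1 in
                M :* M :* (con 1 :+ w :* w :* c) :+ :- (w :* w :* (M :* M :* c)) :* con 1 :=
                con 1 :+ N :* P :* (con 1 :+ w :* w :* (M :* M :* c :* j)) :+ :- (w :* w :* (M :* M :* c)) :* (N :* P :* j)) refl N ϖ c j)
              (cong₂ (λ M P → 1# + N * P * (1# + ϖ * ϖ * (M * M * c * j)) + - (ϖ * ϖ * (M * M * c)) * (N * P * j)) (sym M≡) (sym P≡)))))
              where
              M≡ : M ≡ N + 1#
              M≡ = #-suc n
              P≡ : P ≡ N + 1# + 1#
              P≡ = trans (#-suc (suc n)) (cong (_+ 1#) M≡)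
            reciprocal : ∀ {x₊ E v w} → (x₊ - e) * (T * (N * P * w * (N * P * w))) ≡ E * (N * N * u) → E * u * v ≡ 1# →
              (x₊ - e) * (P * P * T * (w * w * v)) ≡ 1#
            reciprocal {x₊} {E} {v} {w} e₊ ev = *-cancelˡ (Unit⇒≢0 (Unit-* N-unit N-unit)) (combine₂ v e₊ (N * N) ev
              (solve 8 (λ X T N P w E u v → N :* N :* (X :* (P :* P :* T :* (w :* w :* v))) :+ (v :* (E :* (N :* N :* u)) :+ N :* N :* con 1) :=
                N :* N :* con 1 :+ (v :* (X :* (T :* (N :* P :* w :* (N :* P :* w)))) :+ N :* N :* (E :* u :* v))) refl (x₊ - e) T N P w E u v))

          states : ∀ n → suc (suc n) ℕ.< p → State (suc n) × State (suc (suc n))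
          states zero _ = state₁ , state₂
          states (suc n) n+3<p =
            let s , s' = states n (ℕP.<-trans (ℕP.n<1+n (suc (suc n))) n+3<p) in
            s' , state-suc (suc n) (s≤s z≤n) n+3<p s s'

          -- At m = p - 1 the number m² - 1 = p(p - 2) has exactly one factor p, so k = ϖz with z a
          -- unit. The recurrence squares k, and the reciprocal for pQ is ϖ² times T up to a unit:
          -- one ϖ more than asked for.
          p-state : ∀ n → p ≡ suc (suc n) → State n → State (suc n) → ∃ λ c → Int c × Near e (p · Q) (ϖ * c * T)
          p-state n p≡n+2 (u , pu , at) (u' , (c , ic , eu') , at') =
            let x₊ , y₊ , eq , E , pE , e₊ = recurrence n at at' (subst Int (sym eu') (proj₁ (Principal⇒Unit (c , ic , refl)))) (ϖ * z) k≡
                  (λ ϖz≡0 → Unit⇒≢0 z-unit (*≡0⇒ p≢0 ϖz≡0))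
                _ , v , iv , ev = Unit-* (Unit-* (Principal⇒Unit pE) (Unit-* N-unit N-unit)) (Principal⇒Unit pu)
                i-coefficient = Int-* (Int-* (Int-# (+ p)) (Int-* (proj₁ z-unit) (proj₁ z-unit))) iv in
            ϖ * (z * z) * v , i-coefficient , x₊ , y₊ , trans (cong (_· Q) p≡n+2) eq , reciprocal e₊ ev ,
            ϖ * (z * z) * v * T , Int-* i-coefficient int-T , solve 3 (λ w c T → w :* c :* T := w :* (c :* T)) refl ϖ (ϖ * (z * z) * v) T
            where
            N = # (+ n)
            M = # (+ suc n)
            z = N + ϖ * (M * M * c)
            1≤n : 1 ℕ.≤ n
            1≤n = ℕP.≤-trans (s≤s z≤n) (subst (3 ℕ.≤_) (ℕP.suc-injective (ℕP.suc-injective (trans (sym p≡) p≡n+2))) 3≤q)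
            N-unit : Unit N
            N-unit = unit-< n 1≤n (subst (n ℕ.<_) (sym p≡n+2) (ℕP.<-trans (ℕP.n<1+n n) (ℕP.n<1+n (suc n))))
            z-unit : Unit z
            z-unit = Unit-+Max N-unit (Max-*ʳ Max-p (Int-* (Int-* (Int-# (+ suc n)) (Int-# (+ suc n))) ic))
            M≡ : M ≡ N + 1#
            M≡ = #-suc n
            ϖ≡ : ϖ ≡ N + 1# + 1#
            ϖ≡ = trans (cong (λ m → # (+ m)) p≡n+2) (trans (#-suc (suc n)) (cong (_+ 1#) M≡))
            k≡ : M * M * u' ≡ 1# + ϖ * z
            k≡ = trans (cong (M * M *_) eu') (combine₂ (M + N + 1#) M≡ (- N) ϖ≡ (solve 4 (λ M N w c →
              M :* M :* (con 1 :+ w :* w :* c) :+ ((M :+ N :+ con 1) :* (N :+ con 1) :+ :- N :* (N :+ con 1 :+ con 1)) :=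
              con 1 :+ w :* (N :+ w :* (M :* M :* c)) :+ ((M :+ N :+ con 1) :* M :+ :- N :* w)) refl M N ϖ c))
            reciprocal : ∀ {x₊ E v} → (x₊ - e) * (T * (ϖ * z * (ϖ * z))) ≡ E * (N * N * u) → E * (N * N) * u * v ≡ 1# →
              (x₊ - e) * (ϖ * (ϖ * (z * z) * v) * T) ≡ 1#
            reciprocal {x₊} {E} {v} e₊ ev = combine₂ v e₊ 1# ev (solve 8 (λ X T w z E N u v →
              X :* (w :* (w :* (z :* z) :* v) :* T) :+ (v :* (E :* (N :* N :* u)) :+ con 1 :* con 1) :=
              con 1 :+ (v :* (X :* (T :* (w :* z :* (w :* z)))) :+ con 1 :* (E :* (N :* N) :* u :* v))) refl (x₊ - e) T ϖ z E N u v)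

        near-· : ∃ λ c → Int c × Near e (p · Q) (ϖ * c * T)
        near-· = by-q q p≡ 3≤q
          where
          by-q : ∀ q → p ≡ suc (suc q) → 3 ℕ.≤ q → ∃ λ c → Int c × Near e (p · Q) (ϖ * c * T)
          by-q (suc q') p≡' _ =
            let s , s' = states q' (subst (suc (suc q') ℕ.<_) (sym p≡') (ℕP.n<1+n (suc (suc q')))) in p-state (suc q') p≡' s s'

      multiplication-step : ∀ {Q T} → On Q → Near e Q T → ∃ λ c → Int c × Near e (p · Q) (ϖ * c * T)
      multiplication-step on (x , y , refl , xT , r , ir , eT) = near-· on xT ir eT

-- The 2-adic obstruction

module _ {F : Field} (loc : Localization F) where
  open LocalTheory loc

  module TwoAdic (π≡2 : π ≡ # (+ 2))
    (residue : ∀ {x} → Int x → Max x ⊎ Max (x - 1#)) where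

    2≢0 : # (+ 2) ≢ 0#
    2≢0 e = π≢0 (trans π≡2 e)

    4≢0 : # (+ 4) ≢ 0#
    4≢0 e = 2≢0 (*≡0⇒ 2≢0 (trans (solve 0 (con 2 :* con 2 := con 4) refl) e))

    Max-2 : Max (# (+ 2))
    Max-2 = subst Max π≡2 Max-π

    Max-2* : ∀ {x} → Int x → Max (# (+ 2) * x)
    Max-2* ix = Max-*ʳ Max-2 ix

    Max-4* : ∀ {x} → Int x → Max (# (+ 4) * x)
    Max-4* {x} ix = subst Max (solve 1 (λ x → con 2 :* (con 2 :* x) := con 4 :* x) refl x) (Max-2* (Int-* (Int-# (+ 2)) ix))

    even : ∀ {x} → Max x → ∃ λ r → Int r × x ≡ # (+ 2) * r
    even (r , ir , e) = r , ir , trans e (cong (_* r) π≡2)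

    odd : ∀ {x} → Int x → ¬ Max x → ∃ λ r → Int r × x ≡ 1# + # (+ 2) * r
    odd {x} ix ¬m = by-residue (residue ix)
      where
      by-residue : Max x ⊎ Max (x - 1#) → ∃ λ r → Int r × x ≡ 1# + # (+ 2) * r
      by-residue (inj₁ m) = ⊥-elim (¬m m)
      by-residue (inj₂ m) = let r , ir , e = even m in r , ir ,
        combine₁ 1# e (solve 2 (λ x r → x :+ con 1 :* (con 2 :* r) := con 1 :+ con 2 :* r :+ con 1 :* (x :- con 1)) refl x r)

    data SquareMod4 (x : Carrier) : Set where
      is-even : ∀ r → Int r → x ≡ # (+ 2) * r → SquareMod4 x
      is-odd  : ∀ c → Int c → x * x ≡ 1# + # (+ 4) * c → SquareMod4 x

    square-mod-4 : ∀ {x} → Int x → SquareMod4 x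
    square-mod-4 {x} ix = by-residue (residue ix)
      where
      by-residue : Max x ⊎ Max (x - 1#) → SquareMod4 x
      by-residue (inj₁ m) = let r , ir , e = even m in is-even r ir e
      by-residue (inj₂ m) = let r , ir , e = even m in is-odd (r + r * r) (Int-+ ir (Int-* ir ir))
        (combine₁ (x + 1# + # (+ 2) * r) e (solve 2 (λ x r → x :* x :+ (x :+ con 1 :+ con 2 :* r) :* (con 2 :* r) :=
          con 1 :+ con 4 :* (r :+ r :* r) :+ (x :+ con 1 :+ con 2 :* r) :* (x :- con 1)) refl x r))

    consecutive : ∀ {x} → Int x → Max (x * (x + 1#))
    consecutive {x} ix = by-residue (residue ix)
      where
      by-residue : Max x ⊎ Max (x - 1#) → Max (x * (x + 1#))
      by-residue (inj₁ m) = Max-*ʳ m (Int-+ ix (Int-# (+ 1)))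
      by-residue (inj₂ m) = Max-*ˡ ix (subst Max (solve 1 (λ x → x :- con 1 :+ con 2 := x :+ con 1) refl x) (Max-+ m Max-2))

    Unit-square : ∀ {x} → Int x → Unit (x * x) → Unit x
    Unit-square ix u = Unit-factorˡ ix ix u

    -- Modulo 4 the squares are 0 and 1.
    not-8-unit : ∀ {δ σ b t U} → Unit δ → Int σ → Int b → Int t → Unit U →
      # (+ 2) * δ * (b * b * (b * b)) - (1# + # (+ 4) * σ) * (b * b) + t * t ≢ # (+ 8) * U
    not-8-unit {δ} {σ} {b} {t} {U} uδ iσ ib it uU eq = by-squares (square-mod-4 ib) (square-mod-4 it)
      where
      iδ = proj₁ uδ
      iU = proj₁ uU
      -- Both even: dividing by 4 leaves τ² - β² congruent to 2U modulo 4, but a difference of two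
      -- squares is never 2 modulo 4.
      by-halves : ∀ {β τ} → b ≡ # (+ 2) * β → t ≡ # (+ 2) * τ → Int β → Int τ → SquareMod4 β → SquareMod4 τ → ⊥
      by-halves {β} {τ} refl refl iβ iτ sβ sτ = contradictory sβ sτ
        where
        iβ² = Int-* iβ iβ
        halved : τ * τ ≡ # (+ 2) * U + (1# + # (+ 4) * σ) * (β * β) - # (+ 4) * (# (+ 2) * δ * (β * β * (β * β)))
        halved = *-cancelˡ 4≢0 (combine₁ 1# eq (solve 5 (λ δ σ β τ U → let b = con 2 :* β in let t = con 2 :* τ in
          con 4 :* (τ :* τ) :+ con 1 :* (con 8 :* U) :=
          con 4 :* (con 2 :* U :+ (con 1 :+ con 4 :* σ) :* (β :* β) :- con 4 :* (con 2 :* δ :* (β :* β :* (β :* β)))) :+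
            con 1 :* (con 2 :* δ :* (b :* b :* (b :* b)) :- (con 1 :+ con 4 :* σ) :* (b :* b) :+ t :* t)) refl δ σ β τ U))
        i-rest : Int (# (+ 2) * δ * (β * β * (β * β)))
        i-rest = Int-* (Int-* (Int-# (+ 2)) iδ) (Int-* iβ² iβ²)
        contradictory : SquareMod4 β → SquareMod4 τ → ⊥
        contradictory (is-even c ic refl) (is-even c' ic' refl) = Unit⇒¬Max uU (subst Max
          (sym (*-cancelˡ 2≢0 (combine₁ (- 1#) halved (solve 5 (λ δ σ c c' U → let β = con 2 :* c in let τ = con 2 :* c' in
            con 2 :* U :+ :- con 1 :* (con 2 :* U :+ (con 1 :+ con 4 :* σ) :* (β :* β) :- con 4 :* (con 2 :* δ :* (β :* β :* (β :* β)))) :=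
            con 2 :* (con 2 :* (c' :* c' :- (con 1 :+ con 4 :* σ) :* (c :* c) :+ con 16 :* (con 2 :* δ :* (c :* c :* (c :* c))))) :+ :- con 1 :* (τ :* τ))
            refl δ σ c c' U))))
          (Max-2* (Int-+ (Int-- (Int-* ic' ic') (Int-* (Int-+ (Int-# (+ 1)) (Int-* (Int-# (+ 4)) iσ)) (Int-* ic ic)))
            (Int-* (Int-# (+ 16)) (Int-* (Int-* (Int-# (+ 2)) iδ) (Int-* (Int-* ic ic) (Int-* ic ic)))))))
        contradictory (is-even c ic refl) (is-odd c' ic' eτ) = ¬Max-1 (subst Max
          (sym (combine₂ (- 1#) eτ 1# halved (solve 6 (λ δ σ c c' U τ² → let β = con 2 :* c in
            con 1 :+ (:- con 1 :* (con 1 :+ con 4 :* c') :+ con 1 :* (con 2 :* U :+ (con 1 :+ con 4 :* σ) :* (β :* β) :- con 4 :* (con 2 :* δ :* (β :* β :* (β :* β))))) :=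
            con 2 :* (U :+ con 2 :* (con 1 :+ con 4 :* σ) :* (c :* c) :- con 2 :* (con 2 :* δ :* (β :* β :* (β :* β))) :- con 2 :* c') :+ (:- con 1 :* τ² :+ con 1 :* τ²)) refl δ σ c c' U (τ * τ))))
          (Max-2* (Int-- (Int-- (Int-+ iU (Int-* (Int-* (Int-# (+ 2)) (Int-+ (Int-# (+ 1)) (Int-* (Int-# (+ 4)) iσ))) (Int-* ic ic))) (Int-* (Int-# (+ 2)) i-rest)) (Int-* (Int-# (+ 2)) ic'))))
        contradictory (is-odd c ic eβ) (is-even c' ic' refl) = ¬Max-1 (subst Max
          (sym (combine₂ (- 1#) eβ (- 1#) halved (solve 7 (λ δ σ c c' U β² τ → let τ = con 2 :* c' in
            con 1 :+ (:- con 1 :* (con 1 :+ con 4 :* c) :+ :- con 1 :* (con 2 :* U :+ (con 1 :+ con 4 :* σ) :* β² :- con 4 :* (con 2 :* δ :* (β² :* β²)))) :=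
            con 2 :* (con 2 :* (c' :* c') :- U :- con 2 :* σ :* β² :+ con 2 :* (con 2 :* δ :* (β² :* β²)) :- con 2 :* c) :+
              (:- con 1 :* β² :+ :- con 1 :* (τ :* τ))) refl δ σ c c' U (β * β) τ)))
          (Max-2* (Int-- (Int-+ (Int-- (Int-- (Int-* (Int-# (+ 2)) (Int-* ic' ic')) iU) (Int-* (Int-* (Int-# (+ 2)) iσ) iβ²)) (Int-* (Int-# (+ 2)) i-rest)) (Int-* (Int-# (+ 2)) ic))))
        contradictory (is-odd c ic eβ) (is-odd c' ic' eτ) = Unit⇒¬Max uU (subst Max
          (sym (*-cancelˡ 2≢0 (combine₃ (- 1#) halved 1# eτ (- 1#) eβ (solve 7 (λ δ σ c c' U β² τ² →
            con 2 :* U :+ (:- con 1 :* (con 2 :* U :+ (con 1 :+ con 4 :* σ) :* β² :- con 4 :* (con 2 :* δ :* (β² :* β²))) :+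
              con 1 :* (con 1 :+ con 4 :* c') :+ :- con 1 :* (con 1 :+ con 4 :* c)) :=
            con 2 :* (con 2 :* (c' :- c :- σ :* β² :+ con 2 :* δ :* (β² :* β²))) :+
              (:- con 1 :* τ² :+ con 1 :* τ² :+ :- con 1 :* β²)) refl δ σ c c' U (β * β) (τ * τ)))))
          (Max-2* (Int-+ (Int-- (Int-- ic' ic) (Int-* iσ iβ²)) i-rest)))

      by-squares : SquareMod4 b → SquareMod4 t → ⊥
      by-squares (is-even β iβ eβ) (is-even τ iτ eτ) = by-halves eβ eτ iβ iτ (square-mod-4 iβ) (square-mod-4 iτ)
      by-squares (is-even β iβ refl) (is-odd c ic et) = ¬Max-1 (subst Max
        (sym (combine₂ (- 1#) et 1# eq (solve 6 (λ δ σ β t² c U → let b = con 2 :* β in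
          con 1 :+ (:- con 1 :* (con 1 :+ con 4 :* c) :+ con 1 :* (con 8 :* U)) :=
          con 2 :* (con 4 :* U :- con 2 :* c :- δ :* (b :* b :* (b :* b)) :+ (con 1 :+ con 4 :* σ) :* (con 2 :* (β :* β))) :+
            (:- con 1 :* t² :+ con 1 :* (con 2 :* δ :* (b :* b :* (b :* b)) :- (con 1 :+ con 4 :* σ) :* (b :* b) :+ t²))) refl δ σ β (t * t) c U)))
        (Max-2* (Int-+ (Int-- (Int-- (Int-* (Int-# (+ 4)) iU) (Int-* (Int-# (+ 2)) ic)) (Int-* iδ (Int-* (Int-* ib ib) (Int-* ib ib))))
          (Int-* (Int-+ (Int-# (+ 1)) (Int-* (Int-# (+ 4)) iσ)) (Int-* (Int-# (+ 2)) (Int-* iβ iβ))))))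
      by-squares (is-odd c ic eb) (is-even τ iτ refl) = ¬Max-1 (subst Max
        (sym (combine₂ (- 1#) eb (- 1#) eq (solve 6 (λ δ σ b² τ c U → let t = con 2 :* τ in
          con 1 :+ (:- con 1 :* (con 1 :+ con 4 :* c) :+ :- con 1 :* (con 8 :* U)) :=
          con 2 :* (con 2 :* (τ :* τ) :- con 4 :* U :- con 2 :* c :+ δ :* (b² :* b²) :- con 2 :* σ :* b²) :+
            (:- con 1 :* b² :+ :- con 1 :* (con 2 :* δ :* (b² :* b²) :- (con 1 :+ con 4 :* σ) :* b² :+ t :* t))) refl δ σ (b * b) τ c U)))
        (Max-2* (Int-- (Int-+ (Int-- (Int-- (Int-* (Int-# (+ 2)) (Int-* iτ iτ)) (Int-* (Int-# (+ 4)) iU)) (Int-* (Int-# (+ 2)) ic)) (Int-* iδ (Int-* (Int-* ib ib) (Int-* ib ib))))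
          (Int-* (Int-* (Int-# (+ 2)) iσ) (Int-* ib ib)))))
      -- Both odd: b² and t² cancel modulo 4, which leaves 2δb⁴ divisible by 4 although δb⁴ is a
      -- unit.
      by-squares (is-odd c ic eb) (is-odd c' ic' et) = Unit⇒¬Max (Unit-* uδ (Unit-* ub² ub²)) (subst Max
        (sym (*-cancelˡ 2≢0 (combine₃ 1# eq (- 1#) et 1# eb (solve 7 (λ δ σ b² t² c c' U →
          con 2 :* (δ :* (b² :* b²)) :+ (con 1 :* (con 8 :* U) :+ :- con 1 :* (con 1 :+ con 4 :* c') :+ con 1 :* (con 1 :+ con 4 :* c)) :=
          con 2 :* (con 2 :* (con 2 :* U :- c' :+ c :+ σ :* b²)) :+
            (con 1 :* (con 2 :* δ :* (b² :* b²) :- (con 1 :+ con 4 :* σ) :* b² :+ t²) :+ :- con 1 :* t² :+ con 1 :* b²)) refl δ σ (b * b) (t * t) c c' U))))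
        (Max-2* (Int-+ (Int-+ (Int-- (Int-* (Int-# (+ 2)) iU) ic') ic) (Int-* iσ (Int-* ib ib)))))
        where
        ub² : Unit (b * b)
        ub² = subst Unit (sym eb) (Unit-+Max Unit-1 (Max-4* ic))

module _ {F : Field} (loc : Localization F) where
  open LocalTheory loc

  module NormIntegral (δ : Carrier) (δ-unit : Unit δ) where
    open Ramified loc δ δ-unit
    private
      module KL = LocalTheory quadraticLocalization

    -- If s + t√d had a pole, its reciprocal would have norm in the maximal ideal, while the product
    -- of the two norms is 1.
    norm-integral : ∀ {s t} → Int (s * s - d * (t * t)) → Int s × Int t
    norm-integral {s} {t} i-norm = by-valuation (KL.valuation (s , t))
      where
      by-valuation : IntK (s , t) ⊎ (∃ λ r → IntK r × mulK (s , t) (mulK √d r) ≡ ι 1#) → Int s × Int t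
      by-valuation (inj₁ i) = i
      by-valuation (inj₂ ((r , r') , (ir , ir') , e)) = ⊥-elim (¬Max-1 (subst Max norm≡1
          (Max-*ˡ i-norm (Max-- (Max-*ʳ Max-w iw) (Max-*ʳ Max-d (Int-* iw' iw'))))))
        where
        w w' : Carrier
        w = 0# * r + d * (1# * r')
        w' = 0# * r' + 1# * r
        Max-w : Max w
        Max-w = subst Max (solve 3 (λ d r r' → d :* r' := con 0 :* r :+ d :* (con 1 :* r')) refl d r r') (Max-*ʳ Max-d ir')
        iw = Max-Int Max-w
        iw' : Int w'
        iw' = subst Int (solve 2 (λ r r' → r := con 0 :* r' :+ con 1 :* r) refl r r') ir
        norm≡1 : (s * s - d * (t * t)) * (w * w - d * (w' * w')) ≡ 1#
        norm≡1 = trans (solve 5 (λ d s t w w' → (s :* s :- d :* (t :* t)) :* (w :* w :- d :* (w' :* w')) :=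
            (s :* w :+ d :* (t :* w')) :* (s :* w :+ d :* (t :* w')) :- d :* ((s :* w' :+ t :* w) :* (s :* w' :+ t :* w))) refl d s t w w')
          (trans (cong₂ (λ a b → a * a - d * (b * b)) (cong proj₁ e) (cong proj₂ e))
            (solve 1 (λ d → con 1 :* con 1 :- d :* (con 0 :* con 0) := con 1) refl d))

    d-square-integral : ∀ {t} → Int (d * (t * t)) → Int t
    d-square-integral {t} i = proj₂ (norm-integral {0#} (subst Int (solve 2 (λ d t → :- (d :* (t :* t)) := con 0 :* con 0 :- d :* (t :* t)) refl d t) (Int-neg i)))

module _ {F : Field} (loc : Localization F) where
  open LocalTheory loc

  module TwoDescent (π≡2 : π ≡ # (+ 2))
    (residue : ∀ {x} → Int x → Max x ⊎ Max (x - 1#)) {δ : Carrier} (δ-unit : Unit δ)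
    {a₁ a₂ a₃ a₄ a₆ : Carrier} (int₁ : Int a₁) (int₂ : Int a₂) (int₃ : Int a₃) (int₄ : Int a₄) (int₆ : Int a₆) where
    open TwoAdic loc π≡2 residue
    open Coefficients F a₁ a₂ a₃ a₄ a₆
    open IntegralInvariants loc int₁ int₂ int₃ int₄ int₆ using (Int-b₂; Int-b₄; Int-b₆)
    private
      open ≡-Reasoning
      d : Carrier
      d = # (+ 2) * δ
      iδ = proj₁ δ-unit

      4* : ∀ {x} → Int x → Int (# (+ 4) * x)
      4* = Int-* (Int-# (+ 4))
      2* : ∀ {x} → Int x → Int (# (+ 2) * x)
      2* = Int-* (Int-# (+ 2))

    -- X₀ is four times the first coordinate of a point of order 2 near the origin, which forces ordinary reduction.
    module _ {x₀ t'} (it' : Int t') (x₀t' : x₀ * (# (+ 2) * t') ≡ 1#)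
      (root : # (+ 4) * (x₀ * x₀ * x₀) + b₂ * (x₀ * x₀) + # (+ 2) * b₄ * x₀ + b₆ ≡ 0#) where
      private
        X₀ : Carrier
        X₀ = # (+ 4) * x₀

        -- The cubic equation of x₀ multiplied by the cube of its reciprocal 2t' and divided by 2.
        reversed : # (+ 2) + b₂ * t' + # (+ 4) * (b₄ * (t' * t') + b₆ * (t' * t' * t')) ≡ 0#
        reversed = *-cancelˡ 2≢0 (begin
          # (+ 2) * (# (+ 2) + b₂ * t' + # (+ 4) * (b₄ * (t' * t') + b₆ * (t' * t' * t')))
            ≡⟨ solve 4 (λ t b₂ b₄ b₆ → let T = con 2 :* t in let o = con 1 in
                 con 2 :* (con 2 :+ b₂ :* t :+ con 4 :* (b₄ :* (t :* t) :+ b₆ :* (t :* t :* t))) :=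
                 con 4 :* (o :* o :* o) :+ b₂ :* (o :* o) :* T :+ con 2 :* b₄ :* o :* (T :* T) :+ b₆ :* (T :* T :* T)) refl t' b₂ b₄ b₆ ⟩
          # (+ 4) * (1# * 1# * 1#) + b₂ * (1# * 1#) * T + # (+ 2) * b₄ * 1# * (T * T) + b₆ * (T * T * T)
            ≡⟨ cong (λ z → # (+ 4) * (z * z * z) + b₂ * (z * z) * T + # (+ 2) * b₄ * z * (T * T) + b₆ * (T * T * T)) x₀t' ⟨
          # (+ 4) * (x₀ * T * (x₀ * T) * (x₀ * T)) + b₂ * (x₀ * T * (x₀ * T)) * T + # (+ 2) * b₄ * (x₀ * T) * (T * T) + b₆ * (T * T * T)
            ≡⟨ solve 5 (λ x T b₂ b₄ b₆ → let z = x :* T in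
                 con 4 :* (z :* z :* z) :+ b₂ :* (z :* z) :* T :+ con 2 :* b₄ :* z :* (T :* T) :+ b₆ :* (T :* T :* T) :=
                 (con 4 :* (x :* x :* x) :+ b₂ :* (x :* x) :+ con 2 :* b₄ :* x :+ b₆) :* (T :* T :* T)) refl x₀ T b₂ b₄ b₆ ⟩
          (# (+ 4) * (x₀ * x₀ * x₀) + b₂ * (x₀ * x₀) + # (+ 2) * b₄ * x₀ + b₆) * (T * T * T)
            ≡⟨ cong (_* (T * T * T)) root ⟩
          0# * (T * T * T)
            ≡⟨ solve 1 (λ z → con 0 :* z := con 2 :* con 0) refl (T * T * T) ⟩
          # (+ 2) * 0# ∎)
          where T = # (+ 2) * t'

        i-tail : Int (b₄ * (t' * t') + b₆ * (t' * t' * t'))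
        i-tail = Int-+ (Int-* Int-b₄ (Int-* it' it')) (Int-* Int-b₆ (Int-* (Int-* it' it') it'))

        -- For even a₁ the coefficient b₂ is divisible by 4, and `reversed` would make 2 divisible
        -- by 4.
        a₁-odd : ¬ Max a₁
        a₁-odd m = let c , ic , e = even m in Unit⇒¬Max Unit-1 (subst Max
          (sym (*-cancelˡ 2≢0 (combine₂ 1# reversed (- (a₁ + # (+ 2) * c) * t') e (solve 5 (λ a₁ a₂ c t z →
            con 2 :* con 1 :+ (con 1 :* con 0 :+ :- (a₁ :+ con 2 :* c) :* t :* (con 2 :* c)) :=
            con 2 :* :- (con 2 :* ((c :* c :+ a₂) :* t :+ z)) :+
              (con 1 :* (con 2 :+ (a₁ :* a₁ :+ con 4 :* a₂) :* t :+ con 4 :* z) :+ :- (a₁ :+ con 2 :* c) :* t :* a₁))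
            refl a₁ a₂ c t' (b₄ * (t' * t') + b₆ * (t' * t' * t'))))))
          (Max-neg (Max-2* (Int-+ (Int-* (Int-+ (Int-* ic ic) int₂) it') i-tail))))

      b₂-mod-4 : ∃ λ j → Int j × b₂ ≡ 1# + # (+ 4) * j
      b₂-mod-4 = let c , ic , e = odd int₁ a₁-odd in c + c * c + a₂ , Int-+ (Int-+ ic (Int-* ic ic)) int₂ ,
        combine₁ (a₁ + 1# + # (+ 2) * c) e (solve 3 (λ a₁ a₂ c → a₁ :* a₁ :+ con 4 :* a₂ :+ (a₁ :+ con 1 :+ con 2 :* c) :* (con 1 :+ con 2 :* c) :=
          con 1 :+ con 4 :* (c :+ c :* c :+ a₂) :+ (a₁ :+ con 1 :+ con 2 :* c) :* a₁) refl a₁ a₂ c)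

      -- Since b₂ is odd, `reversed` makes t' even. Writing t' = 2s gives X₀s = 1, and `reversed`
      -- multiplied by X₀/2 is the claim.
      X₀-mod-8 : ∃ λ k → Int k × X₀ ≡ - b₂ - # (+ 8) * k
      X₀-mod-8 =
        let j , ij , eb₂ = b₂-mod-4
            s , is , es = even (max-t' j ij eb₂) in
        b₄ * s + # (+ 2) * b₆ * (s * s) , Int-+ (Int-* Int-b₄ is) (Int-* (2* Int-b₆) (Int-* is is)) , X₀≡ es
        where
        max-t' : ∀ j → Int j → b₂ ≡ 1# + # (+ 4) * j → Max t'
        max-t' j ij eb₂ = subst Max
          (sym (combine₂ (- t') eb₂ 1# reversed (solve 4 (λ b₂ t j z →
            t :+ (:- t :* (con 1 :+ con 4 :* j) :+ con 1 :* con 0) :=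
            con 2 :* :- (con 1 :+ con 2 :* (z :+ j :* t)) :+ (:- t :* b₂ :+ con 1 :* (con 2 :+ b₂ :* t :+ con 4 :* z)))
            refl b₂ t' j (b₄ * (t' * t') + b₆ * (t' * t' * t')))))
          (Max-2* (Int-neg (Int-+ (Int-# (+ 1)) (2* (Int-+ i-tail (Int-* ij it'))))))
        X₀≡ : ∀ {s} → t' ≡ # (+ 2) * s → X₀ ≡ - b₂ - # (+ 8) * (b₄ * s + # (+ 2) * b₆ * (s * s))
        X₀≡ {s} refl = *-cancelˡ 2≢0 (combine₂ (# (+ 4) * x₀) reversed
          (- (# (+ 2)) * (b₂ + # (+ 8) * (b₄ * s + # (+ 2) * b₆ * (s * s)))) x₀t'
          (solve 5 (λ x s b₂ b₄ b₆ → let t = con 2 :* s in let h = b₂ :+ con 8 :* (b₄ :* s :+ con 2 :* b₆ :* (s :* s)) in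
            con 2 :* (con 4 :* x) :+ (con 4 :* x :* con 0 :+ :- (con 2) :* h :* con 1) :=
            con 2 :* (:- b₂ :- con 8 :* (b₄ :* s :+ con 2 :* b₆ :* (s :* s))) :+
              (con 4 :* x :* (con 2 :+ b₂ :* t :+ con 4 :* (b₄ :* (t :* t) :+ b₆ :* (t :* t :* t))) :+
               :- (con 2) :* h :* (x :* (con 2 :* t)))) refl x₀ s b₂ b₄ b₆))

      module _ {α β s q m} (4α : # (+ 4) * α ≡ b₂) (2β : # (+ 2) * β ≡ b₄) (Δ-unit : Unit Δ)
        (e-norm : s * s - d * (q * q) ≡ # (+ 3) * (x₀ * x₀) + # (+ 2) * α * x₀ + β)
        (e-trace : d * (m * m) ≡ # (+ 2) * s + # (+ 3) * x₀ + α) where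
        private
          -- These factors clear the powers of 2: the norm of S + t̂√d becomes `b'` and dμ² becomes
          -- 2S + 3X₀ + b₂, from which S, t̂ and μ turn out to be integral.
          S t̂ μ : Carrier
          S = # (+ 4) * s
          t̂ = # (+ 4) * q
          μ = # (+ 2) * m
          k = proj₁ X₀-mod-8
          ik = proj₁ (proj₂ X₀-mod-8)
          X₀≡ = proj₂ (proj₂ X₀-mod-8)
          j = proj₁ b₂-mod-4
          ij = proj₁ (proj₂ b₂-mod-4)
          b₂≡ = proj₂ (proj₂ b₂-mod-4)

          iX₀ : Int X₀
          iX₀ = subst Int (sym X₀≡) (Int-- (Int-neg Int-b₂) (Int-* (Int-# (+ 8)) ik))

          ℓ : Carrier
          ℓ = b₄ - # (+ 2) * k * X₀
          iℓ : Int ℓ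
          iℓ = Int-- Int-b₄ (Int-* (2* ik) iX₀)

          b₂≡' : b₂ ≡ - X₀ - # (+ 8) * k
          b₂≡' = combine₁ 1# X₀≡ (solve 3 (λ b X k → b :+ con 1 :* (:- b :- con 8 :* k) := :- X :- con 8 :* k :+ con 1 :* X) refl b₂ X₀ k)

          -- The derivative at its root X₀ of the cubic X³ + b₂X² + 8b₄X + 16b₆.
          b' : Carrier
          b' = # (+ 3) * (X₀ * X₀) + # (+ 2) * b₂ * X₀ + # (+ 8) * b₄

          -- Substituting b₂ = -X₀ - 8k exhibits `b'` as a square modulo 8, on which the parity of
          -- t̂ rests.
          b'≡ : b' ≡ X₀ * X₀ + # (+ 8) * ℓ
          b'≡ = trans (cong (λ b → # (+ 3) * (X₀ * X₀) + # (+ 2) * b * X₀ + # (+ 8) * b₄) b₂≡')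
            (solve 3 (λ X k b → con 3 :* (X :* X) :+ con 2 :* (:- X :- con 8 :* k) :* X :+ con 8 :* b :=
              X :* X :+ con 8 :* (b :- con 2 :* k :* X)) refl X₀ k b₄)

          norm≡ : S * S - d * (t̂ * t̂) ≡ b'
          norm≡ = combine₃ (# (+ 16)) e-norm (# (+ 8) * x₀) 4α (# (+ 8)) 2β
            (solve 8 (λ s d q x α β b₂ b₄ → let X = con 4 :* x in
              con 4 :* s :* (con 4 :* s) :- d :* (con 4 :* q :* (con 4 :* q)) :+
                (con 16 :* (con 3 :* (x :* x) :+ con 2 :* α :* x :+ β) :+ con 8 :* x :* b₂ :+ con 8 :* b₄) :=
              con 3 :* (X :* X) :+ con 2 :* b₂ :* X :+ con 8 :* b₄ :+
                (con 16 :* (s :* s :- d :* (q :* q)) :+ con 8 :* x :* (con 4 :* α) :+ con 8 :* (con 2 :* β))) refl s d q x₀ α β b₂ b₄)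

          trace≡ : d * (μ * μ) ≡ # (+ 2) * S + # (+ 3) * X₀ + b₂
          trace≡ = combine₂ (# (+ 4)) e-trace 1# 4α (solve 6 (λ s d m x α b₂ →
            d :* (con 2 :* m :* (con 2 :* m)) :+ (con 4 :* (con 2 :* s :+ con 3 :* x :+ α) :+ con 1 :* b₂) :=
            con 2 :* (con 4 :* s) :+ con 3 :* (con 4 :* x) :+ b₂ :+ (con 4 :* (d :* (m :* m)) :+ con 1 :* (con 4 :* α)))
            refl s d m x₀ α b₂)

          root≡ : X₀ * X₀ * X₀ + b₂ * (X₀ * X₀) + # (+ 8) * b₄ * X₀ + # (+ 16) * b₆ ≡ 0#
          root≡ = combine₁ (# (+ 16)) root (solve 4 (λ x b₂ b₄ b₆ → let X = con 4 :* x in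
            X :* X :* X :+ b₂ :* (X :* X) :+ con 8 :* b₄ :* X :+ con 16 :* b₆ :+ con 16 :* con 0 :=
            con 0 :+ con 16 :* (con 4 :* (x :* x :* x) :+ b₂ :* (x :* x) :+ con 2 :* b₄ :* x :+ b₆)) refl x₀ b₂ b₄ b₆)

          -- The second factor is the discriminant of the quadratic left after dividing the cubic by
          -- X - X₀. Times the square of the derivative at X₀ it is the discriminant of the cubic.
          discriminant≡ : b' * b' * ((# (+ 3) * X₀ + b₂) * (# (+ 3) * X₀ + b₂) - # (+ 4) * b') ≡ # (+ 256) * Δ
          discriminant≡ = begin
            b' * b' * ((# (+ 3) * X₀ + b₂) * (# (+ 3) * X₀ + b₂) - # (+ 4) * b')
              ≡⟨ solve 3 (λ X b₂ c → let b' = con 3 :* (X :* X) :+ con 2 :* b₂ :* X :+ con 8 :* c in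
                   let B = :- (X :* X :* X :+ b₂ :* (X :* X) :+ con 8 :* c :* X) in
                   b' :* b' :* ((con 3 :* X :+ b₂) :* (con 3 :* X :+ b₂) :- con 4 :* b') :=
                   :- (con 4 :* (b₂ :* b₂ :* b₂) :* B) :+ con 64 :* (b₂ :* b₂) :* (c :* c) :- con 2048 :* (c :* c :* c) :-
                     con 27 :* (B :* B) :+ con 144 :* b₂ :* c :* B) refl X₀ b₂ b₄ ⟩
            quintic (- (X₀ * X₀ * X₀ + b₂ * (X₀ * X₀) + # (+ 8) * b₄ * X₀))
              ≡⟨ cong quintic (combine₁ (- 1#) root≡ (solve 2 (λ z b → :- z :+ :- con 1 :* con 0 := b :+ :- con 1 :* (z :+ b)) refl
                   (X₀ * X₀ * X₀ + b₂ * (X₀ * X₀) + # (+ 8) * b₄ * X₀) (# (+ 16) * b₆))) ⟩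
            quintic (# (+ 16) * b₆)
              ≡⟨ solve 3 (λ b₂ c b₆ → let B = con 16 :* b₆ in
                   :- (con 4 :* (b₂ :* b₂ :* b₂) :* B) :+ con 64 :* (b₂ :* b₂) :* (c :* c) :- con 2048 :* (c :* c :* c) :-
                     con 27 :* (B :* B) :+ con 144 :* b₂ :* c :* B :=
                   con 64 :* (:- (b₂ :* b₂ :* (b₂ :* b₆ :- c :* c)) :- con 32 :* (c :* c :* c) :- con 108 :* (b₆ :* b₆) :+ con 36 :* b₂ :* c :* b₆)) refl b₂ b₄ b₆ ⟩
            # (+ 64) * (- (b₂ * b₂ * (b₂ * b₆ - b₄ * b₄)) - # (+ 32) * (b₄ * b₄ * b₄) - # (+ 108) * (b₆ * b₆) + # (+ 36) * b₂ * b₄ * b₆)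
              ≡⟨ cong (# (+ 64) *_) (sym 4Δ) ⟩
            # (+ 64) * (# (+ 4) * Δ)
              ≡⟨ solve 1 (λ z → con 64 :* (con 4 :* z) := con 256 :* z) refl Δ ⟩
            # (+ 256) * Δ ∎
            where
            quintic : Carrier → Carrier
            quintic B = - (# (+ 4) * (b₂ * b₂ * b₂) * B) + # (+ 64) * (b₂ * b₂) * (b₄ * b₄) - # (+ 2048) * (b₄ * b₄ * b₄) - # (+ 27) * (B * B) + # (+ 144) * b₂ * b₄ * B

          integral-S-t̂ : Int S × Int t̂
          integral-S-t̂ = NormIntegral.norm-integral loc δ δ-unit (subst (λ z → Int (S * S - z * δ * (t̂ * t̂))) (sym π≡2)
            (subst Int (sym norm≡) (Int-+ (Int-+ (Int-* (Int-# (+ 3)) (Int-* iX₀ iX₀)) (Int-* (2* Int-b₂) iX₀)) (Int-* (Int-# (+ 8)) Int-b₄))))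
          iS = proj₁ integral-S-t̂
          it̂ = proj₂ integral-S-t̂

          iμ : Int μ
          iμ = NormIntegral.d-square-integral loc δ δ-unit (subst (λ z → Int (z * δ * (μ * μ))) (sym π≡2)
            (subst Int (sym trace≡) (Int-+ (Int-+ (2* iS) (Int-* (Int-# (+ 3)) iX₀)) Int-b₂)))

          x' : Carrier
          x' = - 1# - # (+ 2) * j - # (+ 4) * k
          ix' : Int x'
          ix' = Int-- (Int-- (Int-neg (Int-# (+ 1))) (2* ij)) (4* ik)
          X₀-odd : X₀ ≡ 1# + # (+ 2) * x'
          X₀-odd = combine₂ 1# X₀≡ (- 1#) b₂≡ (solve 4 (λ X b j k →
            X :+ (con 1 :* (:- b :- con 8 :* k) :+ :- con 1 :* (con 1 :+ con 4 :* j)) :=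
            con 1 :+ con 2 :* (:- con 1 :- con 2 :* j :- con 4 :* k) :+ (con 1 :* X :+ :- con 1 :* b)) refl X₀ b₂ j k)

          X₀-unit : Unit X₀
          X₀-unit = subst Unit (sym X₀-odd) (Unit-+Max Unit-1 (Max-2* ix'))

          Max-8ℓ : Max (# (+ 8) * ℓ)
          Max-8ℓ = subst Max (solve 1 (λ z → con 2 :* (con 4 :* z) := con 8 :* z) refl ℓ) (Max-2* (4* iℓ))

          b'-unit : Unit b'
          b'-unit = subst Unit (sym b'≡) (Unit-+Max (Unit-* X₀-unit X₀-unit) Max-8ℓ)

          S-unit : Unit S
          S-unit = Unit-square iS (subst Unit (trans (cong (_+ d * (t̂ * t̂)) (sym norm≡)) (solve 2 (λ a b → a :- b :+ b := a) refl (S * S) (d * (t̂ * t̂))))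
            (Unit-+Max b'-unit (Max-*ʳ (Max-2* iδ) (Int-* it̂ it̂))))

          S-odd : ∃ λ s' → Int s' × S ≡ 1# + # (+ 2) * s'
          S-odd = odd iS (Unit⇒¬Max S-unit)
          s' = proj₁ S-odd
          is' = proj₁ (proj₂ S-odd)

          Max-of-δ : ∀ {z} → Int z → Max (δ * (z * z)) → Max z
          Max-of-δ {z} iz m' = by-cases (Max-or-Unit iz)
            where
            by-cases : Max z ⊎ Unit z → Max z
            by-cases (inj₁ mz) = mz
            by-cases (inj₂ uz) = ⊥-elim (Unit⇒¬Max (Unit-* δ-unit (Unit-* uz uz)) m')

          -- S and X₀ are odd, so their squares agree modulo 8. The norm equation then makes 2δt̂²
          -- divisible by 8, and δ is a unit.
          t̂-even : ∃ λ t₁ → Int t₁ × t̂ ≡ # (+ 2) * t₁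
          t̂-even =
            let n , in' , en = even (consecutive is')
                n' , in'' , en' = even (consecutive ix') in
            even (Max-of-δ it̂ (subst Max (sym (δt̂² en en')) (Max-4* (Int-- (Int-- in' in'') iℓ))))
            where
            δt̂² : ∀ {n n'} → s' * (s' + 1#) ≡ # (+ 2) * n → x' * (x' + 1#) ≡ # (+ 2) * n' → δ * (t̂ * t̂) ≡ # (+ 4) * (n - n' - ℓ)
            δt̂² {n} {n'} en en' = *-cancelˡ 2≢0 (begin
              # (+ 2) * (δ * (t̂ * t̂))
                ≡⟨ solve 3 (λ δ t S → con 2 :* (δ :* (t :* t)) := S :* S :- (S :* S :- con 2 :* δ :* (t :* t))) refl δ t̂ S ⟩
              S * S - (S * S - d * (t̂ * t̂))
                ≡⟨ cong (λ z → S * S - z) (trans norm≡ b'≡) ⟩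
              S * S - (X₀ * X₀ + # (+ 8) * ℓ)
                ≡⟨ cong₂ (λ a b → a * a - (b * b + # (+ 8) * ℓ)) (proj₂ (proj₂ S-odd)) X₀-odd ⟩
              (1# + # (+ 2) * s') * (1# + # (+ 2) * s') - ((1# + # (+ 2) * x') * (1# + # (+ 2) * x') + # (+ 8) * ℓ)
                ≡⟨ combine₂ (# (+ 4)) en (- # (+ 4)) en' (solve 5 (λ s x n n' l →
                     (con 1 :+ con 2 :* s) :* (con 1 :+ con 2 :* s) :- ((con 1 :+ con 2 :* x) :* (con 1 :+ con 2 :* x) :+ con 8 :* l) :+
                       (con 4 :* (con 2 :* n) :+ :- con 4 :* (con 2 :* n')) :=
                     con 2 :* (con 4 :* (n :- n' :- l)) :+ (con 4 :* (s :* (s :+ con 1)) :+ :- con 4 :* (x :* (x :+ con 1)))) refl s' x' n n' ℓ) ⟩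
              # (+ 2) * (# (+ 4) * (n - n' - ℓ)) ∎)

          δμ² : δ * (μ * μ) ≡ S + X₀ - # (+ 4) * k
          δμ² = *-cancelˡ 2≢0 (combine₂ 1# trace≡ 1# b₂≡' (solve 6 (λ δ μ S X b k →
            con 2 :* (δ :* (μ :* μ)) :+ (con 1 :* (con 2 :* S :+ con 3 :* X :+ b) :+ con 1 :* (:- X :- con 8 :* k)) :=
            con 2 :* (S :+ X :- con 4 :* k) :+ (con 1 :* (con 2 :* δ :* (μ :* μ)) :+ con 1 :* b)) refl δ μ S X₀ b₂ k))

          μ-even : ∃ λ β₁ → Int β₁ × μ ≡ # (+ 2) * β₁
          μ-even = even (Max-of-δ iμ (subst Max (sym (trans δμ² (trans
            (cong₂ (λ a b → a + b - # (+ 4) * k) (proj₂ (proj₂ S-odd)) X₀-odd)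
            (solve 3 (λ s x k → con 1 :+ con 2 :* s :+ (con 1 :+ con 2 :* x) :- con 4 :* k :=
              con 2 :* (con 1 :+ s :+ x :- con 2 :* k)) refl s' x' k))))
            (Max-2* (Int-- (Int-+ (Int-+ (Int-# (+ 1)) is') ix') (2* ik)))))

          -- X₀ is -1 modulo 4 and δμ² is 0 modulo 4, so S is 1 modulo 4. This fixes the sign of the
          -- middle coefficient in `not-8-unit`.
          S≡ : ∀ {β₁} → μ ≡ # (+ 2) * β₁ → S ≡ 1# + # (+ 4) * (δ * (β₁ * β₁) + # (+ 3) * k + j)
          S≡ {β₁} eμ = begin
            S                                                               ≡⟨ solve 3 (λ S X k → S := S :+ X :- con 4 :* k :- (X :- con 4 :* k)) refl S X₀ k ⟩
            S + X₀ - # (+ 4) * k - (X₀ - # (+ 4) * k)                       ≡⟨ cong₂ (λ a b → a - (b - # (+ 4) * k)) (trans (sym δμ²) (cong (λ m → δ * (m * m)) eμ)) X₀-odd ⟩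
            δ * (# (+ 2) * β₁ * (# (+ 2) * β₁)) - (1# + # (+ 2) * x' - # (+ 4) * k)
              ≡⟨ solve 4 (λ δ β j k → δ :* (con 2 :* β :* (con 2 :* β)) :- (con 1 :+ con 2 :* (:- con 1 :- con 2 :* j :- con 4 :* k) :- con 4 :* k) :=
                   con 1 :+ con 4 :* (δ :* (β :* β) :+ con 3 :* k :+ j)) refl δ β₁ j k ⟩
            1# + # (+ 4) * (δ * (β₁ * β₁) + # (+ 3) * k + j)                ∎

          -- By the trace and norm equations (dμ² - 2S)² - 4(S² - dt̂²) is the discriminant of the
          -- quadratic cofactor. With μ = 2β₁ and t̂ = 2t₁ it equals 32δ times the quartic
          -- expression, and `discriminant≡` applies.
          quartic : ∀ {β₁ t₁} → μ ≡ # (+ 2) * β₁ → t̂ ≡ # (+ 2) * t₁ →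
            b' * b' * δ * (# (+ 2) * δ * (β₁ * β₁ * (β₁ * β₁)) - S * (β₁ * β₁) + t₁ * t₁) ≡ # (+ 8) * Δ
          quartic {β₁} {t₁} eμ et = *-cancelˡ 4≢0 (*-cancelˡ 4≢0 (*-cancelˡ 2≢0 (begin
            # (+ 2) * (# (+ 4) * (# (+ 4) * (b' * b' * δ * (# (+ 2) * δ * (β₁ * β₁ * (β₁ * β₁)) - S * (β₁ * β₁) + t₁ * t₁))))
              ≡⟨ solve 5 (λ c δ β t S → let m = con 2 :* β in let u = con 2 :* t in let d = con 2 :* δ in
                   con 2 :* (con 4 :* (con 4 :* (c :* δ :* (con 2 :* δ :* (β :* β :* (β :* β)) :- S :* (β :* β) :+ t :* t)))) :=
                   c :* ((d :* (m :* m) :- con 2 :* S) :* (d :* (m :* m) :- con 2 :* S) :- con 4 :* (S :* S :- d :* (u :* u)))) refl (b' * b') δ β₁ t₁ S ⟩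
            b' * b' * ((d * (# (+ 2) * β₁ * (# (+ 2) * β₁)) - # (+ 2) * S) * (d * (# (+ 2) * β₁ * (# (+ 2) * β₁)) - # (+ 2) * S) - # (+ 4) * (S * S - d * (# (+ 2) * t₁ * (# (+ 2) * t₁))))
              ≡⟨ cong₂ (λ m u → b' * b' * ((d * (m * m) - # (+ 2) * S) * (d * (m * m) - # (+ 2) * S) - # (+ 4) * (S * S - d * (u * u)))) (sym eμ) (sym et) ⟩
            b' * b' * ((d * (μ * μ) - # (+ 2) * S) * (d * (μ * μ) - # (+ 2) * S) - # (+ 4) * (S * S - d * (t̂ * t̂)))
              ≡⟨ cong₂ (λ a b → b' * b' * ((a - # (+ 2) * S) * (a - # (+ 2) * S) - # (+ 4) * b)) trace≡ norm≡ ⟩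
            b' * b' * ((# (+ 2) * S + # (+ 3) * X₀ + b₂ - # (+ 2) * S) * (# (+ 2) * S + # (+ 3) * X₀ + b₂ - # (+ 2) * S) - # (+ 4) * b')
              ≡⟨ solve 4 (λ b' S X b₂ → b' :* b' :* ((con 2 :* S :+ con 3 :* X :+ b₂ :- con 2 :* S) :* (con 2 :* S :+ con 3 :* X :+ b₂ :- con 2 :* S) :- con 4 :* b') :=
                   b' :* b' :* ((con 3 :* X :+ b₂) :* (con 3 :* X :+ b₂) :- con 4 :* b')) refl b' S X₀ b₂ ⟩
            b' * b' * ((# (+ 3) * X₀ + b₂) * (# (+ 3) * X₀ + b₂) - # (+ 4) * b')
              ≡⟨ discriminant≡ ⟩
            # (+ 256) * Δ
              ≡⟨ solve 1 (λ z → con 256 :* z := con 2 :* (con 4 :* (con 4 :* (con 8 :* z)))) refl Δ ⟩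
            # (+ 2) * (# (+ 4) * (# (+ 4) * (# (+ 8) * Δ))) ∎)))

        no-descent : ⊥
        no-descent =
          let β₁ , iβ₁ , eμ = μ-even
              t₁ , it₁ , et = t̂-even
              w , w-unit , ew = Unit-inverse (Unit-* (Unit-* b'-unit b'-unit) δ-unit) in
          not-8-unit δ-unit (Int-+ (Int-+ (Int-* iδ (Int-* iβ₁ iβ₁)) (Int-* (Int-# (+ 3)) ik)) ij) iβ₁ it₁ (Unit-* Δ-unit w-unit)
            (trans (cong (λ S → # (+ 2) * δ * (β₁ * β₁ * (β₁ * β₁)) - S * (β₁ * β₁) + t₁ * t₁) (sym (S≡ eμ)))
              (combine₂ w (quartic eμ et) (- (# (+ 2) * δ * (β₁ * β₁ * (β₁ * β₁)) - S * (β₁ * β₁) + t₁ * t₁)) ew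
                (solve 4 (λ E w c z → E :+ (w :* (con 8 :* z) :+ :- E :* con 1) := con 8 :* (z :* w) :+ (w :* (c :* E) :+ :- E :* (c :* w)))
                  refl (# (+ 2) * δ * (β₁ * β₁ * (β₁ * β₁)) - S * (β₁ * β₁) + t₁ * t₁) w (b' * b' * δ) Δ)))

-- The localization of ℚ at a prime

fromℤ : ℤ → ℚ
fromℤ i = i ℚ./ 1

private
  toℚᵘ-fromℤ : ∀ i → ℚ.toℚᵘ (fromℤ i) ℚᵘ.≃ mkℚᵘ i 0
  toℚᵘ-fromℤ i = ℚP.toℚᵘ-fromℚᵘ (mkℚᵘ i 0)

fromℤ-+ : ∀ i j → fromℤ (i ℤ.+ j) ≡ fromℤ i ℚ.+ fromℤ j
fromℤ-+ i j = ℚP.toℚᵘ-injective (begin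
  ℚ.toℚᵘ (fromℤ (i ℤ.+ j))                        ≈⟨ toℚᵘ-fromℤ (i ℤ.+ j) ⟩
  mkℚᵘ (i ℤ.+ j) 0                                ≈⟨ *≡* (cong (ℤ._* (+ 1)) (sym (cong₂ ℤ._+_ (ℤP.*-identityʳ i) (ℤP.*-identityʳ j)))) ⟩
  mkℚᵘ i 0 ℚᵘ.+ mkℚᵘ j 0                          ≈⟨ ℚᵘP.+-cong (toℚᵘ-fromℤ i) (toℚᵘ-fromℤ j) ⟨
  ℚ.toℚᵘ (fromℤ i) ℚᵘ.+ ℚ.toℚᵘ (fromℤ j)          ≈⟨ ℚP.toℚᵘ-homo-+ (fromℤ i) (fromℤ j) ⟨
  ℚ.toℚᵘ (fromℤ i ℚ.+ fromℤ j)                    ∎)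
  where open ℚᵘP.≃-Reasoning

fromℤ-* : ∀ i j → fromℤ (i ℤ.* j) ≡ fromℤ i ℚ.* fromℤ j
fromℤ-* i j = ℚP.toℚᵘ-injective (begin
  ℚ.toℚᵘ (fromℤ (i ℤ.* j))                        ≈⟨ toℚᵘ-fromℤ (i ℤ.* j) ⟩
  mkℚᵘ i 0 ℚᵘ.* mkℚᵘ j 0                          ≈⟨ ℚᵘP.*-cong (toℚᵘ-fromℤ i) (toℚᵘ-fromℤ j) ⟨
  ℚ.toℚᵘ (fromℤ i) ℚᵘ.* ℚ.toℚᵘ (fromℤ j)          ≈⟨ ℚP.toℚᵘ-homo-* (fromℤ i) (fromℤ j) ⟨
  ℚ.toℚᵘ (fromℤ i ℚ.* fromℤ j)                    ∎)
  where open ℚᵘP.≃-Reasoning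

fromℤ-neg : ∀ i → fromℤ (ℤ.- i) ≡ ℚ.- fromℤ i
fromℤ-neg i = ℚP.toℚᵘ-injective (begin
  ℚ.toℚᵘ (fromℤ (ℤ.- i))                          ≈⟨ toℚᵘ-fromℤ (ℤ.- i) ⟩
  ℚᵘ.- mkℚᵘ i 0                                   ≈⟨ ℚᵘP.-‿cong (toℚᵘ-fromℤ i) ⟨
  ℚᵘ.- ℚ.toℚᵘ (fromℤ i)                           ≈⟨ ℚP.toℚᵘ-homo‿- (fromℤ i) ⟨
  ℚ.toℚᵘ (ℚ.- fromℤ i)                            ∎)
  where open ℚᵘP.≃-Reasoning

fromℤ-injective : ∀ {i j} → fromℤ i ≡ fromℤ j → i ≡ j
fromℤ-injective {i} {j} e with ℚᵘP.≃-trans (ℚᵘP.≃-sym (toℚᵘ-fromℤ i)) (ℚᵘP.≃-trans (ℚᵘP.≃-reflexive (cong ℚ.toℚᵘ e)) (toℚᵘ-fromℤ j))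
... | *≡* e' = trans (sym (ℤP.*-identityʳ i)) (trans e' (ℤP.*-identityʳ j))

*-denominator : ∀ q → q ℚ.* fromℤ (↧ q) ≡ fromℤ (↥ q)
*-denominator q@(mkℚ n d-1 c) = ℚP.toℚᵘ-injective (begin
  ℚ.toℚᵘ (q ℚ.* fromℤ (↧ q))                      ≈⟨ ℚP.toℚᵘ-homo-* q (fromℤ (↧ q)) ⟩
  ℚ.toℚᵘ q ℚᵘ.* ℚ.toℚᵘ (fromℤ (↧ q))              ≈⟨ ℚᵘP.*-cong (ℚᵘP.≃-refl {ℚ.toℚᵘ q}) (toℚᵘ-fromℤ (↧ q)) ⟩
  mkℚᵘ n d-1 ℚᵘ.* mkℚᵘ (+ suc d-1) 0              ≈⟨ *≡* (trans (ℤP.*-identityʳ _) (cong (λ k → n ℤ.* + suc k) (sym (ℕP.*-identityʳ d-1)))) ⟩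
  mkℚᵘ n 0                                        ≈⟨ toℚᵘ-fromℤ n ⟨
  ℚ.toℚᵘ (fromℤ n)                                ∎)
  where open ℚᵘP.≃-Reasoning

ℚ-field : Field
ℚ-field = record
  { Carrier = ℚ ; _+_ = ℚ._+_ ; _*_ = ℚ._*_ ; -_ = ℚ.-_ ; # = fromℤ
  ; isCommutativeRing = ℚP.+-*-isCommutativeRing
  ; _≟_ = ℚP._≟_
  ; inverse = λ q q≢0 → ℚ.1/_ q {{ℚ.≢-nonZero q≢0}} , ℚP.*-inverseʳ q {{ℚ.≢-nonZero q≢0}}
  ; #-+ = fromℤ-+ ; #-* = fromℤ-* ; #-neg = fromℤ-neg }

ℚ-fraction : ∀ q → ∃ λ n → ∃ λ d → Coprime ℤ.∣ n ∣ ℤ.∣ d ∣ × q ℚ.* fromℤ d ≡ fromℤ n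
ℚ-fraction q@(mkℚ n d-1 c) = n , + suc d-1 , Coprimality.recompute c , *-denominator q

module _ (F : Field) where
  open FieldTheory F

  module Fractions (#-injective : ∀ {i j} → # i ≡ # j → i ≡ j)
    (fraction-of : ∀ x → ∃ λ n → ∃ λ d → Coprime ℤ.∣ n ∣ ℤ.∣ d ∣ × x * # d ≡ # n)
    (p : ℕ) (p-prime : Prime p) where

    -- Any fraction with denominator prime to p is accepted, reduced or not, so that sums and
    -- products need no cancellation.
    Int : Carrier → Set
    Int q = ∃ λ a → ∃ λ b → ¬ p ℕD.∣ ℤ.∣ b ∣ × q * # b ≡ # a

    private
      ∤-* : ∀ {b c} → ¬ p ℕD.∣ ℤ.∣ b ∣ → ¬ p ℕD.∣ ℤ.∣ c ∣ → ¬ p ℕD.∣ ℤ.∣ b ℤ.* c ∣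
      ∤-* {b} {c} p∤b p∤c p∣bc with euclidsLemma ℤ.∣ b ∣ ℤ.∣ c ∣ p-prime (subst (p ℕD.∣_) (ℤP.abs-* b c) p∣bc)
      ... | inj₁ p∣b = p∤b p∣b
      ... | inj₂ p∣c = p∤c p∣c

      p∤1 : ¬ p ℕD.∣ 1
      p∤1 p∣1 = Primality.¬prime[1] (subst Prime (ℕD.∣1⇒≡1 p∣1) p-prime)

      p∤⇒≢0 : ∀ {b} → ¬ p ℕD.∣ ℤ.∣ b ∣ → # b ≢ 0#
      p∤⇒≢0 {b} p∤b e with #-injective {b} {+ 0} e
      ... | refl = p∤b (p ℕD.∣0)

      p∣⇒multiple : ∀ {a} → p ℕD.∣ ℤ.∣ a ∣ → ∃ λ a' → a ≡ + p ℤ.* a'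
      p∣⇒multiple {a} p∣a with ℤS.∣ᵤ⇒∣ {+ p} {a} p∣a
      ... | ℤS.divides a' e = a' , trans e (ℤP.*-comm a' (+ p))

      π : Carrier
      π = # (+ p)

      p≢0 : π ≢ 0#
      p≢0 e = Primality.¬prime[0] (subst Prime (ℤP.+-injective (#-injective {+ p} {+ 0} e)) p-prime)

      Int-+ : ∀ {x y} → Int x → Int y → Int (x + y)
      Int-+ {x} {y} (a , b , p∤b , e) (c , d , p∤d , e') = a ℤ.* d ℤ.+ c ℤ.* b , b ℤ.* d , ∤-* {b} {d} p∤b p∤d , (begin
        (x + y) * # (b ℤ.* d)                    ≡⟨ cong ((x + y) *_) (#-* b d) ⟩
        (x + y) * (# b * # d)                    ≡⟨ solve 4 (λ x y b d → (x :+ y) :* (b :* d) := x :* b :* d :+ y :* d :* b) refl x y (# b) (# d) ⟩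
        x * # b * # d + y * # d * # b            ≡⟨ cong₂ (λ u v → u * # d + v * # b) e e' ⟩
        # a * # d + # c * # b                    ≡⟨ cong₂ _+_ (#-* a d) (#-* c b) ⟨
        # (a ℤ.* d) + # (c ℤ.* b)                ≡⟨ #-+ (a ℤ.* d) (c ℤ.* b) ⟨
        # (a ℤ.* d ℤ.+ c ℤ.* b)                  ∎)
        where open ≡-Reasoning

      Int-* : ∀ {x y} → Int x → Int y → Int (x * y)
      Int-* {x} {y} (a , b , p∤b , e) (c , d , p∤d , e') = a ℤ.* c , b ℤ.* d , ∤-* {b} {d} p∤b p∤d , (begin
        x * y * # (b ℤ.* d)                      ≡⟨ cong (x * y *_) (#-* b d) ⟩
        x * y * (# b * # d)                      ≡⟨ solve 4 (λ x y b d → x :* y :* (b :* d) := x :* b :* (y :* d)) refl x y (# b) (# d) ⟩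
        x * # b * (y * # d)                      ≡⟨ cong₂ _*_ e e' ⟩
        # a * # c                                ≡⟨ #-* a c ⟨
        # (a ℤ.* c)                              ∎)
        where open ≡-Reasoning

      Int-neg : ∀ {x} → Int x → Int (- x)
      Int-neg {x} (a , b , p∤b , e) = ℤ.- a , b , p∤b ,
        trans (solve 2 (λ x b → :- x :* b := :- (x :* b)) refl x (# b)) (trans (cong (-_) e) (sym (#-neg a)))

      Int-# : ∀ i → Int (# i)
      Int-# i = i , + 1 , p∤1 , solve 1 (λ x → x :* con 1 := x) refl (# i)

      fraction : ∀ a {b} → ¬ p ℕD.∣ ℤ.∣ b ∣ → ∃ λ r → Int r × r * # b ≡ # a
      fraction a {b} p∤b with i , bi ← inverse (# b) (p∤⇒≢0 {b} p∤b) = # a * i , (a , b , p∤b , eq) , eq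
        where
        eq : # a * i * # b ≡ # a
        eq = combine₁ (# a) bi (solve 3 (λ a b i → a :* i :* b :+ a :* con 1 := a :+ a :* (b :* i)) refl (# a) (# b) i)

      π-or-unit : ∀ {x} → Int x → (∃ λ r → Int r × x ≡ π * r) ⊎ (∃ λ r → Int r × x * r ≡ 1#)
      π-or-unit {x} (a , b , p∤b , e) = by-cases (p ℕD.∣? ℤ.∣ a ∣)
        where
        multiple : ∀ {a' r} → a ≡ + p ℤ.* a' → r * # b ≡ # a' → x ≡ π * r
        multiple {a'} {r} refl rb = *-cancelˡ (p∤⇒≢0 {b} p∤b) (combine₃ 1# e 1# (#-* (+ p) a') (- π) rb
          (solve 6 (λ b x π r a' pa → b :* x :+ (con 1 :* pa :+ con 1 :* (π :* a') :+ :- π :* a') :=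
            b :* (π :* r) :+ (con 1 :* (x :* b) :+ con 1 :* pa :+ :- π :* (r :* b)))
            refl (# b) x π r (# a') (# (+ p ℤ.* a'))))
        invertible : ∀ {r} → r * # a ≡ # b → x * r ≡ 1#
        invertible {r} ra = *-cancelˡ (p∤⇒≢0 {b} p∤b) (combine₂ r e 1# ra (solve 4 (λ b x r a →
          b :* (x :* r) :+ (r :* a :+ con 1 :* b) := b :* con 1 :+ (r :* (x :* b) :+ con 1 :* (r :* a)))
          refl (# b) x r (# a)))
        by-cases : Dec (p ℕD.∣ ℤ.∣ a ∣) → (∃ λ r → Int r × x ≡ π * r) ⊎ (∃ λ r → Int r × x * r ≡ 1#)
        by-cases (yes p∣a) = let a' , ea = p∣⇒multiple {a} p∣a
                                 r , ir , rb = fraction a' {b} p∤b in inj₁ (r , ir , multiple ea rb)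
        by-cases (no p∤a) = let r , ir , ra = fraction b {a} p∤a in inj₂ (r , ir , invertible ra)

      π-nonunit : ∀ {r} → Int r → π * r ≢ 1#
      π-nonunit {r} (a , b , p∤b , e) e' = p∤b (subst (λ i → p ℕD.∣ ℤ.∣ i ∣)
        (#-injective {+ p ℤ.* a} {b} (trans (#-* (+ p) a) (combine₂ (- π) e (# b) e'
          (solve 4 (λ π a r b → π :* a :+ (:- π :* a :+ b :* con 1) := b :+ (:- π :* (r :* b) :+ b :* (π :* r)))
            refl π (# a) r (# b)))))
        (subst (p ℕD.∣_) (sym (ℤP.abs-* (+ p) a)) (ℕD.m∣m*n ℤ.∣ a ∣)))

      coprime⇒∤ : ∀ {m n} → Coprime m n → p ℕD.∣ n → ¬ p ℕD.∣ m
      coprime⇒∤ coprime p∣n p∣m = Primality.¬prime[1] (subst Prime (coprime (p∣m , p∣n)) p-prime)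

      -- Lowest terms enter here: when p divides the denominator it does not divide the numerator,
      -- so the reciprocal is p times an integral element.
      valuation : ∀ x → Int x ⊎ (∃ λ r → Int r × x * (π * r) ≡ 1#)
      valuation x = let n , d , coprime , e = fraction-of x in by-cases n d coprime e (p ℕD.∣? ℤ.∣ d ∣)
        where
        reciprocal : ∀ {n d c r} → ¬ p ℕD.∣ ℤ.∣ n ∣ → x * # d ≡ # n → d ≡ + p ℤ.* c → r * # n ≡ # c →
          x * (π * r) ≡ 1#
        reciprocal {n} {d} {c} {r} p∤n e refl rn = *-cancelˡ (p∤⇒≢0 {n} p∤n) (begin
          # n * (x * (π * r))                ≡⟨ solve 4 (λ n x π r → n :* (x :* (π :* r)) := x :* (π :* (r :* n))) refl (# n) x π r ⟩
          x * (π * (r * # n))                ≡⟨ cong (λ u → x * (π * u)) rn ⟩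
          x * (π * # c)                      ≡⟨ cong (x *_) (#-* (+ p) c) ⟨
          x * # (+ p ℤ.* c)                  ≡⟨ e ⟩
          # n                                ≡⟨ solve 1 (λ n → n := n :* con 1) refl (# n) ⟩
          # n * 1#                           ∎)
          where open ≡-Reasoning
        by-cases : ∀ n d → Coprime ℤ.∣ n ∣ ℤ.∣ d ∣ → x * # d ≡ # n → Dec (p ℕD.∣ ℤ.∣ d ∣) →
          Int x ⊎ (∃ λ r → Int r × x * (π * r) ≡ 1#)
        by-cases n d _ e (no p∤d) = inj₁ (n , d , p∤d , e)
        by-cases n d coprime e (yes p∣d) =
          let p∤n = coprime⇒∤ coprime p∣d
              c , ed = p∣⇒multiple {d} p∣d
              r , ir , rn = fraction c {n} p∤n in
          inj₂ (r , ir , reciprocal p∤n e ed rn)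

    local : Localization F
    local = record
      { Int = Int ; Int-+ = Int-+ ; Int-* = Int-* ; Int-neg = Int-neg ; Int-# = Int-#
      ; π = π ; Int-π = Int-# (+ p) ; π-or-unit = π-or-unit ; π≢0 = p≢0 ; π-nonunit = π-nonunit
      ; valuation = valuation }

    open LocalTheory local using (Unit; Max; ¬Max⇒Unit)

    #-unit : ∀ i → ¬ p ℕD.∣ ℤ.∣ i ∣ → Unit (# i)
    #-unit i p∤i = ¬Max⇒Unit (Int-# i) λ { (r , (a , b , p∤b , e) , e') → ∤-* {i} {b} p∤i p∤b
      (subst (p ℕD.∣_) (trans (sym (ℤP.abs-* (+ p) a)) (cong ℤ.∣_∣ (#-injective {+ p ℤ.* a} {i ℤ.* b}
        (trans (#-* (+ p) a) (trans (combine₂ (- π) e (- # b) e'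
          (solve 5 (λ π a r b i → π :* a :+ (:- π :* a :+ :- b :* (π :* r)) := i :* b :+ (:- π :* (r :* b) :+ :- b :* i))
            refl π (# a) r (# b) (# i))) (sym (#-* i b))))))) (ℕD.m∣m*n ℤ.∣ a ∣)) }

    ∤-numerator⇒Unit : ∀ {x n d} → Int x → x * # d ≡ # n → ¬ p ℕD.∣ ℤ.∣ n ∣ → Unit x
    ∤-numerator⇒Unit {x} {n} {d} ix e p∤n with #-unit n p∤n
    ... | _ , r , ir , e' = ix , # d * r , Int-* (Int-# d) ir ,
      trans (solve 3 (λ q d r → q :* (d :* r) := q :* d :* r) refl x (# d) r) (trans (cong (_* r) e) e')

    denominator∤⇒Int : ∀ {x n d} → x * # d ≡ # n → ¬ p ℕD.∣ ℤ.∣ d ∣ → Int x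
    denominator∤⇒Int {x} {n} {d} e p∤d = n , d , p∤d , e

    numerator⇒Max : ∀ {x a b} → ¬ p ℕD.∣ ℤ.∣ b ∣ → x * # b ≡ # a → p ℕD.∣ ℤ.∣ a ∣ → Max x
    numerator⇒Max {x} {a} {b} p∤b e p∣a = by-cases (Max-or-Unit (a , b , p∤b , e))
      where
      open LocalTheory local using (Max-or-Unit; Unit-*; Unit⇒¬Max)
      by-cases : Max x ⊎ Unit x → Max x
      by-cases (inj₁ m) = m
      by-cases (inj₂ u) = let a' , ea = p∣⇒multiple {a} p∣a in
        ⊥-elim (Unit⇒¬Max (subst Unit e (Unit-* u (#-unit b p∤b))) (# a' , Int-# a' , trans (cong # ea) (#-* (+ p) a')))

    residue-mod-2 : p ≡ 2 → ∀ {x} → Int x → Max x ⊎ Max (x - 1#)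
    residue-mod-2 refl {x} (a , b , 2∤b , e) = by-parity (parity a) (parity b)
      where
      module ℤSolver = Data.Integer.Solver.+-*-Solver
      cancel-1 : ∀ k → + 1 ℤ.+ k ℤ.- + 1 ≡ k
      cancel-1 = ℤSolver.solve 1 (λ k → ℤSolver.con (+ 1) ℤSolver.:+ k ℤSolver.:- ℤSolver.con (+ 1) ℤSolver.:= k) refl
      parity : ∀ i → (+ 2) ℤS.∣ i ⊎ (+ 2) ℤS.∣ i ℤ.- + 1
      parity i = by-remainder (i ℤDM.%ℕ 2) (ℤDM.n%ℕd<d i 2) (ℤDM.a≡a%ℕn+[a/ℕn]*n i 2)
        where
        by-remainder : ∀ r → r ℕ.< 2 → i ≡ + r ℤ.+ (i ℤDM./ℕ 2) ℤ.* + 2 → (+ 2) ℤS.∣ i ⊎ (+ 2) ℤS.∣ i ℤ.- + 1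
        by-remainder 0 _ e = inj₁ (ℤS.divides (i ℤDM./ℕ 2) (trans e (ℤP.+-identityˡ _)))
        by-remainder 1 _ e = inj₂ (ℤS.divides (i ℤDM./ℕ 2) (trans (cong (ℤ._- + 1) e) (cancel-1 ((i ℤDM./ℕ 2) ℤ.* + 2))))
        by-remainder (suc (suc _)) (ℕ.s≤s (ℕ.s≤s ())) _
      by-parity : (+ 2) ℤS.∣ a ⊎ (+ 2) ℤS.∣ a ℤ.- + 1 → (+ 2) ℤS.∣ b ⊎ (+ 2) ℤS.∣ b ℤ.- + 1 → Max x ⊎ Max (x - 1#)
      by-parity (inj₁ 2∣a) _ = inj₁ (numerator⇒Max {x} {a} {b} 2∤b e (ℤS.∣⇒∣ᵤ 2∣a))
      by-parity _ (inj₁ 2∣b) = ⊥-elim (2∤b (ℤS.∣⇒∣ᵤ 2∣b))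
      by-parity (inj₂ 2∣a-1) (inj₂ 2∣b-1) = inj₂ (numerator⇒Max {x - 1#} {a ℤ.- b} {b} 2∤b
        (trans (solve 2 (λ x b → (x :- con 1) :* b := x :* b :- b) refl x (# b))
          (trans (cong (_- # b) e) (trans (cong (λ z → # a + z) (sym (#-neg b))) (sym (#-+ a (ℤ.- b))))))
        (ℤS.∣⇒∣ᵤ (subst ((+ 2) ℤS.∣_) difference (ℤS.∣m∣n⇒∣m-n 2∣a-1 2∣b-1))))
        where
        difference : (a ℤ.- + 1) ℤ.- (b ℤ.- + 1) ≡ a ℤ.- b
        difference = ℤSolver.solve 2 (λ a b → (a ℤSolver.:- ℤSolver.con (+ 1)) ℤSolver.:- (b ℤSolver.:- ℤSolver.con (+ 1)) ℤSolver.:= a ℤSolver.:- b) refl a b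

-- Torsion points of the quadratic extension

module _ (F : Field) (α β γ : Field.Carrier F) where
  open FieldTheory F
  open CubicCurve F α β γ

  module TwoTorsionTranslate
    {X Y ξ : Carrier} (onR : On (aff X Y)) (on-ξ : On (aff ξ 0#)) where

    Y≡0-at-root : X - ξ ≡ 0# → Y ≡ 0#
    Y≡0-at-root X≡ = by-cases (Y ≟ 0#)
      where
      by-cases : Dec (Y ≡ 0#) → Y ≡ 0#
      by-cases (yes e) = e
      by-cases (no Y≢0) = *≡0⇒ Y≢0 (trans onR (trans (cong f (-≡0⇒≡ X≡)) (trans (sym on-ξ) (solve 0 (con 0 :* con 0 := con 0) refl))))

    module _ (X≢ξ : X - ξ ≢ 0#) where
      λ' : Carrier
      λ' = proj₁ (inverse (X - ξ) X≢ξ) * Y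

      secant : (X - ξ) * λ' ≡ Y
      secant = combine₁ Y (proj₂ (inverse (X - ξ) X≢ξ)) (solve 3 (λ d i y →
        d :* (i :* y) :+ y :* con 1 := y :+ y :* (d :* i)) refl (X - ξ) (proj₁ (inverse (X - ξ) X≢ξ)) Y)

      translate≡ : aff X Y ⊕ aff ξ (- 0#) ≡ chord λ' X Y ξ
      translate≡ = ⊕-slope (λ opp → X≢ξ (proj₁ opp)) (secant⇒slope onR (On-neg (aff ξ 0#) on-ξ) X≢ξ
        (trans secant (solve 1 (λ y → y := y :- :- con 0) refl Y)))

      λ'² : λ' * λ' * (X - ξ) ≡ D X ξ
      λ'² = *-cancelˡ X≢ξ (combine₂ ((X - ξ) * λ' + Y) secant 1# difference≡ (solve 4 (λ d l y D →
        d :* (l :* l :* d) :+ ((d :* l :+ y) :* y :+ con 1 :* (d :* D)) := d :* D :+ ((d :* l :+ y) :* (d :* l) :+ con 1 :* (y :* y))) refl (X - ξ) λ' Y (D X ξ)))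
        where
        difference≡ : Y * Y ≡ (X - ξ) * D X ξ
        difference≡ = trans (solve 1 (λ y → y :* y := (y :+ con 0) :* (y :- con 0)) refl Y) (On-difference onR on-ξ)

      -- X' is the first coordinate of the translate by the point (ξ , 0) of order 2.
      product-eq : ∀ {X'} → λ' * λ' - α - X - ξ ≡ X' → (X' - ξ) * (X - ξ) ≡ D ξ ξ
      product-eq {X'} x-eq = combine₂ (- (X - ξ)) x-eq 1# λ'² (solve 6 (λ α β X ξ X' L →
        (X' :- ξ) :* (X :- ξ) :+ (:- (X :- ξ) :* X' :+ con 1 :* (X :* X :+ X :* ξ :+ ξ :* ξ :+ α :* (X :+ ξ) :+ β)) :=
        ξ :* ξ :+ ξ :* ξ :+ ξ :* ξ :+ α :* (ξ :+ ξ) :+ β :+ (:- (X :- ξ) :* (L :- α :- X :- ξ) :+ con 1 :* (L :* (X :- ξ))))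
        refl α β X ξ X' (λ' * λ'))

      -- The negative of the translate is the third point on the line through (X , Y) and (ξ , 0),
      -- so the translate itself is joined to (ξ , 0) by the mirrored line of slope -λ.
      opposite-slope : ∀ {X' Y'} → λ' * (X - X') - Y ≡ Y' → (X' - ξ) * (- λ') ≡ Y'
      opposite-slope {X'} {Y'} y-eq = combine₂ 1# y-eq (- 1#) secant (solve 6 (λ X X' ξ l y y' →
        (X' :- ξ) :* :- l :+ (con 1 :* y' :+ :- con 1 :* y) := y' :+ (con 1 :* (l :* (X :- X') :- y) :+ :- con 1 :* ((X :- ξ) :* l)))
        refl X X' ξ λ' Y Y')

module _ {F : Field} (loc : Localization F) where
  open LocalTheory loc

  module TorsionIsRational
    (p : ℕ) (π≡p : π ≡ # (+ p)) (δ : Carrier) (δ-unit : Unit δ) (2≢0 : # (+ 2) ≢ 0#)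
    (a₁ a₂ a₃ a₄ a₆ α β γ : Carrier)
    (4α : # (+ 4) * α ≡ Coefficients.b₂ F a₁ a₂ a₃ a₄ a₆)
    (2β : # (+ 2) * β ≡ Coefficients.b₄ F a₁ a₂ a₃ a₄ a₆)
    (4γ : # (+ 4) * γ ≡ Coefficients.b₆ F a₁ a₂ a₃ a₄ a₆)
    (int₁ : Int a₁) (int₂ : Int a₂) (int₃ : Int a₃) (int₄ : Int a₄) (int₆ : Int a₆)
    (Δ-unit : Unit (Coefficients.Δ F a₁ a₂ a₃ a₄ a₆)) where

    module G = GoodReduction loc δ δ-unit 2≢0 a₁ a₂ a₃ a₄ a₆ α β γ 4α 2β 4γ int₁ int₂ int₃ int₄ int₆ Δ-unit
    open G
    open Coefficients F a₁ a₂ a₃ a₄ a₆ using (b₂; b₄; b₆; b₈)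

    private
      Max-pK : KL.Max (KF.# (+ p))
      Max-pK = let u , u-unit , e = Unit-inverse δ-unit in (0# , u) , (Int-# (+ 0) , proj₁ u-unit) , cong₂ _,_
        (trans (sym π≡p) (combine₁ (- π) e (solve 4 (λ p δ u z → p :+ :- p :* con 1 :=
          con 0 :* con 0 :+ p :* δ :* (con 1 :* u) :+ :- p :* (δ :* u)) refl π δ u 0#)))
        (solve 1 (λ u → con 0 := con 0 :* u :+ con 1 :* con 0) refl u)

      p≢0K : KF.# (+ p) ≢ KF.0#
      p≢0K e = π≢0 (trans π≡p (cong proj₁ e))

      ι-- : ∀ x y → KF._-_ (ι x) (ι y) ≡ ι (x - y)
      ι-- x y = cong (x - y ,_) (solve 0 (con 0 :- con 0 := con 0) refl)

    open Neighbourhood quadraticLocalization (ι α) (ι β) (ι γ) nonsingular p Max-pK p≢0K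

    σ-· : ∀ n P → On P → σPt (n · P) ≡ n · σPt P
    σ-· zero P on = refl
    σ-· (suc n) P on = trans (σ-⊕ P (n · P) on (On-· n P on)) (cong (σPt P ⊕_) (σ-· n P on))

    On-defect : ∀ P → On P → On (defect P)
    On-defect P on = On-⊕ P (neg (σPt P)) on (On-neg (σPt P) (σ-On P on))

    -- The difference P - P̄ is additive in P: it inherits torsion, and replacing P by a multiple
    -- multiplies it.
    defect-· : ∀ n P → On P → defect (n · P) ≡ n · defect P
    defect-· n P on = begin
      n · P ⊕ neg (σPt (n · P))         ≡⟨ cong (λ R → n · P ⊕ neg R) (σ-· n P on) ⟩
      n · P ⊕ neg (n · σPt P)           ≡⟨ cong (n · P ⊕_) (·-neg n (σPt P) (σ-On P on)) ⟨
      n · P ⊕ n · neg (σPt P)           ≡⟨ ·-⊕ n P (neg (σPt P)) on (On-neg (σPt P) (σ-On P on)) ⟨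
      n · (P ⊕ neg (σPt P))             ∎
      where open ≡-Reasoning

    -- Because x lies in F, its reciprocal t is divisible by the uniformizer p of F and not only by
    -- √d. The reciprocal of x - e is t / (1 - et), whose denominator is a unit.
    near-defect : ∀ {e x m t Q} → Q ≡ aff (ι x) m → Max t → x * t ≡ 1# → Int e → ∃ λ T → Near (ι e) Q T
    near-defect {e} {x} {m} {t} eQ mt@(r , ir , et) xt ie =
      let _ , v , iv , ev = Unit-+Max Unit-1 (Max-neg (Max-*ˡ ie mt)) in
      ι (t * v) , ι x , m , eQ ,
      trans (cong (λ z → mulK z (ι (t * v))) (ι-- x e)) (trans (ι-* (x - e) (t * v)) (cong ι (combine₂ v xt 1# ev
        (solve 4 (λ x e t v → (x :- e) :* (t :* v) :+ (v :* con 1 :+ con 1 :* con 1) :=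
          con 1 :+ (v :* (x :* t) :+ con 1 :* ((con 1 :+ :- (e :* t)) :* v))) refl x e t v)))) ,
      ι (r * v) , (Int-* ir iv , Int-# (+ 0)) ,
      trans (cong ι (trans (cong (_* v) (trans et (cong (_* r) π≡p))) (solve 3 (λ p r v → p :* r :* v := p :* (r :* v)) refl (# (+ p)) r v)))
        (sym (ι-* (# (+ p)) (r * v)))

    module LargePrime {q : ℕ} (p≡ : p ≡ suc (suc q)) (3≤q : 3 ℕ.≤ q)
      (unit-< : ∀ m → 1 ℕ.≤ m → m ℕ.< p → Unit (# (+ m))) where
      private
        small : ∀ m → 1 ℕ.≤ m → m ℕ.≤ 4 → Unit (# (+ m))
        small m 1≤m m≤4 = unit-< m 1≤m (subst (m ℕ.<_) (sym p≡) (ℕP.≤-trans (s≤s m≤4) (s≤s (s≤s 3≤q))))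

        divide : ∀ {u x} → Unit u → Int (u * x) → Int x
        divide {u} {x} (_ , r , ir , e) i = subst Int (combine₁ x e (solve 3 (λ u x r → r :* (u :* x) :+ x :* con 1 := x :+ x :* (u :* r)) refl u x r)) (Int-* ir i)

        int-α : Int α
        int-α = divide (small 4 (s≤s z≤n) ℕP.≤-refl) (subst Int (sym 4α) Int-b₂)
        int-β : Int β
        int-β = divide (small 2 (s≤s z≤n) (s≤s (s≤s z≤n))) (subst Int (sym 2β) Int-b₄)
        int-γ : Int γ
        int-γ = divide (small 4 (s≤s z≤n) ℕP.≤-refl) (subst Int (sym 4γ) Int-b₆)

        third : ∃ λ r → Int r × # (+ 3) * r ≡ 1#
        third = proj₂ (small 3 (s≤s z≤n) (s≤s (s≤s (s≤s z≤n))))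
        -- Minus a third of α, the centre of the roots of the cubic. It is integral because 3 is a
        -- unit for p ≥ 5.
        e : Carrier
        e = - (α * proj₁ third)
        int-e : Int e
        int-e = Int-neg (Int-* int-α (proj₁ (proj₂ third)))
        centred : KF._+_ (ι α) (KF._*_ (KF.# (+ 3)) (ι e)) ≡ KF.0#
        centred = trans (cong (KF._+_ (ι α)) (ι-* (# (+ 3)) e)) (cong₂ _,_
          (combine₁ (- α) (proj₂ (proj₂ third)) (solve 2 (λ a r → a :+ con 3 :* :- (a :* r) :+ :- a :* con 1 := con 0 :+ :- a :* (con 3 :* r)) refl α (proj₁ third)))
          (solve 0 (con 0 :+ con 0 := con 0) refl))
        i0 = Int-# (+ 0)
        iKe : IntK (ι e)
        iKe = int-e , i0
        iKα : IntK (ι α)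
        iKα = int-α , i0
        ie² : IntK (mulK (ι e) (ι e))
        ie² = KL.Int-* {ι e} {ι e} iKe iKe
        int-A : IntK (D (ι e) (ι e))
        int-A = KL.Int-+ {_} {ι β} (KL.Int-+ (KL.Int-+ (KL.Int-+ ie² ie²) ie²) (KL.Int-* {ι α} iKα (KL.Int-+ {ι e} {ι e} iKe iKe))) (int-β , i0)
        int-B : IntK (f (ι e))
        int-B = KL.Int-+ {_} {ι γ} (KL.Int-+ (KL.Int-+ (KL.Int-* {_} {ι e} ie² iKe) (KL.Int-* {_} {ι e} (KL.Int-* {ι α} {ι e} iKα iKe) iKe))
          (KL.Int-* {ι β} {ι e} (int-β , i0) iKe)) (int-γ , i0)
        unit-<K : ∀ m → 1 ℕ.≤ m → m ℕ.< p → KL.Unit (KF.# (+ m))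
        unit-<K m 1≤m m<p = let im , u , iu , eu = unit-< m 1≤m m<p in
          (im , i0) , ι u , (iu , i0) , trans (ι-* (# (+ m)) u) (cong ι eu)
        open MultiplicationByP p≡ 3≤q unit-<K {ι e} centred int-A int-B
        open Torsion (ι e) (λ on near → inj₂ (multiplication-step on near))

      -- Torsion would make some p · (pʲQ) the origin, while `multiplication-step` keeps it an
      -- affine point near the origin.
      torsion-rational : ∀ P n → .{{_ : ℕ.NonZero n}} → On P → n · P ≡ O → σPt P ≢ P → ⊥
      torsion-rational P n on nP≡O ≢ =
        let x , m , eQ , t , mt , xt = defect-near-origin P on ≢
            T , near = near-defect eQ mt xt int-e
            onQ = On-defect P on
            j , T' , near' , p·≡O = torsion-killed n onQ near (trans (sym (defect-· n P on)) (cong defect nP≡O))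
            _ , _ , near'' = multiplication-step (On-· (p ℕ.^ j) (defect P) onQ) near' in
        Near⇒≢O near'' p·≡O

    module PrimeTwo (p≡2 : p ≡ 2) (residue : ∀ {x} → Int x → Max x ⊎ Max (x - 1#)) where
      private
        π≡2 : π ≡ # (+ 2)
        π≡2 = trans π≡p (cong (λ n → # (+ n)) p≡2)

      open Doubling p≡2 {ι b₂} {ι b₄} {ι b₆} {ι b₈}
        (trans (ι-* (# (+ 4)) α) (cong ι 4α)) (trans (ι-* (# (+ 2)) β) (cong ι 2β)) (trans (ι-* (# (+ 4)) γ) (cong ι 4γ))
        ι-b₈≡ (Int-b₂ , Int-# (+ 0)) (Int-b₄ , Int-# (+ 0)) (Int-b₆ , Int-# (+ 0)) (Int-b₈ , Int-# (+ 0))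
      open Torsion KF.0# doubling-step

      -- R - R̄ = (ι x₀ , 0) has order 2 and lies near the origin.
      module _ {X Y : K} {x₀ t' : Carrier} (onR : On (aff X Y)) (eR : defect (aff X Y) ≡ aff (ι x₀) KF.0#)
        (it' : Int t') (x₀t' : x₀ * (# (+ 2) * t') ≡ 1#) where
        private
          R = aff X Y
          ξ : K
          ξ = ι x₀
          on-ξ : On (aff ξ KF.0#)
          on-ξ = subst On eR (On-defect R onR)
          module TT = TwoTorsionTranslate quadratic (ι α) (ι β) (ι γ) {X} {Y} {ξ} onR on-ξ

          σR≡ : R ⊕ aff ξ (KF.- KF.0#) ≡ σPt R
          σR≡ = trans (cong (λ Q → R ⊕ neg Q) (sym eR)) (minus-defect R onR)

          -- Equal abscissae would give R = T, and R̄ = R - T would be the origin.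
          X≢ξ : KF._-_ X ξ ≢ KF.0#
          X≢ξ X≡ = O≢aff (trans (sym (⊕-inverseʳ R)) (trans (cong (λ Q → R ⊕ neg Q) R≡) σR≡))
            where
            O≢aff : ∀ {x y} → O ≢ aff x y
            O≢aff ()
            R≡ : R ≡ aff ξ KF.0#
            R≡ = aff-cong (KF.-≡0⇒≡ X≡) (TT.Y≡0-at-root X≡)

          λ' : K
          λ' = TT.λ' X≢ξ

          chord≡ : chord λ' X Y ξ ≡ σPt R
          chord≡ = trans (sym (TT.translate≡ X≢ξ)) σR≡

          x-eq : KF._-_ (KF._-_ (KF._-_ (mulK λ' λ') (ι α)) X) ξ ≡ conj X
          x-eq = aff-x chord≡
            where
            aff-x : ∀ {x y x' y'} → aff x y ≡ aff x' y' → x ≡ x'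
            aff-x refl = refl

          y-eq : KF._-_ (mulK λ' (KF._-_ X (conj X))) Y ≡ conj Y
          y-eq = trans (cong (λ z → KF._-_ (mulK λ' (KF._-_ X z)) Y) (sym x-eq)) (aff-y chord≡)
            where
            aff-y : ∀ {x y x' y'} → aff x y ≡ aff x' y' → y ≡ y'
            aff-y refl = refl

          a b l₀ l₁ : Carrier
          a = proj₁ X
          b = proj₂ X
          l₀ = proj₁ λ'
          l₁ = proj₂ λ'

          σX≢ξ : KF._-_ (conj X) ξ ≢ KF.0#
          σX≢ξ e = X≢ξ (cong₂ _,_ (cong proj₁ e) (trans (solve 1 (λ b → b :- con 0 := :- (:- b :- con 0)) refl b)
            (trans (cong (-_) (cong proj₂ e)) (solve 0 (:- con 0 := con 0) refl))))

          -- The conjugate line joins the conjugate points, so its slope is both λ̄ and -λ.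
          slope-anti-invariant : negK λ' ≡ conj λ'
          slope-anti-invariant = KF.*-cancelˡ σX≢ξ (trans (TT.opposite-slope X≢ξ y-eq)
            (trans (cong conj (sym (TT.secant X≢ξ))) (cong₂ _,_
              (solve 6 (λ d a b x l m → (a :- x) :* l :+ d :* ((b :- con 0) :* m) := (a :- x) :* l :+ d :* ((:- b :- con 0) :* :- m)) refl d a b x₀ l₀ l₁)
              (solve 5 (λ a b x l m → :- ((a :- x) :* m :+ (b :- con 0) :* l) := (a :- x) :* :- m :+ (:- b :- con 0) :* l) refl a b x₀ l₀ l₁))))

          l₀≡0 : l₀ ≡ 0#
          l₀≡0 = *≡0⇒ 2≢0 (combine₁ (- 1#) (cong proj₁ slope-anti-invariant) (solve 1 (λ z → con 2 :* z :+ :- con 1 :* z :=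
            con 0 :+ :- con 1 :* :- z) refl l₀))

          s : Carrier
          s = a - x₀
          d≡ : d ≡ # (+ 2) * δ
          d≡ = cong (_* δ) π≡2

          -- The line through R and T has abscissae X, x₀ and the conjugate of X, whose sum is λ² -
          -- α; here λ² = dl₁².
          e-trace : # (+ 2) * δ * (l₁ * l₁) ≡ # (+ 2) * s + # (+ 3) * x₀ + α
          e-trace = trans (cong (_* (l₁ * l₁)) (sym d≡)) (combine₂ 1# (cong proj₁ x-eq) (- l₀) l₀≡0 (solve 6 (λ d l m a x α →
            d :* (m :* m) :+ (con 1 :* a :+ :- l :* con 0) :=
            con 2 :* (a :- x) :+ con 3 :* x :+ α :+ (con 1 :* (l :* l :+ d :* (m :* m) :+ :- α :+ :- a :+ :- x) :+ :- l :* l)) refl d l₀ l₁ a x₀ α))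

          -- Translation by a point of order 2 with abscissa ξ sends X - ξ to `D ξ ξ` divided by X -
          -- ξ. As the translate of R is R̄, the norm of X - x₀ is the derivative at x₀.
          e-norm : s * s - # (+ 2) * δ * (b * b) ≡ # (+ 3) * (x₀ * x₀) + # (+ 2) * α * x₀ + β
          e-norm = trans (cong (λ z → s * s - z * (b * b)) (sym d≡)) (combine₁ 1# (cong proj₁ (TT.product-eq X≢ξ x-eq)) (solve 6 (λ d a b x α β →
            let z = con 0 in
            let xx = x :* x :+ d :* (z :* z) in
            (a :- x) :* (a :- x) :- d :* (b :* b) :+ con 1 :* (xx :+ xx :+ xx :+ (α :* (x :+ x) :+ d :* (z :* (z :+ z))) :+ β) :=
            con 3 :* (x :* x) :+ con 2 :* α :* x :+ β :+ con 1 :* ((a :- x) :* (a :- x) :+ d :* ((:- b :- z) :* (b :- z)))) refl d a b x₀ α β))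

          root : # (+ 4) * (x₀ * x₀ * x₀) + b₂ * (x₀ * x₀) + # (+ 2) * b₄ * x₀ + b₆ ≡ 0#
          root = trans (cong₂ (λ u v → # (+ 4) * (x₀ * x₀ * x₀) + u * (x₀ * x₀) + # (+ 2) * v * x₀ + b₆) (sym 4α) (sym 2β))
            (trans (cong (λ w → # (+ 4) * (x₀ * x₀ * x₀) + # (+ 4) * α * (x₀ * x₀) + # (+ 2) * (# (+ 2) * β) * x₀ + w) (sym 4γ))
            (combine₁ (- # (+ 4)) (cong proj₁ on-ξ) (solve 5 (λ d x α β γ → let z = con 0 in
              let xx = x :* x :+ d :* (z :* z) in let xx' = x :* z :+ z :* x in
              let αx = α :* x :+ d :* (z :* z) in let αx' = α :* z :+ z :* x in
              con 4 :* (x :* x :* x) :+ con 4 :* α :* (x :* x) :+ con 2 :* (con 2 :* β) :* x :+ con 4 :* γ :+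
                :- con 4 :* (xx :* x :+ d :* (xx' :* z) :+ (αx :* x :+ d :* (αx' :* z)) :+ (β :* x :+ d :* (z :* z)) :+ γ) :=
              con 0 :+ :- con 4 :* (z :* z :+ d :* (z :* z))) refl d x₀ α β γ)))

        order-two-impossible : ⊥
        order-two-impossible = TwoDescent.no-descent loc π≡2 residue δ-unit int₁ int₂ int₃ int₄ int₆
          it' x₀t' root {α} {β} {s} {b} {l₁} 4α 2β Δ-unit e-norm e-trace

      -- Passing to R = 2ʲP replaces the difference by its last nonzero multiple: R - R̄ = 2ʲ(P -
      -- P̄) is killed by 2 and near the origin.
      torsion-rational : ∀ P n → .{{_ : ℕ.NonZero n}} → On P → n · P ≡ O → σPt P ≢ P → ⊥
      torsion-rational P n on nP≡O ≢ =
        let x , m , eQ , t , mt , xt = defect-near-origin P on ≢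
            T , near = near-defect eQ mt xt (Int-# (+ 0))
            onQ = On-defect P on
            j , T' , near' , p·≡O = torsion-killed n onQ near (trans (sym (defect-· n P on)) (cong defect nP≡O)) in
        at-order-two ((p ℕ.^ j) · P) (On-· (p ℕ.^ j) P on)
          (subst (λ R → Near KF.0# R T') (sym (defect-· (p ℕ.^ j) P on)) near')
          (subst (λ R → p · R ≡ O) (sym (defect-· (p ℕ.^ j) P on)) p·≡O)
        where
        at-order-two : ∀ R {T} → On R → Near KF.0# (defect R) T → p · defect R ≡ O → ⊥
        at-order-two (aff X Y) {T} onR (x , y , eR , xT , r , ir , eT) pR≡O =
          order-two-impossible {X} {Y} {proj₁ x} {proj₁ r} onR (trans eR (aff-cong (proj₁ anti) y≡0)) (proj₁ ir) reciprocal
          where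
          anti : x ≡ ι (proj₁ x) × y ≡ (0# , proj₂ y)
          anti = anti-invariant (subst (λ Q → σPt Q ≡ neg Q) eR (σ-defect (aff X Y) onR))
          on-Q : On (aff x y)
          on-Q = subst On eR (On-defect (aff X Y) onR)
          2Q≡O : aff x y ⊕ aff x y ≡ O
          2Q≡O = trans (cong (aff x y ⊕_) (sym (⊕-identityʳ (aff x y)))) (trans (cong₂ _·_ (sym p≡2) (sym eR)) pR≡O)
          aff≢O : ∀ {x y} → ¬ (aff x y ≡ O)
          aff≢O ()
          y≡0 : y ≡ KF.0#
          y≡0 = by-view (sumView on-Q on-Q)
            where
            by-view : SumView x y x y → y ≡ KF.0#
            by-view (inj₁ (_ , 2y≡0)) = KF.*≡0⇒ (λ z → 2≢0 (cong proj₁ z)) (trans (KF.solve 1 (λ y → KF.con 2 KF.:* y KF.:= y KF.:+ y) refl y) 2y≡0)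
            by-view (inj₂ (¬opp , l , sl)) = ⊥-elim (aff≢O (trans (sym (⊕-slope ¬opp sl)) 2Q≡O))
          reciprocal : proj₁ x * (# (+ 2) * proj₁ r) ≡ 1#
          reciprocal = combine₃ 1# (cong proj₁ xT) (- proj₁ x) T≡ (- (d * proj₂ T)) (cong proj₂ (proj₁ anti))
            (solve 6 (λ x x' r T T' d → let z = con 0 in
              x :* (con 2 :* r) :+ (con 1 :* con 1 :+ :- x :* (con 2 :* r) :+ :- (d :* T') :* z) :=
              con 1 :+ (con 1 :* ((x :- z) :* T :+ d :* ((x' :- z) :* T')) :+ :- x :* T :+ :- (d :* T') :* x'))
              refl (proj₁ x) (proj₂ x) (proj₁ r) (proj₁ T) (proj₂ T) d)
            where
            T≡ : proj₁ T ≡ # (+ 2) * proj₁ r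
            T≡ = trans (cong proj₁ eT) (trans (cong (λ n → # (+ n) * proj₁ r + d * (0# * proj₂ r)) p≡2)
              (solve 3 (λ r r' d → con 2 :* r :+ d :* (con 0 :* r') := con 2 :* r) refl (proj₁ r) (proj₂ r) d))

    PrimeCase : Set
    PrimeCase = (p ≡ 2 × (∀ {x} → Int x → Max x ⊎ Max (x - 1#))) ⊎
      (∃ λ q → p ≡ suc (suc q) × 3 ℕ.≤ q × (∀ m → 1 ℕ.≤ m → m ℕ.< p → Unit (# (+ m))))

    no-irrational-torsion : PrimeCase →
      let module K√ = QuadraticExtension F (Ramified.d loc δ δ-unit) (LocalTheory.uniformizer-nonsquare loc δ-unit)
          module C = CubicCurve K√.quadratic (K√.ι α) (K√.ι β) (K√.ι γ) in
      ∀ Q n → .{{_ : ℕ.NonZero n}} → C.On Q → n C.· Q ≡ C.O →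
      (∀ X Y → Q ≡ C.aff X Y → ¬ (proj₂ X ≡ 0# × proj₂ Y ≡ 0#)) → Q ≢ C.O → ⊥
    no-irrational-torsion prime-case Q n on e irrational Q≢O = by-case prime-case
      where
      moved : ∀ R → (∀ X Y → R ≡ aff X Y → ¬ (proj₂ X ≡ 0# × proj₂ Y ≡ 0#)) → R ≢ O → σPt R ≢ R
      moved O _ R≢O _ = R≢O refl
      moved (aff X Y) irrational _ fixed = irrational X Y refl (fixed⇒rational fixed)
      by-case : PrimeCase → ⊥
      by-case (inj₁ (p≡2 , residue)) = PrimeTwo.torsion-rational p≡2 residue Q n on e (moved Q irrational Q≢O)
      by-case (inj₂ (q , p≡ , 3≤q , unit-<)) = LargePrime.torsion-rational p≡ 3≤q unit-< Q n on e (moved Q irrational Q≢O)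

-- From a Weierstrass equation to Y² = X³ + αX² + βX + γ

-- The substitution is X = κ²(x - ρ), Y = κ³(y + h(a₁x + a₃)) with h = 1/2.
module _ (F : Field) where
  open FieldTheory F

  module CompletingTheSquare (a₁ a₂ a₃ a₄ a₆ α β γ κ ρ h : Carrier)
    (κ≢0 : κ ≢ 0#) (2h : # (+ 2) * h ≡ 1#)
    (eα : α ≡ κ * κ * (# (+ 3) * ρ + (a₂ + h * h * (a₁ * a₁))))
    (eβ : β ≡ κ * κ * (κ * κ) * (# (+ 3) * ρ * ρ + # (+ 2) * ρ * (a₂ + h * h * (a₁ * a₁)) + (a₄ + # (+ 2) * (h * h) * (a₁ * a₃))))
    (eγ : γ ≡ κ * κ * (κ * κ) * (κ * κ) * (ρ * ρ * ρ + ρ * ρ * (a₂ + h * h * (a₁ * a₁)) + ρ * (a₄ + # (+ 2) * (h * h) * (a₁ * a₃)) + (a₆ + h * h * (a₃ * a₃)))) where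
    open CubicCurve F α β γ

    private
      A₂ A₄ A₆ κ² κ³ : Carrier
      A₂ = a₂ + h * h * (a₁ * a₁)
      A₄ = a₄ + # (+ 2) * (h * h) * (a₁ * a₃)
      A₆ = a₆ + h * h * (a₃ * a₃)
      κ² = κ * κ
      κ³ = κ * κ * κ

    X-of : Carrier → Carrier
    X-of x = κ * κ * (x - ρ)

    Y-of : Carrier → Carrier → Carrier
    Y-of x y = κ * κ * κ * (y + h * (a₁ * x + a₃))

    φ : Carrier → Carrier → Pt
    φ x y = aff (X-of x) (Y-of x y)

    Equation : Carrier → Carrier → Set
    Equation x y = y * y + a₁ * x * y + a₃ * y ≡ x * x * x + a₂ * x * x + a₄ * x + a₆

    private
      *≢0 : ∀ {x y} → x ≢ 0# → y ≢ 0# → x * y ≢ 0#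
      *≢0 x≢0 y≢0 e = y≢0 (*≡0⇒ x≢0 e)
      κ²≢0 : κ² ≢ 0#
      κ²≢0 = *≢0 κ≢0 κ≢0
      κ³≢0 : κ³ ≢ 0#
      κ³≢0 = *≢0 κ²≢0 κ≢0

      f-of-X : ∀ x → f (X-of x) ≡ κ³ * κ³ * (x * x * x + A₂ * (x * x) + A₄ * x + A₆)
      f-of-X x = combine₃ (X-of x * X-of x) eα (X-of x) eβ 1# eγ (solve 9 (λ κ ρ x A₂ A₄ A₆ α β γ →
        let X = κ :* κ :* (x :- ρ) in
        X :* X :* X :+ α :* X :* X :+ β :* X :+ γ :+
          (X :* X :* (κ :* κ :* (con 3 :* ρ :+ A₂)) :+
           X :* (κ :* κ :* (κ :* κ) :* (con 3 :* ρ :* ρ :+ con 2 :* ρ :* A₂ :+ A₄)) :+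
           con 1 :* (κ :* κ :* (κ :* κ) :* (κ :* κ) :* (ρ :* ρ :* ρ :+ ρ :* ρ :* A₂ :+ ρ :* A₄ :+ A₆))) :=
        κ :* κ :* κ :* (κ :* κ :* κ) :* (x :* x :* x :+ A₂ :* (x :* x) :+ A₄ :* x :+ A₆) :+ (X :* X :* α :+ X :* β :+ con 1 :* γ))
        refl κ ρ x A₂ A₄ A₆ α β γ)

      D-of-X : ∀ x → D (X-of x) (X-of x) ≡ κ² * κ² * (# (+ 3) * (x * x) + # (+ 2) * A₂ * x + A₄)
      D-of-X x = combine₂ (X-of x + X-of x) eα 1# eβ (solve 7 (λ κ ρ x A₂ A₄ α β →
        let X = κ :* κ :* (x :- ρ) in
        X :* X :+ X :* X :+ X :* X :+ α :* (X :+ X) :+ β :+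
          ((X :+ X) :* (κ :* κ :* (con 3 :* ρ :+ A₂)) :+
           con 1 :* (κ :* κ :* (κ :* κ) :* (con 3 :* ρ :* ρ :+ con 2 :* ρ :* A₂ :+ A₄))) :=
        κ :* κ :* (κ :* κ) :* (con 3 :* (x :* x) :+ con 2 :* A₂ :* x :+ A₄) :+ ((X :+ X) :* α :+ con 1 :* β))
        refl κ ρ x A₂ A₄ α β)

      square : ∀ x y → (y + h * (a₁ * x + a₃)) * (y + h * (a₁ * x + a₃)) - (x * x * x + A₂ * (x * x) + A₄ * x + A₆) ≡
        y * y + a₁ * x * y + a₃ * y - (x * x * x + a₂ * x * x + a₄ * x + a₆)
      square x y = combine₁ ((a₁ * x + a₃) * y) 2h (solve 8 (λ a₁ a₂ a₃ a₄ a₆ h x y → let z = y :+ h :* (a₁ :* x :+ a₃) in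
        z :* z :- (x :* x :* x :+ (a₂ :+ h :* h :* (a₁ :* a₁)) :* (x :* x) :+ (a₄ :+ con 2 :* (h :* h) :* (a₁ :* a₃)) :* x :+ (a₆ :+ h :* h :* (a₃ :* a₃))) :+
          (a₁ :* x :+ a₃) :* y :* con 1 :=
        y :* y :+ a₁ :* x :* y :+ a₃ :* y :- (x :* x :* x :+ a₂ :* x :* x :+ a₄ :* x :+ a₆) :+ (a₁ :* x :+ a₃) :* y :* (con 2 :* h))
        refl a₁ a₂ a₃ a₄ a₆ h x y)

      scaled-square : ∀ x y → Y-of x y * Y-of x y - f (X-of x) ≡ κ³ * κ³ * (y * y + a₁ * x * y + a₃ * y - (x * x * x + a₂ * x * x + a₄ * x + a₆))
      scaled-square x y = trans (cong (λ z → Y-of x y * Y-of x y - z) (f-of-X x)) (trans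
        (solve 3 (λ k z g → k :* z :* (k :* z) :- k :* k :* g := k :* k :* (z :* z :- g)) refl κ³ (y + h * (a₁ * x + a₃)) (x * x * x + A₂ * (x * x) + A₄ * x + A₆))
        (cong (κ³ * κ³ *_) (square x y)))

      *0 : ∀ x → x * 0# ≡ 0#
      *0 = solve 1 (λ x → x :* con 0 := con 0) refl

    Equation⇒On : ∀ {x y} → Equation x y → On (φ x y)
    Equation⇒On {x} {y} e = -≡0⇒≡ (trans (scaled-square x y) (trans (cong (κ³ * κ³ *_) (≡⇒-≡0 e)) (*0 (κ³ * κ³))))

    On⇒Equation : ∀ {x y} → On (φ x y) → Equation x y
    On⇒Equation {x} {y} on = -≡0⇒≡ (*≡0⇒ (*≢0 κ³≢0 κ³≢0) (trans (sym (scaled-square x y)) (≡⇒-≡0 on)))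

    x₃-of : Carrier → Carrier → Carrier → Carrier
    x₃-of l x₁ x₂ = l * l + a₁ * l - a₂ - x₁ - x₂

    third : Carrier → Carrier → Carrier → Carrier → Pt
    third l ν x₁ x₂ = φ (x₃-of l x₁ x₂) (- ((l + a₁) * x₃-of l x₁ x₂) - ν - a₃)

    private
      -- The slope dY/dX corresponding to dy/dx = l: Y grows by κ³(l + ha₁) while X grows by κ².
      slope-of : Carrier → Carrier
      slope-of l = κ * (l + h * a₁)

    chord-φ : ∀ {l ν x₁ y₁ x₂} → y₁ ≡ l * x₁ + ν → chord (slope-of l) (X-of x₁) (Y-of x₁ y₁) (X-of x₂) ≡ third l ν x₁ x₂
    chord-φ {l} {ν} {x₁} {y₁} {x₂} refl = aff-cong x-eq (trans (cong (λ z → slope-of l * (X-of x₁ - z) - Y-of x₁ y₁) x-eq)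
        (combine₁ (κ³ * - (a₁ * x₃ + a₃)) 2h
          (solve 9 (λ κ ρ h l ν x₁ x₃ a₁ a₃ →
            κ :* (l :+ h :* a₁) :* (κ :* κ :* (x₁ :- ρ) :- κ :* κ :* (x₃ :- ρ)) :- κ :* κ :* κ :* (l :* x₁ :+ ν :+ h :* (a₁ :* x₁ :+ a₃)) :+
              κ :* κ :* κ :* :- (a₁ :* x₃ :+ a₃) :* con 1 :=
            κ :* κ :* κ :* (:- ((l :+ a₁) :* x₃) :- ν :- a₃ :+ h :* (a₁ :* x₃ :+ a₃)) :+ κ :* κ :* κ :* :- (a₁ :* x₃ :+ a₃) :* (con 2 :* h))
            refl κ ρ h l ν x₁ x₃ a₁ a₃)))
      where
      x₃ = x₃-of l x₁ x₂
      x-eq : slope-of l * slope-of l - α - X-of x₁ - X-of x₂ ≡ X-of x₃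
      x-eq = combine₂ (- 1#) eα (κ² * (a₁ * l)) 2h (solve 9 (λ κ ρ h l x₁ x₂ a₁ a₂ α →
        κ :* (l :+ h :* a₁) :* (κ :* (l :+ h :* a₁)) :- α :- κ :* κ :* (x₁ :- ρ) :- κ :* κ :* (x₂ :- ρ) :+
          (:- con 1 :* (κ :* κ :* (con 3 :* ρ :+ (a₂ :+ h :* h :* (a₁ :* a₁)))) :+ κ :* κ :* (a₁ :* l) :* con 1) :=
        κ :* κ :* (l :* l :+ a₁ :* l :- a₂ :- x₁ :- x₂ :- ρ) :+ (:- con 1 :* α :+ κ :* κ :* (a₁ :* l) :* (con 2 :* h)))
        refl κ ρ h l x₁ x₂ a₁ a₂ α)

    φ-chord : ∀ {l ν x₁ y₁ x₂ y₂} → Equation x₁ y₁ → Equation x₂ y₂ → x₂ - x₁ ≢ 0# →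
      l * (x₂ - x₁) ≡ y₂ - y₁ → ν * (x₂ - x₁) ≡ y₁ * x₂ - y₂ * x₁ →
      φ x₁ y₁ ⊕ φ x₂ y₂ ≡ third l ν x₁ x₂
    φ-chord {l} {ν} {x₁} {y₁} {x₂} {y₂} e₁ e₂ x≢ el eν = trans (⊕-slope (λ opp → X≢ (proj₁ opp))
        (secant⇒slope (Equation⇒On e₁) (Equation⇒On e₂) X≢ (combine₁ (- κ³) el
          (solve 10 (λ κ ρ h l x₁ y₁ x₂ y₂ a₁ a₃ → (κ :* κ :* (x₁ :- ρ) :- κ :* κ :* (x₂ :- ρ)) :* (κ :* (l :+ h :* a₁)) :+ :- (κ :* κ :* κ) :* (y₂ :- y₁) :=
            κ :* κ :* κ :* (y₁ :+ h :* (a₁ :* x₁ :+ a₃)) :- κ :* κ :* κ :* (y₂ :+ h :* (a₁ :* x₂ :+ a₃)) :+ :- (κ :* κ :* κ) :* (l :* (x₂ :- x₁)))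
            refl κ ρ h l x₁ y₁ x₂ y₂ a₁ a₃)))) (chord-φ line)
      where
      X≢ : X-of x₁ - X-of x₂ ≢ 0#
      X≢ e = *≢0 κ²≢0 x≢ (combine₁ (- 1#) e (solve 4 (λ k ρ x₁ x₂ → k :* (x₂ :- x₁) :+ :- con 1 :* con 0 :=
        con 0 :+ :- con 1 :* (k :* (x₁ :- ρ) :- k :* (x₂ :- ρ))) refl κ² ρ x₁ x₂))
      line : y₁ ≡ l * x₁ + ν
      line = *-cancelˡ x≢ (combine₂ (- x₁) el (- 1#) eν (solve 6 (λ l ν x₁ y₁ x₂ y₂ →
        (x₂ :- x₁) :* y₁ :+ (:- x₁ :* (y₂ :- y₁) :+ :- con 1 :* (y₁ :* x₂ :- y₂ :* x₁)) :=
        (x₂ :- x₁) :* (l :* x₁ :+ ν) :+ (:- x₁ :* (l :* (x₂ :- x₁)) :+ :- con 1 :* (ν :* (x₂ :- x₁)))) refl l ν x₁ y₁ x₂ y₂))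

    φ-opposite : ∀ {x₁ y₁ x₂ y₂} → x₁ ≡ x₂ → y₁ + y₂ + a₁ * x₂ + a₃ ≡ 0# → φ x₁ y₁ ⊕ φ x₂ y₂ ≡ O
    φ-opposite {x} {y₁} {_} {y₂} refl e = ⊕-opposite (≡⇒-≡0 refl , combine₂ κ³ e (κ³ * (a₁ * x + a₃)) 2h
      (solve 7 (λ k h x y₁ y₂ a₁ a₃ → k :* (y₁ :+ h :* (a₁ :* x :+ a₃)) :+ k :* (y₂ :+ h :* (a₁ :* x :+ a₃)) :+ (k :* con 0 :+ k :* (a₁ :* x :+ a₃) :* con 1) :=
        con 0 :+ (k :* (y₁ :+ y₂ :+ a₁ :* x :+ a₃) :+ k :* (a₁ :* x :+ a₃) :* (con 2 :* h))) refl κ³ h x y₁ y₂ a₁ a₃))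

    -- Both ordinates are roots of one quadratic equation with coefficient a₁x + a₃, so they
    -- coincide unless they add up to the negative of it.
    same-y : ∀ {x y y₂} → Equation x y → Equation x y₂ → y + y₂ + a₁ * x + a₃ ≢ 0# → y ≡ y₂
    same-y {x} {y} {y₂} e₁ e₂ den≢ = -≡0⇒≡ (*≡0⇒ den≢ (combine₂ 1# e₁ (- 1#) e₂ (solve 6 (λ x y y₂ a₁ a₃ r →
        (y :+ y₂ :+ a₁ :* x :+ a₃) :* (y :- y₂) :+ (con 1 :* r :+ :- con 1 :* r) :=
        con 0 :+ (con 1 :* (y :* y :+ a₁ :* x :* y :+ a₃ :* y) :+ :- con 1 :* (y₂ :* y₂ :+ a₁ :* x :* y₂ :+ a₃ :* y₂)))
        refl x y y₂ a₁ a₃ (x * x * x + a₂ * x * x + a₄ * x + a₆))))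

    φ-tangent : ∀ {l ν x y} → Equation x y → # (+ 2) * y + a₁ * x + a₃ ≢ 0# →
      l * (# (+ 2) * y + a₁ * x + a₃) ≡ # (+ 3) * x * x + # (+ 2) * a₂ * x + a₄ - a₁ * y →
      ν * (# (+ 2) * y + a₁ * x + a₃) ≡ - (x * x * x) + a₄ * x + # (+ 2) * a₆ - a₃ * y →
      φ x y ⊕ φ x y ≡ third l ν x x
    φ-tangent {l} {ν} {x} {y} e₁ den≢ el eν =
        trans (⊕-slope (λ opp → Y≢ (proj₂ opp)) (tangent⇒slope (Equation⇒On e₁) (Equation⇒On e₁) Y≢ tangent)) (chord-φ line)
      where
      den : Carrier
      den = # (+ 2) * y + a₁ * x + a₃
      Y+Y : Y-of x y + Y-of x y ≡ κ³ * den
      Y+Y = combine₁ (κ³ * (a₁ * x + a₃)) 2h (solve 6 (λ k h x y a₁ a₃ → k :* (y :+ h :* (a₁ :* x :+ a₃)) :+ k :* (y :+ h :* (a₁ :* x :+ a₃)) :+ k :* (a₁ :* x :+ a₃) :* con 1 :=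
        k :* (con 2 :* y :+ a₁ :* x :+ a₃) :+ k :* (a₁ :* x :+ a₃) :* (con 2 :* h)) refl κ³ h x y a₁ a₃)
      Y≢ : Y-of x y + Y-of x y ≢ 0#
      Y≢ e = *≢0 κ³≢0 den≢ (trans (sym Y+Y) e)
      tangent : (Y-of x y + Y-of x y) * slope-of l ≡ D (X-of x) (X-of x)
      tangent = trans (cong (_* slope-of l) Y+Y) (trans (combine₂ (κ² * κ²) el (κ² * κ² * (a₁ * y)) 2h
          (solve 10 (λ κ h l x y a₁ a₂ a₃ a₄ z → let k = κ :* κ in let den = con 2 :* y :+ a₁ :* x :+ a₃ in
            κ :* κ :* κ :* den :* (κ :* (l :+ h :* a₁)) :+ (k :* k :* (con 3 :* x :* x :+ con 2 :* a₂ :* x :+ a₄ :- a₁ :* y) :+ k :* k :* (a₁ :* y) :* con 1) :=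
            k :* k :* (con 3 :* (x :* x) :+ con 2 :* a₂ :* x :+ a₄ :+ h :* (a₁ :* a₁) :* x :+ h :* (a₁ :* a₃)) :+ (k :* k :* (l :* den) :+ k :* k :* (a₁ :* y) :* (con 2 :* h)))
            refl κ h l x y a₁ a₂ a₃ a₄ 0#))
        (trans (combine₁ (- (κ² * κ² * h * (a₁ * a₁ * x + a₁ * a₃))) 2h (solve 8 (λ k h x a₁ a₂ a₃ a₄ z →
            k :* k :* (con 3 :* (x :* x) :+ con 2 :* a₂ :* x :+ a₄ :+ h :* (a₁ :* a₁) :* x :+ h :* (a₁ :* a₃)) :+ :- (k :* k :* h :* (a₁ :* a₁ :* x :+ a₁ :* a₃)) :* con 1 :=
            k :* k :* (con 3 :* (x :* x) :+ con 2 :* (a₂ :+ h :* h :* (a₁ :* a₁)) :* x :+ (a₄ :+ con 2 :* (h :* h) :* (a₁ :* a₃))) :+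
              :- (k :* k :* h :* (a₁ :* a₁ :* x :+ a₁ :* a₃)) :* (con 2 :* h)) refl κ² h x a₁ a₂ a₃ a₄ 0#))
          (sym (D-of-X x))))
      line : y ≡ l * x + ν
      line = *-cancelˡ den≢ (combine₃ (- x) el (- 1#) eν (# (+ 2)) e₁ (solve 9 (λ l ν x y a₁ a₂ a₃ a₄ a₆ → let den = con 2 :* y :+ a₁ :* x :+ a₃ in
        den :* y :+ (:- x :* (con 3 :* x :* x :+ con 2 :* a₂ :* x :+ a₄ :- a₁ :* y) :+ :- con 1 :* (:- (x :* x :* x) :+ a₄ :* x :+ con 2 :* a₆ :- a₃ :* y) :+
          con 2 :* (x :* x :* x :+ a₂ :* x :* x :+ a₄ :* x :+ a₆)) :=
        den :* (l :* x :+ ν) :+ (:- x :* (l :* den) :+ :- con 1 :* (ν :* den) :+ con 2 :* (y :* y :+ a₁ :* x :* y :+ a₃ :* y)))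
        refl l ν x y a₁ a₂ a₃ a₄ a₆))

module _ (F : Field) where
  open FieldTheory F

  module WeierstrassChange {a₁ a₂ a₃ a₄ a₆ a₁' a₂' a₃' a₄' a₆' u r s t h κ : Carrier}
    (2h : # (+ 2) * h ≡ 1#) (uκ : u * κ ≡ 1#)
    (e₁ : u * a₁' ≡ a₁ + # (+ 2) * s)
    (e₂ : u * u * a₂' ≡ a₂ - s * a₁ + # (+ 3) * r - s * s)
    (e₃ : u * u * u * a₃' ≡ a₃ + r * a₁ + # (+ 2) * t)
    (e₄ : u * u * u * u * a₄' ≡ a₄ - s * a₃ + # (+ 2) * r * a₂ - (t + r * s) * a₁ + # (+ 3) * r * r - # (+ 2) * s * t)
    (e₆ : u * u * u * u * u * u * a₆' ≡ a₆ + r * a₄ + r * r * a₂ + r * r * r - t * a₃ - t * t - r * t * a₁) where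

    private
      A₂ A₄ A₆ : Carrier
      A₂ = a₂ + h * h * (a₁ * a₁)
      A₄ = a₄ + # (+ 2) * (h * h) * (a₁ * a₃)
      A₆ = a₆ + h * h * (a₃ * a₃)

      divide-power : ∀ {x y n m} → n * m ≡ 1# → n * x ≡ y → x ≡ m * y
      divide-power {x} {y} {n} {m} nm e = combine₂ (- x) nm m e (solve 4 (λ x y n m → x :+ (:- x :* con 1 :+ m :* y) :=
        m :* y :+ (:- x :* (n :* m) :+ m :* (n :* x))) refl x y n m)

      u²κ² : u * u * (κ * κ) ≡ 1#
      u²κ² = trans (solve 2 (λ u k → u :* u :* (k :* k) := u :* k :* (u :* k)) refl u κ)
        (trans (cong (λ z → z * z) uκ) (solve 0 (con 1 :* con 1 := con 1) refl))
      u⁴κ⁴ : u * u * (u * u) * (κ * κ * (κ * κ)) ≡ 1#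
      u⁴κ⁴ = trans (solve 2 (λ u k → u :* u :* (u :* u) :* (k :* k :* (k :* k)) := u :* u :* (k :* k) :* (u :* u :* (k :* k))) refl u κ)
        (trans (cong (λ z → z * z) u²κ²) (solve 0 (con 1 :* con 1 := con 1) refl))
      u⁶κ⁶ : u * u * (u * u) * (u * u) * (κ * κ * (κ * κ) * (κ * κ)) ≡ 1#
      u⁶κ⁶ = trans (solve 2 (λ u k → u :* u :* (u :* u) :* (u :* u) :* (k :* k :* (k :* k) :* (k :* k)) := u :* u :* (u :* u) :* (k :* k :* (k :* k)) :* (u :* u :* (k :* k))) refl u κ)
        (trans (cong₂ _*_ u⁴κ⁴ u²κ²) (solve 0 (con 1 :* con 1 := con 1) refl))

      -- Completing the square is independent of s and t, because h(2s) = s and h(2t) = t.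
      c₁ : u * (h * a₁') ≡ h * a₁ + s
      c₁ = combine₂ h e₁ s 2h (solve 5 (λ u h a₁' a₁ s → u :* (h :* a₁') :+ (h :* (a₁ :+ con 2 :* s) :+ s :* con 1) :=
        h :* a₁ :+ s :+ (h :* (u :* a₁') :+ s :* (con 2 :* h))) refl u h a₁' a₁ s)
      c₃ : u * u * u * (h * a₃') ≡ h * a₃ + r * (h * a₁) + t
      c₃ = combine₂ h e₃ t 2h (solve 7 (λ u h a₃' a₃ a₁ r t → u :* u :* u :* (h :* a₃') :+ (h :* (a₃ :+ r :* a₁ :+ con 2 :* t) :+ t :* con 1) :=
        h :* a₃ :+ r :* (h :* a₁) :+ t :+ (h :* (u :* u :* u :* a₃') :+ t :* (con 2 :* h))) refl u h a₃' a₃ a₁ r t)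

    -- The square completed in the new equation equals the original one completed and rescaled with
    -- κ = 1/u and ρ = r. This and the next two identities let points of the original equation be
    -- carried directly to the model of the integral one.
    completed-α : a₂' + h * h * (a₁' * a₁') ≡ κ * κ * (# (+ 3) * r + A₂)
    completed-α = divide-power u²κ² (begin
      u * u * (a₂' + h * h * (a₁' * a₁'))
        ≡⟨ solve 4 (λ u a h b → u :* u :* (a :+ h :* h :* (b :* b)) := u :* u :* a :+ u :* (h :* b) :* (u :* (h :* b))) refl u a₂' h a₁' ⟩
      u * u * a₂' + u * (h * a₁') * (u * (h * a₁'))
        ≡⟨ cong₂ (λ a b → a + b * b) e₂ c₁ ⟩
      a₂ - s * a₁ + # (+ 3) * r - s * s + (h * a₁ + s) * (h * a₁ + s)
        ≡⟨ combine₁ (s * a₁) 2h (solve 5 (λ a₂ s a₁ r h → a₂ :- s :* a₁ :+ con 3 :* r :- s :* s :+ (h :* a₁ :+ s) :* (h :* a₁ :+ s) :+ s :* a₁ :* con 1 :=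
             con 3 :* r :+ (a₂ :+ h :* h :* (a₁ :* a₁)) :+ s :* a₁ :* (con 2 :* h)) refl a₂ s a₁ r h) ⟩
      # (+ 3) * r + A₂ ∎)
      where open ≡-Reasoning

    completed-β : a₄' + # (+ 2) * (h * h) * (a₁' * a₃') ≡ κ * κ * (κ * κ) * (# (+ 3) * r * r + # (+ 2) * r * A₂ + A₄)
    completed-β = divide-power u⁴κ⁴ (begin
      u * u * (u * u) * (a₄' + # (+ 2) * (h * h) * (a₁' * a₃'))
        ≡⟨ solve 5 (λ u a h b c → u :* u :* (u :* u) :* (a :+ con 2 :* (h :* h) :* (b :* c)) := u :* u :* u :* u :* a :+ con 2 :* (u :* (h :* b) :* (u :* u :* u :* (h :* c)))) refl u a₄' h a₁' a₃' ⟩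
      u * u * u * u * a₄' + # (+ 2) * (u * (h * a₁') * (u * u * u * (h * a₃')))
        ≡⟨ cong₂ (λ a b → a + # (+ 2) * b) e₄ (cong₂ _*_ c₁ c₃) ⟩
      a₄ - s * a₃ + # (+ 2) * r * a₂ - (t + r * s) * a₁ + # (+ 3) * r * r - # (+ 2) * s * t + # (+ 2) * ((h * a₁ + s) * (h * a₃ + r * (h * a₁) + t))
        ≡⟨ combine₁ (a₁ * t + s * a₃ + s * r * a₁) 2h (solve 8 (λ a₄ s a₃ r a₂ t a₁ h →
             a₄ :- s :* a₃ :+ con 2 :* r :* a₂ :- (t :+ r :* s) :* a₁ :+ con 3 :* r :* r :- con 2 :* s :* t :+ con 2 :* ((h :* a₁ :+ s) :* (h :* a₃ :+ r :* (h :* a₁) :+ t)) :+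
               (a₁ :* t :+ s :* a₃ :+ s :* r :* a₁) :* con 1 :=
             con 3 :* r :* r :+ con 2 :* r :* (a₂ :+ h :* h :* (a₁ :* a₁)) :+ (a₄ :+ con 2 :* (h :* h) :* (a₁ :* a₃)) :+
               (a₁ :* t :+ s :* a₃ :+ s :* r :* a₁) :* (con 2 :* h)) refl a₄ s a₃ r a₂ t a₁ h) ⟩
      # (+ 3) * r * r + # (+ 2) * r * A₂ + A₄ ∎)
      where open ≡-Reasoning

    completed-γ : a₆' + h * h * (a₃' * a₃') ≡ κ * κ * (κ * κ) * (κ * κ) * (r * r * r + r * r * A₂ + r * A₄ + A₆)
    completed-γ = divide-power u⁶κ⁶ (begin
      u * u * (u * u) * (u * u) * (a₆' + h * h * (a₃' * a₃'))
        ≡⟨ solve 4 (λ u a h c → u :* u :* (u :* u) :* (u :* u) :* (a :+ h :* h :* (c :* c)) := u :* u :* u :* u :* u :* u :* a :+ u :* u :* u :* (h :* c) :* (u :* u :* u :* (h :* c))) refl u a₆' h a₃' ⟩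
      u * u * u * u * u * u * a₆' + u * u * u * (h * a₃') * (u * u * u * (h * a₃'))
        ≡⟨ cong₂ (λ a b → a + b * b) e₆ c₃ ⟩
      a₆ + r * a₄ + r * r * a₂ + r * r * r - t * a₃ - t * t - r * t * a₁ + (h * a₃ + r * (h * a₁) + t) * (h * a₃ + r * (h * a₁) + t)
        ≡⟨ combine₁ (t * a₃ + r * t * a₁) 2h (solve 8 (λ a₆ r a₄ a₂ t a₃ a₁ h →
             a₆ :+ r :* a₄ :+ r :* r :* a₂ :+ r :* r :* r :- t :* a₃ :- t :* t :- r :* t :* a₁ :+ (h :* a₃ :+ r :* (h :* a₁) :+ t) :* (h :* a₃ :+ r :* (h :* a₁) :+ t) :+
               (t :* a₃ :+ r :* t :* a₁) :* con 1 :=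
             r :* r :* r :+ r :* r :* (a₂ :+ h :* h :* (a₁ :* a₁)) :+ r :* (a₄ :+ con 2 :* (h :* h) :* (a₁ :* a₃)) :+ (a₆ :+ h :* h :* (a₃ :* a₃)) :+
               (t :* a₃ :+ r :* t :* a₁) :* (con 2 :* h)) refl a₆ r a₄ a₂ t a₃ a₁ h) ⟩
      r * r * r + r * r * A₂ + r * A₄ + A₆ ∎)
      where open ≡-Reasoning

module _ (F : Field) where
  open FieldTheory F

  module HalvedInvariants {h : Carrier} (2h : # (+ 2) * h ≡ 1#) (a₁ a₂ a₃ a₄ a₆ : Carrier) where

    private
      4hh : # (+ 4) * (h * h) ≡ 1#
      4hh = trans (solve 1 (λ h → con 4 :* (h :* h) := con 2 :* h :* (con 2 :* h)) refl h)
        (trans (cong (λ z → z * z) 2h) (solve 0 (con 1 :* con 1 := con 1) refl))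

      scaled : ∀ n {m} a b → n * m ≡ 1# → n * (a + m * b) ≡ b + n * a
      scaled n {m} a b e = combine₁ b e (solve 4 (λ n m a b → n :* (a :+ m :* b) :+ b :* con 1 := b :+ n :* a :+ b :* (n :* m)) refl n m a b)

    4α : # (+ 4) * (a₂ + h * h * (a₁ * a₁)) ≡ a₁ * a₁ + # (+ 4) * a₂
    4α = scaled (# (+ 4)) a₂ (a₁ * a₁) 4hh

    2β : # (+ 2) * (a₄ + # (+ 2) * (h * h) * (a₁ * a₃)) ≡ # (+ 2) * a₄ + a₁ * a₃
    2β = trans (scaled (# (+ 2)) a₄ (a₁ * a₃) (trans (solve 1 (λ h → con 2 :* (con 2 :* (h :* h)) := con 4 :* (h :* h)) refl h) 4hh))
      (solve 2 (λ a b → a :+ b := b :+ a) refl (a₁ * a₃) (# (+ 2) * a₄))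

    4γ : # (+ 4) * (a₆ + h * h * (a₃ * a₃)) ≡ a₃ * a₃ + # (+ 4) * a₆
    4γ = scaled (# (+ 4)) a₆ (a₃ * a₃) 4hh

-- Comparison of the stated addition formulas with the chord and tangent law

module AdditionCases (d : ℤ) (W : Weierstrass) where
  private
    module QD = QuadField d
    module GL = GroupLaw d W

  third : Kd → Kd → Kd → Kd → Point
  third l ν x₁ x₂ = let x₃ = l QD.⊗ l QD.⊕ GL.A₁ QD.⊗ l QD.⊖ GL.A₂ QD.⊖ x₁ QD.⊖ x₂ in
    Point.aff x₃ (QD.neg ((l QD.⊕ GL.A₁) QD.⊗ x₃) QD.⊖ ν QD.⊖ GL.A₃)

  denominator slope-numerator intercept-numerator : Kd → Kd → Kd
  denominator x y = GL.c 2 QD.⊗ y QD.⊕ GL.A₁ QD.⊗ x QD.⊕ GL.A₃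
  slope-numerator x y = GL.c 3 QD.⊗ x QD.⊗ x QD.⊕ GL.c 2 QD.⊗ GL.A₂ QD.⊗ x QD.⊕ GL.A₄ QD.⊖ GL.A₁ QD.⊗ y
  intercept-numerator x y = QD.neg (x QD.⊗ x QD.⊗ x) QD.⊕ GL.A₄ QD.⊗ x QD.⊕ GL.c 2 QD.⊗ GL.A₆ QD.⊖ GL.A₃ QD.⊗ y

  -- A view of the stated addition when the abscissae agree, indexed by the result, so that the case
  -- distinction inside the definition is opened only once.
  data SameX (x x' y₁ y₂ : Kd) : Point → Set where
    opposite : y₁ QD.⊕ y₂ QD.⊕ GL.A₁ QD.⊗ x' QD.⊕ GL.A₃ ≡ QD.ι 0ℚ → SameX x x' y₁ y₂ Point.O
    tangent : y₁ QD.⊕ y₂ QD.⊕ GL.A₁ QD.⊗ x' QD.⊕ GL.A₃ ≢ QD.ι 0ℚ →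
      SameX x x' y₁ y₂ (third (slope-numerator x y₁ QD.⊘ denominator x y₁) (intercept-numerator x y₁ QD.⊘ denominator x y₁) x x')

  sameX : ∀ {x x' y₁ y₂} → x ≡ x' → SameX x x' y₁ y₂ (Point.aff x y₁ GL.⊞ Point.aff x' y₂)
  sameX {x} {x'} {y₁} {y₂} ex with x QD.≟K x'
  ... | no x≢ = ⊥-elim (x≢ ex)
  ... | yes _ with (y₁ QD.⊕ y₂ QD.⊕ GL.A₁ QD.⊗ x' QD.⊕ GL.A₃) QD.≟K QD.ι 0ℚ
  ...   | yes e = opposite e
  ...   | no ne = tangent ne

  chord-case : ∀ {x₁ y₁ x₂ y₂} → x₁ ≢ x₂ →
    Point.aff x₁ y₁ GL.⊞ Point.aff x₂ y₂ ≡ third ((y₂ QD.⊖ y₁) QD.⊘ (x₂ QD.⊖ x₁)) ((y₁ QD.⊗ x₂ QD.⊖ y₂ QD.⊗ x₁) QD.⊘ (x₂ QD.⊖ x₁)) x₁ x₂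
  chord-case {x₁} {y₁} {x₂} {y₂} x≢ with x₁ QD.≟K x₂
  ... | yes x≡ = ⊥-elim (x≢ x≡)
  ... | no _ = refl

module Transport (d : ℤ) (nonsquare : ∀ r → r ℚ.* r ≢ fromℤ d) (W : Weierstrass)
  (α β γ κ ρ h : ℚ) (κ≢0 : κ ≢ 0ℚ) where
  open Weierstrass W
  open FieldTheory ℚ-field
  open QuadraticExtension ℚ-field (fromℤ d) nonsquare
  private
    module KF = FieldTheory quadratic
    module QD = QuadField d
    module GL = GroupLaw d W
  open AdditionCases d W

  module _ (2h : # (+ 2) * h ≡ 1#)
    (eα : α ≡ κ * κ * (# (+ 3) * ρ + (a₂ + h * h * (a₁ * a₁))))
    (eβ : β ≡ κ * κ * (κ * κ) * (# (+ 3) * ρ * ρ + # (+ 2) * ρ * (a₂ + h * h * (a₁ * a₁)) + (a₄ + # (+ 2) * (h * h) * (a₁ * a₃))))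
    (eγ : γ ≡ κ * κ * (κ * κ) * (κ * κ) * (ρ * ρ * ρ + ρ * ρ * (a₂ + h * h * (a₁ * a₁)) + ρ * (a₄ + # (+ 2) * (h * h) * (a₁ * a₃)) + (a₆ + h * h * (a₃ * a₃)))) where

    open CubicCurve quadratic (ι α) (ι β) (ι γ)
    private
      A₂≡ = ‵ a₂ ⟨+⟩ ‵ h ⟨*⟩ ‵ h ⟨*⟩ (‵ a₁ ⟨*⟩ ‵ a₁)
      A₄≡ = ‵ a₄ ⟨+⟩ ‵ (# (+ 2)) ⟨*⟩ (‵ h ⟨*⟩ ‵ h) ⟨*⟩ (‵ a₁ ⟨*⟩ ‵ a₃)
      A₆≡ = ‵ a₆ ⟨+⟩ ‵ h ⟨*⟩ ‵ h ⟨*⟩ (‵ a₃ ⟨*⟩ ‵ a₃)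
      κ²≡ = ‵ κ ⟨*⟩ ‵ κ
      module CS = CompletingTheSquare quadratic (ι a₁) (ι a₂) (ι a₃) (ι a₄) (ι a₆) (ι α) (ι β) (ι γ) (ι κ) (ι ρ) (ι h)
        (λ e → κ≢0 (cong proj₁ e))
        (trans (ι-* (# (+ 2)) h) (cong ι 2h))
        (trans (cong ι eα) (sym (κ²≡ ⟨*⟩ (‵ (# (+ 3)) ⟨*⟩ ‵ ρ ⟨+⟩ A₂≡))))
        (trans (cong ι eβ) (sym (κ²≡ ⟨*⟩ κ²≡ ⟨*⟩ (‵ (# (+ 3)) ⟨*⟩ ‵ ρ ⟨*⟩ ‵ ρ ⟨+⟩ ‵ (# (+ 2)) ⟨*⟩ ‵ ρ ⟨*⟩ A₂≡ ⟨+⟩ A₄≡))))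
        (trans (cong ι eγ) (sym (κ²≡ ⟨*⟩ κ²≡ ⟨*⟩ κ²≡ ⟨*⟩ (‵ ρ ⟨*⟩ ‵ ρ ⟨*⟩ ‵ ρ ⟨+⟩ ‵ ρ ⟨*⟩ ‵ ρ ⟨*⟩ A₂≡ ⟨+⟩ ‵ ρ ⟨*⟩ A₄≡ ⟨+⟩ A₆≡))))

    φ : Point → Pt
    φ Point.O = O
    φ (Point.aff x y) = CS.φ x y

    private
      *invℚ : ∀ {q} → q ≢ 0ℚ → q * invℚ q ≡ 1#
      *invℚ {q} q≢0 with q ℚP.≟ 0ℚ
      ... | yes e = ⊥-elim (q≢0 e)
      ... | no q≢0' = ℚP.*-inverseʳ q {{ℚ.≢-nonZero q≢0'}}

      *-inv : ∀ x → x ≢ ι 0# → mulK x (QD.inv x) ≡ ι 1#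
      *-inv (a , b) x≢0 = norm-inverse {a} {b} {invℚ (a * a - # d * (b * b))} (*invℚ (norm≢0 x≢0))

      ⊘-cancel : ∀ {x} y → x ≢ ι 0# → mulK (y QD.⊘ x) x ≡ y
      ⊘-cancel {x} y x≢0 = KF.combine₁ y (*-inv x x≢0) (KF.solve 3 (λ x y i → y KF.:* i KF.:* x KF.:+ y KF.:* KF.con 1 KF.:= y KF.:+ y KF.:* (x KF.:* i)) refl x y (QD.inv x))

    private
      -- The operations on `Kd` and those of the field `quadratic` agree by computation. This and
      -- the following conversions confine that comparison to small terms.
      On-φ-aff : ∀ x y → GL.OnCurve (Point.aff x y) → CS.Equation x y
      On-φ-aff x y on = on
      φ-On-aff : ∀ x y → CS.Equation x y → GL.OnCurve (Point.aff x y)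
      φ-On-aff x y e = e

    On-φ : ∀ P → GL.OnCurve P → On (φ P)
    On-φ Point.O _ = tt
    On-φ (Point.aff x y) on = CS.Equation⇒On {x} {y} (On-φ-aff x y on)

    φ-On : ∀ P → On (φ P) → GL.OnCurve P
    φ-On Point.O _ = tt
    φ-On (Point.aff x y) on = φ-On-aff x y (CS.On⇒Equation {x} {y} on)

    private
      φ-third : ∀ l ν x₁ x₂ → φ (third l ν x₁ x₂) ≡ CS.third l ν x₁ x₂
      φ-third l ν x₁ x₂ = refl

      module Tangent (x y : K) where
        K-denominator K-slope-numerator K-intercept-numerator : K
        K-denominator = KF._+_ (KF._+_ (KF._*_ (KF.# (+ 2)) y) (KF._*_ (ι a₁) x)) (ι a₃)
        K-slope-numerator = KF._-_ (KF._+_ (KF._+_ (KF._*_ (KF._*_ (KF.# (+ 3)) x) x) (KF._*_ (KF._*_ (KF.# (+ 2)) (ι a₂)) x)) (ι a₄)) (KF._*_ (ι a₁) y)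
        K-intercept-numerator = KF._-_ (KF._+_ (KF._+_ (KF.-_ (KF._*_ (KF._*_ x x) x)) (KF._*_ (ι a₄) x)) (KF._*_ (KF.# (+ 2)) (ι a₆))) (KF._*_ (ι a₃) y)

        denominator≡ : denominator x y ≡ K-denominator
        denominator≡ = refl
        slope-numerator≡ : slope-numerator x y ≡ K-slope-numerator
        slope-numerator≡ = refl
        intercept-numerator≡ : intercept-numerator x y ≡ K-intercept-numerator
        intercept-numerator≡ = refl

      sum-with : K → K → K → K
      sum-with x y₁ y₂ = KF._+_ (KF._+_ (KF._+_ y₁ y₂) (KF._*_ (ι a₁) x)) (ι a₃)
      sum-with≡ : ∀ x y₁ y₂ → y₁ QD.⊕ y₂ QD.⊕ GL.A₁ QD.⊗ x QD.⊕ GL.A₃ ≡ sum-with x y₁ y₂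
      sum-with≡ x y₁ y₂ = refl

      difference≡ : ∀ x₁ x₂ → x₁ QD.⊖ x₂ ≡ KF._-_ x₁ x₂
      difference≡ x₁ x₂ = refl
      cross≡ : ∀ x₁ y₁ x₂ y₂ → y₁ QD.⊗ x₂ QD.⊖ y₂ QD.⊗ x₁ ≡ KF._-_ (KF._*_ y₁ x₂) (KF._*_ y₂ x₁)
      cross≡ x₁ y₁ x₂ y₂ = refl

      φ-chord-case : ∀ {x₁ y₁ x₂ y₂} → CS.Equation x₁ y₁ → CS.Equation x₂ y₂ → KF._-_ x₂ x₁ ≢ KF.0# →
        ∀ l ν → mulK l (x₂ QD.⊖ x₁) ≡ y₂ QD.⊖ y₁ → mulK ν (x₂ QD.⊖ x₁) ≡ y₁ QD.⊗ x₂ QD.⊖ y₂ QD.⊗ x₁ →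
        φ (third l ν x₁ x₂) ≡ CS.φ x₁ y₁ ⊕ CS.φ x₂ y₂
      φ-chord-case {x₁} {y₁} {x₂} {y₂} e₁ e₂ x≢ l ν el eν = trans (φ-third l ν x₁ x₂) (sym (CS.φ-chord {l} {ν} {x₁} {y₁} {x₂} {y₂} e₁ e₂ x≢
        (trans (cong (mulK l) (sym (difference≡ x₂ x₁))) (trans el (difference≡ y₂ y₁)))
        (trans (cong (mulK ν) (sym (difference≡ x₂ x₁))) (trans eν (cross≡ x₁ y₁ x₂ y₂)))))

      φ-tangent-case : ∀ {x y} → CS.Equation x y → Tangent.K-denominator x y ≢ KF.0# →
        ∀ l ν → mulK l (denominator x y) ≡ slope-numerator x y → mulK ν (denominator x y) ≡ intercept-numerator x y →
        φ (third l ν x x) ≡ CS.φ x y ⊕ CS.φ x y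
      φ-tangent-case {x} {y} e den≢0 l ν el eν = trans (φ-third l ν x x) (sym (CS.φ-tangent {l} {ν} {x} {y} e den≢0
          (trans (cong (mulK l) (sym denominator≡)) (trans el slope-numerator≡))
          (trans (cong (mulK ν) (sym denominator≡)) (trans eν intercept-numerator≡))))
        where open Tangent x y

    φ-⊞ : ∀ P Q → GL.OnCurve P → GL.OnCurve Q → φ (P GL.⊞ Q) ≡ φ P ⊕ φ Q
    φ-⊞ Point.O Q _ _ = refl
    φ-⊞ (Point.aff _ _) Point.O _ _ = refl
    φ-⊞ (Point.aff x₁ y₁) (Point.aff x₂ y₂) on₁ on₂ = by-x (x₁ QD.≟K x₂) (On-φ-aff x₁ y₁ on₁) (On-φ-aff x₂ y₂ on₂)
      where
      by-x : Dec (x₁ ≡ x₂) → CS.Equation x₁ y₁ → CS.Equation x₂ y₂ →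
        φ (Point.aff x₁ y₁ GL.⊞ Point.aff x₂ y₂) ≡ CS.φ x₁ y₁ ⊕ CS.φ x₂ y₂
      by-x (no x≢) e₁ e₂ = trans (cong φ (chord-case {x₁} {y₁} {x₂} {y₂} x≢)) (φ-chord-case {x₁} {y₁} {x₂} {y₂} e₁ e₂ x₂-x₁≢0
          ((y₂ QD.⊖ y₁) QD.⊘ (x₂ QD.⊖ x₁)) ((y₁ QD.⊗ x₂ QD.⊖ y₂ QD.⊗ x₁) QD.⊘ (x₂ QD.⊖ x₁))
          (⊘-cancel {x₂ QD.⊖ x₁} (y₂ QD.⊖ y₁) x₂-x₁≢0) (⊘-cancel {x₂ QD.⊖ x₁} (y₁ QD.⊗ x₂ QD.⊖ y₂ QD.⊗ x₁) x₂-x₁≢0))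
        where
        x₂-x₁≢0 : KF._-_ x₂ x₁ ≢ KF.0#
        x₂-x₁≢0 e = x≢ (sym (KF.-≡0⇒≡ {x₂} {x₁} e))
      by-x (yes refl) e₁ e₂ = by-view (sameX {x₁} {x₁} {y₁} {y₂} refl)
        where
        by-view : ∀ {R} → SameX x₁ x₁ y₁ y₂ R → φ R ≡ CS.φ x₁ y₁ ⊕ CS.φ x₁ y₂
        by-view (opposite den≡0) = sym (CS.φ-opposite {x₁} {y₁} {x₁} {y₂} refl (trans (sym (sum-with≡ x₁ y₁ y₂)) den≡0))
        by-view (tangent den≢0) = trans (φ-tangent-case {x₁} {y₁} e₁ den≢0' (slope-numerator x₁ y₁ QD.⊘ denominator x₁ y₁) (intercept-numerator x₁ y₁ QD.⊘ denominator x₁ y₁)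
            (⊘-cancel {denominator x₁ y₁} (slope-numerator x₁ y₁) (λ e → den≢0' (trans (sym (Tangent.denominator≡ x₁ y₁)) e)))
            (⊘-cancel {denominator x₁ y₁} (intercept-numerator x₁ y₁) (λ e → den≢0' (trans (sym (Tangent.denominator≡ x₁ y₁)) e))))
            (cong (λ y → CS.φ x₁ y₁ ⊕ CS.φ x₁ y) y₁≡y₂)
          where
          den≢ : sum-with x₁ y₁ y₂ ≢ KF.0#
          den≢ e = den≢0 (trans (sum-with≡ x₁ y₁ y₂) e)
          y₁≡y₂ : y₁ ≡ y₂
          y₁≡y₂ = CS.same-y {x₁} {y₁} {y₂} e₁ e₂ den≢
          den≢0' : Tangent.K-denominator x₁ y₁ ≢ KF.0#
          den≢0' e = den≢ (trans (cong (sum-with x₁ y₁) (sym y₁≡y₂))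
            (trans (cong (λ z → KF._+_ (KF._+_ z (KF._*_ (ι a₁) x₁)) (ι a₃)) (KF.solve 1 (λ y → y KF.:+ y KF.:= KF.con 2 KF.:* y) refl y₁)) e))

    -- The induction needs the multiples to lie on the curve. Closure under the stated addition is
    -- pulled back along `φ` from closure under the chord and tangent law.
    φ-mul : ∀ n P → GL.OnCurve P → φ (GL.mul n P) ≡ n · φ P × GL.OnCurve (GL.mul n P)
    φ-mul zero P on = refl , tt
    φ-mul (suc n) P on =
      let e , on' = φ-mul n P on
          e' = φ-⊞ P (GL.mul n P) on on' in
      trans e' (cong (φ P ⊕_) e) , φ-On _ (subst On (sym e') (On-⊕ (φ P) (φ (GL.mul n P)) (On-φ P on) (On-φ (GL.mul n P) on')))

    Rational : Pt → Set
    Rational O = ⊤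
    Rational (aff x y) = proj₂ x ≡ 0# × proj₂ y ≡ 0#

    φ-rational : ∀ P → Rational (φ P) → GL.IsRational P
    φ-rational Point.O _ = tt
    φ-rational (Point.aff (x , x') (y , y')) (eX , eY) = x'≡0 , y'≡0
      where
      open ≡-Reasoning
      κ²≢0 : κ * κ ≢ 0#
      κ²≢0 e = κ≢0 (*≡0⇒ κ≢0 e)
      κ³≢0 : κ * κ * κ ≢ 0#
      κ³≢0 e = κ≢0 (*≡0⇒ κ²≢0 e)
      x'≡0 : x' ≡ 0#
      x'≡0 = trans (sym (ℚP.+-identityʳ x')) (*≡0⇒ κ²≢0 (trans (sym (irrational-part (‵ κ ⟨*⟩ ‵ κ) (x + - ρ , x' + - 0#))) eX))
      w = KF._+_ (KF._*_ (ι a₁) (x , x')) (ι a₃)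
      w≡0 : proj₂ w ≡ 0#
      w≡0 = begin
        proj₂ w                          ≡⟨ ℚP.+-identityʳ _ ⟩
        proj₂ (mulK (ι a₁) (x , x'))     ≡⟨ irrational-part (‵ a₁) (x , x') ⟩
        a₁ * x'                          ≡⟨ cong (a₁ *_) x'≡0 ⟩
        a₁ * 0#                          ≡⟨ ℚP.*-zeroʳ a₁ ⟩
        0#                               ∎
      y'≡0 : y' ≡ 0#
      y'≡0 = begin
        y'                               ≡⟨ ℚP.+-identityʳ y' ⟨
        y' + 0#                          ≡⟨ cong (λ z → y' + z) (trans (cong (h *_) w≡0) (ℚP.*-zeroʳ h)) ⟨
        y' + h * proj₂ w                 ≡⟨ cong (λ z → y' + z) (irrational-part (‵ h) w) ⟨
        y' + proj₂ (mulK (ι h) w)        ≡⟨ *≡0⇒ κ³≢0 (trans (sym (irrational-part (‵ κ ⟨*⟩ ‵ κ ⟨*⟩ ‵ κ) (KF._+_ (y , y') (KF._*_ (ι h) w)))) eY) ⟩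
        0#                               ∎

open FieldTheory ℚ-field

-- `D` is kept apart from the image of d because the local theory constructs K from the product of p
-- and δ; the equation identifies the two fields.
transport : (d : ℤ) (D : ℚ) (nonsquare : ∀ r → r * r ≢ D) → D ≡ fromℤ d →
  ∀ W → let open Weierstrass W in ∀ (α β γ κ ρ h : ℚ) → κ ≢ 0ℚ → # (+ 2) * h ≡ 1# →
  α ≡ κ * κ * (# (+ 3) * ρ + (a₂ + h * h * (a₁ * a₁))) →
  β ≡ κ * κ * (κ * κ) * (# (+ 3) * ρ * ρ + # (+ 2) * ρ * (a₂ + h * h * (a₁ * a₁)) + (a₄ + # (+ 2) * (h * h) * (a₁ * a₃))) →
  γ ≡ κ * κ * (κ * κ) * (κ * κ) * (ρ * ρ * ρ + ρ * ρ * (a₂ + h * h * (a₁ * a₁)) + ρ * (a₄ + # (+ 2) * (h * h) * (a₁ * a₃)) + (a₆ + h * h * (a₃ * a₃))) →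
  let open GroupLaw d W in ∀ P n → OnCurve P → mul n P ≡ Point.O → ¬ IsRational P →
  let open QuadraticExtension ℚ-field D nonsquare
      open CubicCurve quadratic (ι α) (ι β) (ι γ) renaming (O to O'; aff to aff') in
  ∃ λ Q → On Q × n · Q ≡ O' × (∀ X Y → Q ≡ aff' X Y → ¬ (proj₂ X ≡ 0ℚ × proj₂ Y ≡ 0ℚ)) × Q ≢ O'
transport d _ nonsquare refl W α β γ κ ρ h κ≢0 2h eα eβ eγ P n on e ¬rational =
  φ 2h eα eβ eγ P , On-φ 2h eα eβ eγ P on , trans (sym (proj₁ (φ-mul 2h eα eβ eγ n P on))) (cong (φ 2h eα eβ eγ) e) ,
  (λ X Y eq rational → ¬rational (φ-rational 2h eα eβ eγ P (subst (Rational 2h eα eβ eγ) (sym eq) rational))) ,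
  (λ eq → ¬rational (φ-rational 2h eα eβ eγ P (subst (Rational 2h eα eβ eγ) (sym eq) tt)))
  where open Transport d nonsquare W α β γ κ ρ h κ≢0

2½ : # (+ 2) * ℚ.½ ≡ 1#
2½ = refl

-- Primes of good reduction dividing d

module GoodReductionContradiction (E : EllipticCurve) (d : ℤ) (square-free : SquareFree d) (p : ℕ) (p-prime : Prime p) (p≢3 : p ≢ 3)
  (δ : ℤ) (d≡ : d ≡ + p ℤ.* δ) where
  open Weierstrass (EllipticCurve.eqn E)

  open Fractions ℚ-field fromℤ-injective ℚ-fraction p p-prime
    using (Int; local; #-unit; denominator∤⇒Int; ∤-numerator⇒Unit; residue-mod-2)
  open LocalTheory local using (Unit; Max)

  -- Otherwise p² would divide d = pδ. Hence d is p times a p-adic unit and p ramifies in K.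
  p∤δ : ¬ p ℕD.∣ ℤ.∣ δ ∣
  p∤δ p∣δ = square-free p p-prime (subst (p ℕ.* p ℕD.∣_)
    (sym (trans (cong ℤ.∣_∣ d≡) (ℤP.abs-* (+ p) δ))) (ℕD.*-monoʳ-∣ p p∣δ))

  δ-unit : Unit (# δ)
  δ-unit = #-unit δ p∤δ

  2≢0 : # (+ 2) ≢ 0#
  2≢0 e with fromℤ-injective {+ 2} {+ 0} e
  ... | ()

  p-integral : ∀ {q} → PIntegral p q → Int q
  p-integral {q} i = denominator∤⇒Int {q} {↥ q} {↧ q} (*-denominator q) i

  prime-case : (p ≡ 2 × (∀ {x} → Int x → Max x ⊎ Max (x - 1#))) ⊎
    (∃ λ q → p ≡ suc (suc q) × 3 ℕ.≤ q × (∀ m → 1 ℕ.≤ m → m ℕ.< p → Unit (# (+ m))))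
  prime-case = by-size p refl
    where
    by-size : ∀ q → p ≡ q → (p ≡ 2 × (∀ {x} → Int x → Max x ⊎ Max (x - 1#))) ⊎
      (∃ λ q → p ≡ suc (suc q) × 3 ℕ.≤ q × (∀ m → 1 ℕ.≤ m → m ℕ.< p → Unit (# (+ m))))
    by-size 0 p≡0 = ⊥-elim (Primality.¬prime[0] (subst Prime p≡0 p-prime))
    by-size 1 p≡1 = ⊥-elim (Primality.¬prime[1] (subst Prime p≡1 p-prime))
    by-size 2 p≡2 = inj₁ (p≡2 , residue-mod-2 p≡2)
    by-size 3 p≡3 = ⊥-elim (p≢3 p≡3)
    by-size 4 p≡4 = ⊥-elim (from-no (Primality.prime? 4) (subst Prime p≡4 p-prime))
    by-size (suc (suc q@(suc (suc (suc _))))) p≡ = inj₂ (q , p≡ , s≤s (s≤s (s≤s z≤n)) ,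
      λ m 1≤m m<p → #-unit (+ m) (λ p∣m → ℕP.<⇒≱ m<p (ℕD.∣⇒≤ {{ℕ.>-nonZero 1≤m}} p∣m)))

  good-reduction : ∀ W' u r s t → IsoVia (EllipticCurve.eqn E) W' u r s t →
    PIntegral p (Weierstrass.a₁ W') → PIntegral p (Weierstrass.a₂ W') → PIntegral p (Weierstrass.a₃ W') →
    PIntegral p (Weierstrass.a₄ W') → PIntegral p (Weierstrass.a₆ W') → ¬ p ℕD.∣ ℤ.∣ ↥ Defs.disc W' ∣ → ¬ TorsionGrows E d
  good-reduction (weier a₁' a₂' a₃' a₄' a₆') u r s t (u≢0 , e₁ , e₂ , e₃ , e₄ , e₆) j₁ j₂ j₃ j₄ j₆ p∤Δ (P , on , (n , n≥1 , eP) , ¬rational) =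
    let Q , onQ , nQ≡O , irrational , Q≢O = transport d (Ramified.d local (# δ) δ-unit) (LocalTheory.uniformizer-nonsquare local δ-unit) D≡ (EllipticCurve.eqn E) α β γ κ r ℚ.½
          κ≢0 2½ WC.completed-α WC.completed-β WC.completed-γ P n on eP ¬rational in
    TorsionIsRational.no-irrational-torsion local p refl (# δ) δ-unit 2≢0 a₁' a₂' a₃' a₄' a₆' α β γ
      HI.4α HI.2β HI.4γ i₁ i₂ i₃ i₄ i₆ Δ-unit prime-case Q n {{ℕ.>-nonZero n≥1}} onQ nQ≡O irrational Q≢O
    where
    κ = proj₁ (inverse u u≢0)
    uκ : u * κ ≡ 1#
    uκ = proj₂ (inverse u u≢0)
    κ≢0 : κ ≢ 0ℚ
    κ≢0 κ≡0 = 1≢0 (trans (sym uκ) (trans (cong (u *_) κ≡0) (ℚP.*-zeroʳ u)))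
      where
      1≢0 : 1# ≢ 0#
      1≢0 ()
    module WC = WeierstrassChange ℚ-field {a₁} {a₂} {a₃} {a₄} {a₆} {a₁'} {a₂'} {a₃'} {a₄'} {a₆'} {u} {r} {s} {t} {ℚ.½} {κ} 2½ uκ e₁ e₂ e₃ e₄ e₆
    W' = weier a₁' a₂' a₃' a₄' a₆'
    i₁ = p-integral {a₁'} j₁
    i₂ = p-integral {a₂'} j₂
    i₃ = p-integral {a₃'} j₃
    i₄ = p-integral {a₄'} j₄
    i₆ = p-integral {a₆'} j₆
    Δ-unit : Unit (Defs.disc W')
    Δ-unit = ∤-numerator⇒Unit {Defs.disc W'} {↥ Defs.disc W'} {↧ Defs.disc W'} integral-Δ (*-denominator (Defs.disc W')) p∤Δ
      where
      integral-Δ : Int (Defs.disc W')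
      integral-Δ = IntegralInvariants.Int-Δ local {a₁'} {a₂'} {a₃'} {a₄'} {a₆'} i₁ i₂ i₃ i₄ i₆
    D≡ : Ramified.d local (# δ) δ-unit ≡ fromℤ d
    D≡ = trans (sym (#-* (+ p) δ)) (cong # (sym d≡))
    -- The quarter of b₂, half of b₄ and quarter of b₆ of the p-integral equation: the point P is
    -- carried from the equation of E to the completed square of this one.
    α = a₂' + ℚ.½ * ℚ.½ * (a₁' * a₁')
    β = a₄' + # (+ 2) * (ℚ.½ * ℚ.½) * (a₁' * a₃')
    γ = a₆' + ℚ.½ * ℚ.½ * (a₃' * a₃')
    module HI = HalvedInvariants ℚ-field {ℚ.½} 2½ a₁' a₂' a₃' a₄' a₆'

theorem6p1 : (E : EllipticCurve) (d : ℤ) → SquareFree d → d ≢ + 1 →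
    TorsionGrows E d →
    (p : ℕ) → Prime p → (+ p) ∣ d →
    DividesConductor p E ⊎ p ≡ 3
theorem6p1 E d square-free _ grows p p-prime p∣d = by-p (p ℕ.≟ 3)
  where
  by-p : Dec (p ≡ 3) → DividesConductor p E ⊎ p ≡ 3
  by-p (yes p≡3) = inj₂ p≡3
  by-p (no p≢3) = inj₁ by-discriminant
    where
    δ : ℤ
    δ = ℤS.quotient (ℤS.∣ᵤ⇒∣ {+ p} {d} p∣d)
    d≡ : d ≡ + p ℤ.* δ
    d≡ = trans (ℤS._∣_.equality (ℤS.∣ᵤ⇒∣ {+ p} {d} p∣d)) (ℤP.*-comm δ (+ p))
    open GoodReductionContradiction E d square-free p p-prime p≢3 δ d≡
    by-discriminant : DividesConductor p E
    -- Divisibility is decidable, so for each p-integral equation it suffices to refute a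
    -- discriminant prime to p.
    by-discriminant W' u r s t iso i₁ i₂ i₃ i₄ i₆ = by-cases (p ℕD.∣? ℤ.∣ ↥ Defs.disc W' ∣)
      where
      by-cases : Dec (p ℕD.∣ ℤ.∣ ↥ Defs.disc W' ∣) → p ℕD.∣ ℤ.∣ ↥ Defs.disc W' ∣
      by-cases (yes p∣Δ) = p∣Δ
      by-cases (no p∤Δ) = ⊥-elim (good-reduction W' u r s t iso i₁ i₂ i₃ i₄ i₆ p∤Δ grows)
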